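{- Let $\lambda_1,\lambda_2\in[0,1]$. If $G_1$ is an $(N_1,D_1,\lambda_1)$-graph on $[N_1]$ and $G_2$ is a $(D_1,D_2,\lambda_2)$-graph on $[D_1]$, then their replacement product $G$ is an $(N_1\cdot D_1,\,D_2+1,\,g(\lambda_1,\lambda_2,D_2))$-graph, where $$g(\lambda_1,\lambda_2,D_2)\le\bigl((1-p)+p\,f(\lambda_1,\lambda_2)\bigr)^{1/3},\qquad p=\frac{D_2^2}{(D_2+1)^3},$$ and $f(\lambda_1,\lambda_2)=\frac12(1-\lambda_2^2)\lambda_1+\frac12\sqrt{(1-\lambda_2^2)^2\lambda_1^2+4\lambda_2^2}$. In particular, $g(\lambda_1,\lambda_2,D_2)<1$ when $\lambda_1,\lambda_2<1$. Moreover, $\mathrm{Rot}_{G}$ can be computed in time $\mathrm{poly}(\log N_1,\log D_1,\log D_2)$ with one oracle query to $\mathrm{Rot}_{G_1}$ or $\mathrm{Rot}_{G_2}$.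
   Context: For a positive integer $n$, $[n]=\{1,\dots,n\}$. Graphs are finite, undirected and regular, and may have self-loops and parallel edges. A $D$-regular graph $G$ on $[N]$ is specified by its rotation map $\mathrm{Rot}_G:[N]\times[D]\to[N]\times[D]$: $\mathrm{Rot}_G(v,i)=(w,j)$ means that the $i$-th edge incident to $v$ leads to $w$ and that this edge is the $j$-th edge incident to $w$. Thus $\mathrm{Rot}_G$ is a permutation with $\mathrm{Rot}_G\circ\mathrm{Rot}_G=\mathrm{id}$ (and any such involution specifies a $D$-regular graph). Vertex sets and sets of edge labels may be any finite sets of the right cardinality. The normalized adjacency matrix of $G$ is the symmetric $N\times N$ matrix with $M_{u,v}=\frac1D|\{(i,j)\in[D]^2:\mathrm{Rot}_G(u,i)=(v,j)\}|$. The second largest eigenvalue in absolute value is $\lambda(G)=\max_{\alpha\perp 1_N,\,\alpha\ne0}\|M\alpha\|/\|\alpha\|$, where $1_N$ is the all-ones vector and the norm is Euclidean (with $\lambda(G)=0$ if $N=1$). An $(N,D,\lambda)$-graph is a $D$-regular graph on $N$ vertices with $\lambda(G)\le\lambda$. Replacement product: for a $D_1$-regular graph $G_1$ on $[N_1]$ and a $D_2$-regular graph $G_2$ on $[D_1]$, it is the $(D_2+1)$-regular graph on $[N_1]\times[D_1]$ whose rotation map on input $((v,k),i)$ is: if $i\le D_2$, let $(m,j)=\mathrm{Rot}_{G_2}(k,i)$ and output $((v,m),j)$; if $i=D_2+1$, output $(\mathrm{Rot}_{G_1}(v,k),i)$. Computation: $\mathrm{poly}(\cdot)$ denotes a fixed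 unspecified polynomial in its arguments. An algorithm with oracle access to a function may evaluate it on inputs of its choice at the cost of one time step per evaluation. One single algorithm, given the parameters as additional input, works for all graphs; the time and query counts are per evaluation of the rotation map. -}

module Defs where

open import Algebra.Bundles using (CommutativeRing)
open import Data.Bool.Base using (Bool; true; false)
open import Data.Empty using (⊥; ⊥-elim)
open import Data.Fin.Base using (Fin; toℕ; splitAt; join)
open import Data.Fin.Patterns using (3F; 4F; 5F)
open import Data.Fin.Properties as Fin using (splitAt-join; join-splitAt)
open import Data.List.Base using (List; []; _∷_; length; filter; cartesianProduct; allFin)
open import Data.Nat.Base as ℕ using (ℕ; zero; suc; NonZero)
open import Data.Nat.Binary.Base as ℕᵇ using (ℕᵇ; 2[1+_]; 1+[2_])
open import Data.Nat.Solver using (module +-*-Solver)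
open import Data.Product.Base using (∃; ∃₂; _×_; _,_; proj₁; proj₂; map₁; map₂)
open import Data.Product.Properties using (≡-dec)
open import Data.Sum.Base using (_⊎_; inj₁; inj₂)
open import Data.Vec.Base as Vec using (Vec; []; _∷_; lookup; _[_]≔_; replicate)
open import Function.Bundles using (_↔_; Inverse)
open import Level using (0ℓ)
open import Relation.Binary.Bundles using (Poset)
open import Relation.Binary.PropositionalEquality.Core as ≡ using (_≡_; _≢_)
open import Relation.Binary.Structures using (IsDecTotalOrder)
open import Relation.Nullary using (¬_; yes; no; contradiction)

-- ℝ is axiomatised, up to isomorphism, as a complete ordered field.  The
-- order axioms are the classical ones (a decidable total order).

record CompleteOrderedField : Set₁ where
  infix  4 _≤_
  infix  8 _⁻¹
  field
    commutativeRing : CommutativeRing 0ℓ 0ℓ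
  open CommutativeRing commutativeRing public
  field
    _≤_             : Carrier → Carrier → Set
    isDecTotalOrder : IsDecTotalOrder _≈_ _≤_
    0≉1             : ¬ 0# ≈ 1#
    +-monoˡ-≤       : ∀ {x y} z → x ≤ y → x + z ≤ y + z
    *-nonNeg        : ∀ {x y} → 0# ≤ x → 0# ≤ y → 0# ≤ x * y
    -- 0# ⁻¹ is an unspecified element.
    _⁻¹             : Carrier → Carrier
    *-inverseʳ      : ∀ x → ¬ x ≈ 0# → x * x ⁻¹ ≈ 1#

  UpperBound : (Carrier → Set) → Carrier → Set
  UpperBound P b = ∀ {x} → P x → x ≤ b

  field
    supremum : (P : Carrier → Set) → ∃ P → ∃ (UpperBound P) →
               ∃ λ s → UpperBound P s × (∀ {b} → UpperBound P b → s ≤ b)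

  infix 4 _<_
  _<_ : Carrier → Carrier → Set
  x < y = x ≤ y × ¬ x ≈ y

  infixl 7 _/_
  _/_ : Carrier → Carrier → Carrier
  x / y = x * y ⁻¹

  IsMaximum : (Carrier → Set) → Carrier → Set
  IsMaximum P m = P m × UpperBound P m

module Roots (ℝ : CompleteOrderedField) where

  open CompleteOrderedField ℝ
  open IsDecTotalOrder isDecTotalOrder
    using (total; antisym; _≤?_; _≟_; isPartialOrder)
    renaming (refl to ≤-refl; trans to ≤-trans; reflexive to ≤-reflexive)
  open import Algebra.Properties.Semiring.Exp semiring public using (_^_)
  open import Algebra.Properties.Semiring.Exp semiring using (^-congˡ)

  private
    open import Algebra.Solver.Ring.NaturalCoefficients.Default commutativeSemiring
      using (solve; _:=_; _:+_; _:*_; con)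
    ≤-poset : Poset 0ℓ 0ℓ 0ℓ
    ≤-poset = record { isPartialOrder = isPartialOrder }

    open import Relation.Binary.Reasoning.PartialOrder ≤-poset
    open import Algebra.Properties.Ring ring using (-‿distribˡ-*; -‿distribʳ-*; -‿involutive)

    +-monoʳ-≤ : ∀ {x y} z → x ≤ y → z + x ≤ z + y
    +-monoʳ-≤ {x} {y} z x≤y = begin
      z + x ≈⟨ +-comm z x ⟩
      x + z ≤⟨ +-monoˡ-≤ z x≤y ⟩
      y + z ≈⟨ +-comm y z ⟩
      z + y ∎

    +-mono-≤ : ∀ {x y u v} → x ≤ y → u ≤ v → x + u ≤ y + v
    +-mono-≤ {y = y} {u} x≤y u≤v = ≤-trans (+-monoˡ-≤ u x≤y) (+-monoʳ-≤ y u≤v)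

    x+[y-x]≈y : ∀ x y → x + (y - x) ≈ y
    x+[y-x]≈y x y = begin-equality
      x + (y - x)   ≈⟨ +-congˡ (+-comm y (- x)) ⟩
      x + (- x + y) ≈⟨ +-assoc x (- x) y ⟨
      x - x + y     ≈⟨ +-congʳ (-‿inverseʳ x) ⟩
      0# + y        ≈⟨ +-identityˡ y ⟩
      y             ∎

    0≤y-x : ∀ {x y} → x ≤ y → 0# ≤ y - x
    0≤y-x {x} {y} x≤y = begin
      0#    ≈⟨ -‿inverseʳ x ⟨
      x - x ≤⟨ +-monoˡ-≤ (- x) x≤y ⟩
      y - x ∎

    +-cancelˡ-≤ : ∀ x {y z} → x + y ≤ x + z → y ≤ z
    +-cancelˡ-≤ x {y} {z} p = begin
      y               ≈⟨ lem y ⟨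
      - x + (x + y)   ≤⟨ +-monoʳ-≤ (- x) p ⟩
      - x + (x + z)   ≈⟨ lem z ⟩
      z               ∎
      where
      lem : ∀ y → - x + (x + y) ≈ y
      lem y = begin-equality
        - x + (x + y) ≈⟨ +-assoc (- x) x y ⟨
        - x + x + y   ≈⟨ +-congʳ (-‿inverseˡ x) ⟩
        0# + y        ≈⟨ +-identityˡ y ⟩
        y             ∎

    *-monoʳ-≤ : ∀ {x y z} → 0# ≤ z → x ≤ y → z * x ≤ z * y
    *-monoʳ-≤ {x} {y} {z} 0≤z x≤y = begin
      z * x               ≈⟨ +-identityʳ (z * x) ⟨
      z * x + 0#          ≤⟨ +-monoʳ-≤ (z * x) (*-nonNeg 0≤z (0≤y-x x≤y)) ⟩
      z * x + z * (y - x) ≈⟨ distribˡ z x (y - x) ⟨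
      z * (x + (y - x))   ≈⟨ *-congˡ (x+[y-x]≈y x y) ⟩
      z * y               ∎

    *-monoˡ-≤ : ∀ {x y z} → 0# ≤ z → x ≤ y → x * z ≤ y * z
    *-monoˡ-≤ {x} {y} {z} 0≤z x≤y = begin
      x * z ≈⟨ *-comm x z ⟩
      z * x ≤⟨ *-monoʳ-≤ 0≤z x≤y ⟩
      z * y ≈⟨ *-comm z y ⟩
      y * z ∎

    *-mono-≤ : ∀ {x y u v} → 0# ≤ x → x ≤ y → 0# ≤ u → u ≤ v → x * u ≤ y * v
    *-mono-≤ 0≤x x≤y 0≤u u≤v =
      ≤-trans (*-monoˡ-≤ 0≤u x≤y) (*-monoʳ-≤ (≤-trans 0≤x x≤y) u≤v)

    +-nonNeg : ∀ {x y} → 0# ≤ x → 0# ≤ y → 0# ≤ x + y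
    +-nonNeg {x} {y} 0≤x 0≤y = begin
      0#      ≈⟨ +-identityˡ 0# ⟨
      0# + 0# ≤⟨ +-mono-≤ 0≤x 0≤y ⟩
      x + y   ∎

    x≤x+y : ∀ {x y} → 0# ≤ y → x ≤ x + y
    x≤x+y {x} {y} 0≤y = begin
      x      ≈⟨ +-identityʳ x ⟨
      x + 0# ≤⟨ +-monoʳ-≤ x 0≤y ⟩
      x + y  ∎

    y≤x+y : ∀ {x y} → 0# ≤ x → y ≤ x + y
    y≤x+y {x} {y} 0≤x = begin
      y      ≤⟨ x≤x+y 0≤x ⟩
      y + x  ≈⟨ +-comm y x ⟩
      x + y  ∎

    x²-nonNeg : ∀ x → 0# ≤ x * x
    x²-nonNeg x with total 0# x
    ... | inj₁ 0≤x = *-nonNeg 0≤x 0≤x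
    ... | inj₂ x≤0 = begin
      0#            ≤⟨ *-nonNeg 0≤-x 0≤-x ⟩
      - x * - x     ≈⟨ -x*-y≈x*y ⟩
      x * x         ∎
      where
      0≤-x : 0# ≤ - x
      0≤-x = begin
        0#      ≤⟨ 0≤y-x x≤0 ⟩
        0# - x  ≈⟨ +-identityˡ (- x) ⟩
        - x     ∎
      -x*-y≈x*y : - x * - x ≈ x * x
      -x*-y≈x*y = begin-equality
        - x * - x     ≈⟨ -‿distribˡ-* x (- x) ⟨
        - (x * - x)   ≈⟨ -‿cong (-‿distribʳ-* x x) ⟨
        - (- (x * x)) ≈⟨ -‿involutive (x * x) ⟩
        x * x         ∎

    0≤1 : 0# ≤ 1#
    0≤1 = begin
      0#      ≤⟨ x²-nonNeg 1# ⟩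
      1# * 1# ≈⟨ *-identityˡ 1# ⟩
      1#      ∎

    ⁻¹-nonNeg : ∀ {x} → 0# ≤ x → ¬ x ≈ 0# → 0# ≤ x ⁻¹
    ⁻¹-nonNeg {x} 0≤x x≉0 = begin
      0#                ≤⟨ *-nonNeg 0≤x (x²-nonNeg (x ⁻¹)) ⟩
      x * (x ⁻¹ * x ⁻¹) ≈⟨ *-assoc x (x ⁻¹) (x ⁻¹) ⟨
      x * x ⁻¹ * x ⁻¹   ≈⟨ *-congʳ (*-inverseʳ x x≉0) ⟩
      1# * x ⁻¹         ≈⟨ *-identityˡ (x ⁻¹) ⟩
      x ⁻¹              ∎

    ^-nonNeg : ∀ {x} n → 0# ≤ x → 0# ≤ x ^ n
    ^-nonNeg zero    0≤x = 0≤1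
    ^-nonNeg (suc n) 0≤x = *-nonNeg 0≤x (^-nonNeg n 0≤x)

    ^-mono-≤ : ∀ {x y} n → 0# ≤ x → x ≤ y → x ^ n ≤ y ^ n
    ^-mono-≤ zero    0≤x x≤y = ≤-refl
    ^-mono-≤ (suc n) 0≤x x≤y =
      *-mono-≤ 0≤x x≤y (^-nonNeg n 0≤x) (^-mono-≤ n 0≤x x≤y)

    1≤^ : ∀ {x} n → 1# ≤ x → 1# ≤ x ^ n
    1≤^ zero    1≤x = ≤-refl
    1≤^ {x} (suc n) 1≤x = begin
      1#        ≈⟨ *-identityˡ 1# ⟨
      1# * 1#   ≤⟨ *-mono-≤ 0≤1 1≤x 0≤1 (1≤^ n 1≤x) ⟩
      x * x ^ n ∎

    -- A bound on the slope of y ↦ y ^ n over an interval [y , y + 1].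
    slope : ℕ → Carrier → Carrier
    slope zero    y = 0#
    slope (suc n) y = y ^ n + (y + 1#) * slope n y

    slope-nonNeg : ∀ n {y} → 0# ≤ y → 0# ≤ slope n y
    slope-nonNeg zero    0≤y = ≤-refl
    slope-nonNeg (suc n) 0≤y =
      +-nonNeg (^-nonNeg n 0≤y) (*-nonNeg (+-nonNeg 0≤y 0≤1) (slope-nonNeg n 0≤y))

    slope-mono : ∀ n {x y} → 0# ≤ x → x ≤ y → slope n x ≤ slope n y
    slope-mono zero    0≤x x≤y = ≤-refl
    slope-mono (suc n) 0≤x x≤y =
      +-mono-≤ (^-mono-≤ n 0≤x x≤y)
        (*-mono-≤ (+-nonNeg 0≤x 0≤1) (+-monoˡ-≤ 1# x≤y)
                  (slope-nonNeg n 0≤x) (slope-mono n 0≤x x≤y))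

    increment : ∀ n {y h} → 0# ≤ y → 0# ≤ h → h ≤ 1# →
                (y + h) ^ n ≤ y ^ n + h * slope n y
    increment zero {y} {h} 0≤y 0≤h h≤1 = ≤-reflexive (begin-equality
      1#          ≈⟨ +-identityʳ 1# ⟨
      1# + 0#     ≈⟨ +-congˡ (zeroʳ h) ⟨
      1# + h * 0# ∎)
    increment (suc n) {y} {h} 0≤y 0≤h h≤1 = begin
      (y + h) * (y + h) ^ n
        ≤⟨ *-monoʳ-≤ (+-nonNeg 0≤y 0≤h) (increment n 0≤y 0≤h h≤1) ⟩
      (y + h) * (y ^ n + h * slope n y)
        ≈⟨ solve 4 (λ y h p c → (y :+ h) :* (p :+ h :* c)
                              := y :* p :+ h :* (p :+ (y :+ h) :* c))
                 refl y h (y ^ n) (slope n y) ⟩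
      y * y ^ n + h * (y ^ n + (y + h) * slope n y)
        ≤⟨ +-monoʳ-≤ _ (*-monoʳ-≤ 0≤h (+-monoʳ-≤ _
             (*-monoˡ-≤ (slope-nonNeg n 0≤y) (+-monoʳ-≤ y h≤1)))) ⟩
      y * y ^ n + h * (y ^ n + (y + 1#) * slope n y) ∎

    -- Given a gap d > 0 and a slope c ≥ 0, a step h ∈ (0 , 1] with h * c < d.
    step : ∀ {d c} → 0# ≤ d → ¬ d ≈ 0# → 0# ≤ c →
           ∃ λ h → 0# ≤ h × h ≤ 1# × ¬ h ≤ 0# × h * c ≤ d × ¬ d ≤ h * c
    step {d} {c} 0≤d d≉0 0≤c = h , 0≤h , h≤1 , h≰0 , hc≤d , d≰hc
      where
      e = 1# + (c + d)
      1≤e : 1# ≤ e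
      1≤e = x≤x+y (+-nonNeg 0≤c 0≤d)
      0≤e : 0# ≤ e
      0≤e = ≤-trans 0≤1 1≤e
      e≉0 : ¬ e ≈ 0#
      e≉0 e≈0 = 0≉1 (antisym 0≤1 (≤-trans 1≤e (≤-reflexive e≈0)))
      h = d * e ⁻¹
      0≤h : 0# ≤ h
      0≤h = *-nonNeg 0≤d (⁻¹-nonNeg 0≤e e≉0)
      he≈d : h * e ≈ d
      he≈d = begin-equality
        d * e ⁻¹ * e   ≈⟨ *-assoc d (e ⁻¹) e ⟩
        d * (e ⁻¹ * e) ≈⟨ *-congˡ (*-comm (e ⁻¹) e) ⟩
        d * (e * e ⁻¹) ≈⟨ *-congˡ (*-inverseʳ e e≉0) ⟩
        d * 1#         ≈⟨ *-identityʳ d ⟩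
        d              ∎
      h≤1 : h ≤ 1#
      h≤1 = begin
        d * e ⁻¹ ≤⟨ *-monoˡ-≤ (⁻¹-nonNeg 0≤e e≉0)
                      (≤-trans (y≤x+y 0≤c) (y≤x+y 0≤1)) ⟩
        e * e ⁻¹ ≈⟨ *-inverseʳ e e≉0 ⟩
        1#       ∎
      h≰0 : ¬ h ≤ 0#
      h≰0 h≤0 = d≉0 (begin-equality
        d      ≈⟨ he≈d ⟨
        h * e  ≈⟨ *-congʳ (antisym h≤0 0≤h) ⟩
        0# * e ≈⟨ zeroˡ e ⟩
        0#     ∎)
      hc+h≤d : h * c + h ≤ d
      hc+h≤d = begin
        h * c + h         ≤⟨ x≤x+y (*-nonNeg 0≤h 0≤d) ⟩
        h * c + h + h * d ≈⟨ solve 3 (λ h c d → h :* c :+ h :+ h :* d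
                                              := h :* (con 1 :+ (c :+ d)))
                                     refl h c d ⟩
        h * e             ≈⟨ he≈d ⟩
        d                 ∎
      hc≤d : h * c ≤ d
      hc≤d = ≤-trans (x≤x+y 0≤h) hc+h≤d
      d≰hc : ¬ d ≤ h * c
      d≰hc d≤hc = h≰0 (+-cancelˡ-≤ (h * c) (begin
        h * c + h  ≤⟨ hc+h≤d ⟩
        d          ≤⟨ d≤hc ⟩
        h * c      ≈⟨ +-identityʳ (h * c) ⟨
        h * c + 0# ∎))

    Below : ℕ → Carrier → Carrier → Set
    Below n x y = 0# ≤ y × y ^ n ≤ x

    gap≉0 : ∀ {x y} → ¬ x ≈ y → ¬ y - x ≈ 0#
    gap≉0 {x} {y} x≉y y-x≈0 = x≉y (begin-equality
      x           ≈⟨ +-identityʳ x ⟨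
      x + 0#      ≈⟨ +-congˡ y-x≈0 ⟨
      x + (y - x) ≈⟨ x+[y-x]≈y x y ⟩
      y           ∎)

    x+h≰x : ∀ {x h} → ¬ h ≤ 0# → ¬ x + h ≤ x
    x+h≰x {x} {h} h≰0 x+h≤x = h≰0 (+-cancelˡ-≤ x (begin
      x + h  ≤⟨ x+h≤x ⟩
      x      ≈⟨ +-identityʳ x ⟨
      x + 0# ∎))

    sup-not-below : ∀ n {x s} → 0# ≤ s → UpperBound (Below n x) s →
                    s ^ n ≤ x → ¬ s ^ n ≈ x → ⊥
    sup-not-below n {x} {s} 0≤s upper sⁿ≤x sⁿ≉x
      using h , 0≤h , h≤1 , h≰0 , hc≤d , _ ←
        step (0≤y-x sⁿ≤x) (gap≉0 sⁿ≉x) (slope-nonNeg n 0≤s)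
      = x+h≰x h≰0 (upper (+-nonNeg 0≤s 0≤h , (begin
          (s + h) ^ n           ≤⟨ increment n 0≤s 0≤h h≤1 ⟩
          s ^ n + h * slope n s ≤⟨ +-monoʳ-≤ (s ^ n) hc≤d ⟩
          s ^ n + (x - s ^ n)   ≈⟨ x+[y-x]≈y (s ^ n) x ⟩
          x                     ∎)))

    sup-not-above : ∀ n {x s} → 0# ≤ s → UpperBound (Below n x) s →
                    (∀ {b} → UpperBound (Below n x) b → s ≤ b) →
                    x ≤ s ^ n → ¬ x ≈ s ^ n → ⊥
    sup-not-above n {x} {s} 0≤s upper least x≤sⁿ x≉sⁿ
      using h , 0≤h , h≤1 , h≰0 , _ , d≰hc ←
        step (0≤y-x x≤sⁿ) (gap≉0 x≉sⁿ) (slope-nonNeg n 0≤s)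
      = x+h≰x h≰0 (begin
          s + h       ≤⟨ +-monoˡ-≤ h (least (s-h-upper 0≤h h≤1 d≰hc)) ⟩
          s - h + h   ≈⟨ +-comm (s - h) h ⟩
          h + (s - h) ≈⟨ x+[y-x]≈y h s ⟩
          s           ∎)
      where
      s-h-upper : ∀ {h} → 0# ≤ h → h ≤ 1# → ¬ s ^ n - x ≤ h * slope n s →
                  UpperBound (Below n x) (s - h)
      s-h-upper {h} 0≤h h≤1 d≰hc {y} (0≤y , yⁿ≤x) with total (h + y) s
      ... | inj₁ h+y≤s = +-cancelˡ-≤ h (begin
              h + y       ≤⟨ h+y≤s ⟩
              s           ≈⟨ x+[y-x]≈y h s ⟨
              h + (s - h) ∎)
      ... | inj₂ s≤h+y = contradiction (+-cancelˡ-≤ x (begin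
              x + (s ^ n - x)       ≈⟨ x+[y-x]≈y x (s ^ n) ⟩
              s ^ n                 ≤⟨ ^-mono-≤ n 0≤s s≤h+y ⟩
              (h + y) ^ n           ≈⟨ ^-congˡ n (+-comm h y) ⟩
              (y + h) ^ n           ≤⟨ increment n 0≤y 0≤h h≤1 ⟩
              y ^ n + h * slope n y ≤⟨ +-mono-≤ yⁿ≤x (*-monoʳ-≤ 0≤h
                                         (slope-mono n 0≤y (upper (0≤y , yⁿ≤x)))) ⟩
              x + h * slope n s     ∎)) d≰hc

    Below-bound : ∀ k {x} → 0# ≤ x → UpperBound (Below (suc k) x) (1# + x)
    Below-bound k {x} 0≤x {y} (0≤y , yⁿ≤x) with total y (1# + x)
    ... | inj₁ y≤1+x = y≤1+x
    ... | inj₂ 1+x≤y = begin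
      y         ≈⟨ *-identityʳ y ⟨
      y * 1#    ≤⟨ *-monoʳ-≤ 0≤y (1≤^ k (≤-trans (x≤x+y 0≤x) 1+x≤y)) ⟩
      y * y ^ k ≤⟨ yⁿ≤x ⟩
      x         ≤⟨ y≤x+y 0≤1 ⟩
      1# + x    ∎

    Below-0 : ∀ k {x} → 0# ≤ x → Below (suc k) x 0#
    Below-0 k {x} 0≤x = ≤-refl , (begin
      0# * 0# ^ k ≈⟨ zeroˡ (0# ^ k) ⟩
      0#          ≤⟨ 0≤x ⟩
      x           ∎)

    sup-root : ∀ n {x s} → 0# ≤ s → UpperBound (Below n x) s →
               (∀ {b} → UpperBound (Below n x) b → s ≤ b) → s ^ n ≈ x
    sup-root n {x} {s} 0≤s upper least with s ^ n ≟ x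
    ... | yes sⁿ≈x = sⁿ≈x
    ... | no  sⁿ≉x with total (s ^ n) x
    ...   | inj₁ sⁿ≤x = ⊥-elim (sup-not-below n 0≤s upper sⁿ≤x sⁿ≉x)
    ...   | inj₂ x≤sⁿ = ⊥-elim (sup-not-above n 0≤s upper least x≤sⁿ
                                  (λ x≈sⁿ → sⁿ≉x (sym x≈sⁿ)))

  root-exists : ∀ n .{{_ : NonZero n}} {x} → 0# ≤ x →
                ∃ λ y → 0# ≤ y × y ^ n ≈ x
  root-exists (suc k) {x} 0≤x =
    let s , upper , least = supremum (Below (suc k) x) (0# , Below-0 k 0≤x)
                                     (1# + x , Below-bound k 0≤x)
        0≤s = upper (Below-0 k 0≤x)
    in s , 0≤s , sup-root (suc k) 0≤s upper least

  -- The nonnegative n-th root, extended by 0 to negative arguments.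
  root : ∀ n .{{_ : NonZero n}} → Carrier → Carrier
  root n x with 0# ≤? x
  ... | yes 0≤x = proj₁ (root-exists n 0≤x)
  ... | no  _   = 0#

  √ ∛ : Carrier → Carrier
  √ = root 2
  ∛ = root 3

record Graph (V E : Set) : Set where
  field
    rot            : V × E → V × E
    rot-involutive : ∀ x → rot (rot x) ≡ x

open Graph public

RegularGraph : ℕ → ℕ → Set
RegularGraph N D = Graph (Fin N) (Fin D)

relabel : ∀ {V W E} → V ↔ W → Graph W E → Graph V E
relabel V↔W G = record
  { rot            = λ x → map₁ from (rot G (map₁ to x))
  ; rot-involutive = λ { (v , i) → ≡.trans
      (≡.cong (λ w → map₁ from (rot G (w , proj₂ (rot G (to v , i)))))
              (strictlyInverseˡ (proj₁ (rot G (to v , i)))))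
      (≡.trans (≡.cong (map₁ from) (rot-involutive G (to v , i)))
               (≡.cong (_, i) (strictlyInverseʳ v))) }
  }
  where open Inverse V↔W

module _ {N₁ D₁ D₂} (G₁ : RegularGraph N₁ D₁) (G₂ : RegularGraph D₁ D₂) where

  -- `splitAt D₂` separates the labels of G₂ (`inj₁`) from the additional
  -- last label (`inj₂`).
  private
    step : Fin N₁ × Fin D₁ → Fin D₂ ⊎ Fin 1 → (Fin N₁ × Fin D₁) × (Fin D₂ ⊎ Fin 1)
    step (v , k) (inj₁ i) = let (m , j) = rot G₂ (k , i) in (v , m) , inj₁ j
    step (v , k) (inj₂ i) = rot G₁ (v , k) , inj₂ i

    step-involutive : ∀ x i → let (y , j) = step x i in step y j ≡ (x , i)
    step-involutive (v , k) (inj₁ i) =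
      ≡.cong (λ (m , j) → (v , m) , inj₁ j) (rot-involutive G₂ (k , i))
    step-involutive (v , k) (inj₂ i) =
      ≡.cong (_, inj₂ i) (rot-involutive G₁ (v , k))

  replacementProduct : Graph (Fin N₁ × Fin D₁) (Fin (D₂ ℕ.+ 1))
  replacementProduct = record
    { rot            = λ (x , i) → map₂ (join D₂ 1) (step x (splitAt D₂ i))
    ; rot-involutive = λ { (x , i) →
        let (y , j) = step x (splitAt D₂ i) in ≡.trans
          (≡.cong (λ l → map₂ (join D₂ 1) (step y l)) (splitAt-join D₂ 1 j))
          (≡.trans (≡.cong (map₂ (join D₂ 1)) (step-involutive x (splitAt D₂ i)))
                   (≡.cong (x ,_) (join-splitAt D₂ 1 i))) }
    }

module Spectral (ℝ : CompleteOrderedField) where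

  open CompleteOrderedField ℝ
  open Roots ℝ public
  open import Algebra.Properties.Semiring.Mult semiring using () renaming (_×_ to _·_)
  open import Algebra.Properties.Semiring.Sum semiring using (sum)

  fromℕ : ℕ → Carrier
  fromℕ n = n · 1#

  Vector : ℕ → Set
  Vector N = Fin N → Carrier

  ⟨_,_⟩ : ∀ {N} → Vector N → Vector N → Carrier
  ⟨ α , β ⟩ = sum (λ v → α v * β v)

  ∥_∥ : ∀ {N} → Vector N → Carrier
  ∥ α ∥ = √ ⟨ α , α ⟩

  𝟙 : ∀ {N} → Vector N
  𝟙 _ = 1#

  edgeCount : ∀ {N D} → RegularGraph N D → Fin N → Fin N → ℕ
  edgeCount {D = D} G u v = length (filter
    (λ (i , j) → ≡-dec Fin._≟_ Fin._≟_ (rot G (u , i)) (v , j))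
    (cartesianProduct (allFin D) (allFin D)))

  adjacency : ∀ {N D} → RegularGraph N D → Fin N → Fin N → Carrier
  adjacency {D = D} G u v = fromℕ (edgeCount G u v) / fromℕ D

  infixr 7 _∙_
  _∙_ : ∀ {N} → (Fin N → Fin N → Carrier) → Vector N → Vector N
  (M ∙ α) u = sum (λ v → M u v * α v)

  NormRatio : ∀ {N D} → RegularGraph N D → Carrier → Set
  NormRatio {N} G r = ∃ λ (α : Vector N) →
    ⟨ α , 𝟙 ⟩ ≈ 0# × ¬ (∀ v → α v ≈ 0#) × r ≈ ∥ adjacency G ∙ α ∥ / ∥ α ∥

  IsSecondEigenvalue : ∀ {N D} → RegularGraph N D → Carrier → Set
  IsSecondEigenvalue {N} G l =
    (N ≡ 1 → l ≈ 0#) × (N ≢ 1 → IsMaximum (NormRatio G) l)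

  -- G is an (N , D , μ)-graph: λ(G), a maximum attained by some α, is at most μ.
  IsExpander : ∀ {N D} → RegularGraph N D → Carrier → Set
  IsExpander G μ = ∃ λ l → IsSecondEigenvalue G l × l ≤ μ

  InUnitInterval : Carrier → Set
  InUnitInterval x = 0# ≤ x × x ≤ 1#

  ½ : Carrier
  ½ = 1# / fromℕ 2

  p : ℕ → Carrier
  p D₂ = fromℕ (D₂ ℕ.^ 2) / fromℕ ((D₂ ℕ.+ 1) ℕ.^ 3)

  f : Carrier → Carrier → Carrier
  f λ₁ λ₂ = ½ * (1# - λ₂ ^ 2) * λ₁
          + ½ * √ ((1# - λ₂ ^ 2) ^ 2 * λ₁ ^ 2 + fromℕ 4 * λ₂ ^ 2)

-- Algorithms are while-programs over finitely many stacks of bits, with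
-- unit-cost instructions that touch only the top of a stack.  A tape is a pair
-- of stacks, so this is the multitape oracle Turing machine model up to a
-- polynomial change in running time.

Word : Set
Word = List Bool

-- Bijective base-2 numerals, least significant digit on top of the stack.
-- The length is ⌊log₂ (1 + n)⌋.
digits : ℕᵇ → Word
digits ℕᵇ.zero  = []
digits 2[1+ b ] = true ∷ digits b
digits 1+[2 b ] = false ∷ digits b

encode : ℕ → Word
encode n = digits (ℕᵇ.fromℕ n)

code : ∀ {n} → Fin n → Word
code x = encode (toℕ x)

infixr 5 _⨾_

data Program (registers oracles : ℕ) : Set where
  skip  : Program registers oracles
  push  : Fin registers → Bool → Program registers oracles
  -- Pop a register and branch: it was empty, the bit was false, or was true.
  pop   : Fin registers → (p∅ p₀ p₁ : Program registers oracles) → Program registers oracles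
  -- Repeat as long as a register is nonempty.
  while : Fin registers → Program registers oracles → Program registers oracles
  _⨾_   : (p p′ : Program registers oracles) → Program registers oracles
  -- Replace the contents of two registers by the oracle's answer to them; a
  -- question that is not in the oracle's domain has no answer and no run.
  query : Fin oracles → (r s : Fin registers) → Program registers oracles

-- The pair of words (a , b) is answered by the pair (c , d).
Oracle : Set₁
Oracle = (a b c d : Word) → Set

rotOracle : ∀ {N D} → RegularGraph N D → Oracle
rotOracle G a b c d = ∃₂ λ v i → let (w , j) = rot G (v , i) in
  a ≡ code v × b ≡ code i × c ≡ code w × d ≡ code j

-- Run O P σ τ t q: started in σ, program P halts in τ after t time steps,
-- q of which are oracle queries.
data Run {R o} (O : Fin o → Oracle) :
         Program R o → Vec Word R → Vec Word R → ℕ → ℕ → Set where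
  skip    : ∀ {σ} → Run O skip σ σ 1 0
  push    : ∀ {σ r b} → Run O (push r b) σ (σ [ r ]≔ (b ∷ lookup σ r)) 1 0
  pop-∅   : ∀ {σ τ r p∅ p₀ p₁ t q} → lookup σ r ≡ [] →
            Run O p∅ σ τ t q → Run O (pop r p∅ p₀ p₁) σ τ (1 ℕ.+ t) q
  pop-0   : ∀ {σ τ r p∅ p₀ p₁ t q w} → lookup σ r ≡ false ∷ w →
            Run O p₀ (σ [ r ]≔ w) τ t q → Run O (pop r p∅ p₀ p₁) σ τ (1 ℕ.+ t) q
  pop-1   : ∀ {σ τ r p∅ p₀ p₁ t q w} → lookup σ r ≡ true ∷ w →
            Run O p₁ (σ [ r ]≔ w) τ t q → Run O (pop r p∅ p₀ p₁) σ τ (1 ℕ.+ t) q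
  while-∅ : ∀ {σ r p} → lookup σ r ≡ [] → Run O (while r p) σ σ 1 0
  while-∷ : ∀ {σ σ′ τ r p t t′ q q′} → lookup σ r ≢ [] →
            Run O p σ σ′ t q → Run O (while r p) σ′ τ t′ q′ →
            Run O (while r p) σ τ (1 ℕ.+ t ℕ.+ t′) (q ℕ.+ q′)
  _⨾_     : ∀ {σ σ′ τ p p′ t t′ q q′} →
            Run O p σ σ′ t q → Run O p′ σ′ τ t′ q′ →
            Run O (p ⨾ p′) σ τ (t ℕ.+ t′) (q ℕ.+ q′)
  query   : ∀ {σ x r s c d} → O x (lookup σ r) (lookup σ s) c d →
            Run O (query x r s) σ (σ [ r ]≔ c [ s ]≔ d) 1 1

rotOracles : ∀ {N₁ D₁ D₂} → RegularGraph N₁ D₁ → RegularGraph D₁ D₂ → Fin 2 → Oracle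
rotOracles G₁ G₂ Fin.zero    = rotOracle G₁
rotOracles G₁ G₂ (Fin.suc _) = rotOracle G₂

input : ∀ (N₁ D₁ D₂ : ℕ) work → Fin N₁ → Fin D₁ → Fin (D₂ ℕ.+ 1) → Vec Word (6 ℕ.+ work)
input N₁ D₁ D₂ work v k i =
  encode N₁ ∷ encode D₁ ∷ encode D₂ ∷ code v ∷ code k ∷ code i ∷ replicate work []

Outputs : ∀ {N D E work} → Vec Word (6 ℕ.+ work) → (Fin N × Fin D) × Fin E → Set
Outputs τ ((v , k) , i) =
  lookup τ 3F ≡ code v × lookup τ 4F ≡ code k × lookup τ 5F ≡ code i

open +-*-Solver public using (Polynomial; ⟦_⟧)

{-# OPTIONS --safe #-}
module Submission where

-- On functions on [N₁] × [D₁] let A be the permutation given by Rot of G₁, B the walk operator of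
-- the copies of G₂ and P the averaging over each copy.  The walk operator of the replacement
-- product is M = a A + b B with a = 1/(D₂+1), b = D₂/(D₂+1), and M³ is p B A B plus contractions of
-- total weight 1 − p, where p = a b².  For α ⊥ 𝟙 write B α = u + w with u = P α and
-- w = B (α − P α), so that u ⊥ w and |w| ≤ λ₂ |α − P α|.  Since A is a symmetric contraction,
-- Cauchy–Schwarz for the positive forms I ∓ A on u ⊥ w reduces |⟨A (u + w) , u + w⟩| ≤ f |α|² to
-- the quadratic equation f² = (1 − λ₂²) λ₁ f + λ₂².  The resulting bound on the form of M³ bounds
-- its norm by polarisation, and |M α|³ ≤ |M³ α| |α|² gives the cube root.
--
-- That λ(G) is attained needs no compactness: if the form s² |α|² − |M α|² were positive definite
-- on 𝟙^⊥, completing squares would make it coercive, so the supremum s would not be least.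

open import Defs
open import Algebra.Bundles using (CommutativeRing)
open import Data.Bool.Base using (Bool; true; false; if_then_else_)
open import Data.Fin.Base using (Fin; zero; suc; toℕ; _↑ˡ_; _↑ʳ_; combine; remQuot; splitAt)
open import Data.Fin.Patterns using (0F; 1F; 2F; 3F; 4F; 5F; 6F; 7F)
open import Data.Fin.Permutation using (permutation)
open import Data.Fin.Properties as Fin
  using (*↔×; remQuot-combine; combine-remQuot; splitAt-↑ˡ; splitAt-↑ʳ; splitAt⁻¹-↑ˡ; splitAt⁻¹-↑ʳ; toℕ-↑ˡ; toℕ-↑ʳ; toℕ<n)
open import Data.Integer.Base as ℤ using (ℤ; +_; -[1+_]; _⊖_; _◃_)
open import Data.Integer.Properties as ℤ using ([1+m]⊖[1+n]≡m⊖n)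
open import Data.List.Base using (List; []; _∷_; _++_; map; tabulate; cartesianProduct; allFin; filter; length; _ʳ++_)
open import Data.List.Properties using (∷-injectiveʳ)
open import Data.Maybe.Base as Maybe using ()
open import Data.Nat.Base as ℕ using (ℕ; zero; suc; NonZero; s≤s; z≤n)
open import Data.Nat.Binary.Base as ℕᵇ using (2[1+_]; 1+[2_])
import Data.Nat.Binary.Properties as ℕᵇ
open import Data.Nat.Logarithm using (⌊log₂_⌋; ⌊log₂⌋-mono-≤; ⌊log₂[2^n]⌋≡n; ⌊log₂[2*b]⌋≡1+⌊log₂b⌋)
import Data.Nat.Properties as ℕ
open import Data.Nat.Solver using (module +-*-Solver)
open import Data.Product.Base using (∃; ∃-syntax; Σ-syntax; _×_; _,_; proj₁; proj₂; uncurry; swap)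
open import Data.Product.Properties using (≡-dec)
open import Data.Sign.Base as Sign using ()
open import Data.Sum.Base using (_⊎_; inj₁; inj₂; [_,_]′)
open import Data.Vec.Base using (Vec; []; _∷_)
open import Level using (0ℓ)
open import Relation.Binary.Bundles using (Poset)
open import Relation.Binary.PropositionalEquality.Core as ≡ using (_≡_; _≢_)
open import Relation.Binary.Structures using (IsDecTotalOrder)
open import Relation.Nullary using (¬_; yes; no; contradiction; does)
open import Relation.Nullary.Decidable.Core using (dec⇒maybe)
open import Relation.Unary using (Pred; Decidable; U)

-- Neither A nor B shrinks every balanced vector: A permutes coordinates, and B fixes whatever is
-- constant on each copy. B A B steps inside, across and inside again; it first appears in the cube,
-- hence the cube root. The quadratic equation for f comes from the extremal case: on the plane of u
-- and w the operator A is a reflection, with rows (λ₁ , √(1 - λ₁²)) and (√(1 - λ₁²) , -λ₁); the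
-- factor λ₂ carried by w turns the rows into (λ₁ , λ₂ √(1 - λ₁²)) and (λ₂ √(1 - λ₁²) , -λ₂² λ₁).
-- The trace is (1 - λ₂²) λ₁, the determinant -λ₂², and f is the larger eigenvalue. Absolute values
-- enter through signs σ = ±1 and norms through their squares, so most estimates become a ring
-- identity plus a nonnegative gap. The algorithm rests on counting labels from 0: the additional
-- label has the number D₂, so comparing the words of i and D₂ bit by bit selects the oracle, and
-- the oracle answers in the registers that hold its question. The program inspects only D₂ and i,
-- whence a time linear in log D₂.

-- Ring solver with integer coefficients.

module IntegerCoefficients (R : CommutativeRing 0ℓ 0ℓ) where

  open CommutativeRing R
  open import Algebra.Properties.Ring ring
    using (-0#≈0#; -‿involutive; -‿distribˡ-*; -‿distribʳ-*; -‿+-comm)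
  open import Algebra.Properties.Semiring.Mult.TCOptimised semiring renaming (_×_ to _·_)
  open import Algebra.Solver.Ring.AlmostCommutativeRing
  open import Algebra.Properties.CommutativeSemigroup +-commutativeSemigroup using (interchange)
  open import Relation.Binary.Reasoning.Setoid setoid

  -- Equality of integers computes while `Carrier` is abstract, so integer coefficients let the
  -- solver cancel a term against its negative during normalisation.
  ι : ℤ → Carrier
  ι (+ n)    = n · 1#
  ι -[1+ n ] = - (suc n · 1#)

  ι-⊖ : ∀ m n → ι (m ⊖ n) ≈ m · 1# - n · 1#
  ι-⊖ zero    zero    = sym (-‿inverseʳ 0#)
  ι-⊖ zero    (suc n) = sym (+-identityˡ _)
  ι-⊖ (suc m) zero    = sym (trans (+-congˡ -0#≈0#) (+-identityʳ _))
  ι-⊖ (suc m) (suc n) = begin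
    ι (suc m ⊖ suc n)                   ≡⟨ ≡.cong ι ([1+m]⊖[1+n]≡m⊖n m n) ⟩
    ι (m ⊖ n)                           ≈⟨ ι-⊖ m n ⟩
    m · 1# - n · 1#                     ≈⟨ +-identityˡ _ ⟨
    0# + (m · 1# - n · 1#)              ≈⟨ +-congʳ (-‿inverseʳ 1#) ⟨
    1# - 1# + (m · 1# - n · 1#)         ≈⟨ interchange _ _ _ _ ⟩
    1# + m · 1# + (- 1# + - (n · 1#))   ≈⟨ +-cong (1+× m 1#) (trans (-‿cong (1+× n 1#)) (sym (-‿+-comm 1# _))) ⟨
    suc m · 1# - suc n · 1#             ∎

  ι-◃⁺ : ∀ n → ι (Sign.+ ◃ n) ≈ n · 1#
  ι-◃⁺ zero    = refl
  ι-◃⁺ (suc n) = refl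

  ι-◃⁻ : ∀ n → ι (Sign.- ◃ n) ≈ - (n · 1#)
  ι-◃⁻ zero    = sym -0#≈0#
  ι-◃⁻ (suc n) = refl

  ι-+ : ∀ i j → ι (i ℤ.+ j) ≈ ι i + ι j
  ι-+ (+ m)    (+ n)    = ×-homo-+ 1# m n
  ι-+ (+ m)    -[1+ n ] = ι-⊖ m (suc n)
  ι-+ -[1+ m ] (+ n)    = trans (ι-⊖ n (suc m)) (+-comm _ _)
  ι-+ -[1+ m ] -[1+ n ] = begin
    - (suc (suc (m ℕ.+ n)) · 1#)       ≡⟨ ≡.cong (λ k → - (k · 1#)) (ℕ.+-suc (suc m) n) ⟨
    - ((suc m ℕ.+ suc n) · 1#)         ≈⟨ -‿cong (×-homo-+ 1# (suc m) (suc n)) ⟩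
    - (suc m · 1# + suc n · 1#)        ≈⟨ -‿+-comm _ _ ⟨
    - (suc m · 1#) + - (suc n · 1#)    ∎
    where import Data.Nat.Properties as ℕ

  ι-* : ∀ i j → ι (i ℤ.* j) ≈ ι i * ι j
  ι-* (+ m)    (+ n)    = trans (ι-◃⁺ (m ℕ.* n)) (×1-homo-* m n)
  ι-* (+ m)    -[1+ n ] = trans (ι-◃⁻ (m ℕ.* suc n))
    (trans (-‿cong (×1-homo-* m (suc n))) (-‿distribʳ-* _ _))
  ι-* -[1+ m ] (+ n)    = trans (ι-◃⁻ (suc m ℕ.* n))
    (trans (-‿cong (×1-homo-* (suc m) n)) (-‿distribˡ-* _ _))
  ι-* -[1+ m ] -[1+ n ] = begin
    ι (Sign.+ ◃ suc m ℕ.* suc n)       ≈⟨ ι-◃⁺ (suc m ℕ.* suc n) ⟩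
    (suc m ℕ.* suc n) · 1#             ≈⟨ ×1-homo-* (suc m) (suc n) ⟩
    suc m · 1# * suc n · 1#            ≈⟨ -‿involutive _ ⟨
    - - (suc m · 1# * suc n · 1#)      ≈⟨ -‿cong (-‿distribˡ-* _ _) ⟩
    - (- (suc m · 1#) * suc n · 1#)    ≈⟨ -‿distribʳ-* _ _ ⟩
    - (suc m · 1#) * - (suc n · 1#)    ∎

  ι-neg : ∀ i → ι (ℤ.- i) ≈ - ι i
  ι-neg (+ zero)  = sym -0#≈0#
  ι-neg (+ suc n) = refl
  ι-neg -[1+ n ]  = sym (-‿involutive _)

  -- The optimised multiple reduces `1 · 1#` to `1#`, so the unit laws are `refl`, and `:0` and `:1`
  -- denote `0#` and `1#` definitionally.
  ι-homomorphism : ℤ.+-*-rawRing -Raw-AlmostCommutative⟶ fromCommutativeRing R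
  ι-homomorphism = record
    { ⟦_⟧ = ι ; +-homo = ι-+ ; *-homo = ι-* ; -‿homo = ι-neg ; 0-homo = refl ; 1-homo = refl }

  open import Algebra.Solver.Ring ℤ.+-*-rawRing (fromCommutativeRing R) ι-homomorphism
    (λ i j → Maybe.map (λ i≡j → reflexive (≡.cong ι i≡j)) (dec⇒maybe (i ℤ.≟ j)))
    public using (solve; _:=_; _:+_; _:*_; _:-_; :-_; _:^_; con) renaming (Polynomial to Expr)

  :0 :1 : ∀ {n} → Expr n
  :0 = con (+ 0)
  :1 = con (+ 1)

-- Arithmetic of ordered fields and of roots.

module OrderedField (ℝ : CompleteOrderedField) where

  open CompleteOrderedField ℝ public hiding (zero)
  open IsDecTotalOrder isDecTotalOrder public
    using (total; antisym; _≤?_; _≟_; isPartialOrder)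
    renaming (refl to ≤-refl; trans to ≤-trans; reflexive to ≤-reflexive)
  open IntegerCoefficients commutativeRing public
  open import Algebra.Properties.Semiring.Mult semiring public
    using (×-homo-+; ×1-homo-*) renaming (_×_ to _·_)
  open Spectral ℝ public using (fromℕ; root; root-exists; _^_; √; ∛; ½; p; f; InUnitInterval)

  ≤-poset : Poset 0ℓ 0ℓ 0ℓ
  ≤-poset = record { isPartialOrder = isPartialOrder }

  open import Relation.Binary.Reasoning.PartialOrder ≤-poset

  +-monoʳ-≤ : ∀ {x y} z → x ≤ y → z + x ≤ z + y
  +-monoʳ-≤ {x} {y} z x≤y = begin
    z + x ≈⟨ +-comm z x ⟩
    x + z ≤⟨ +-monoˡ-≤ z x≤y ⟩
    y + z ≈⟨ +-comm y z ⟩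
    z + y ∎

  +-mono-≤ : ∀ {x y u v} → x ≤ y → u ≤ v → x + u ≤ y + v
  +-mono-≤ {y = y} {u} x≤y u≤v = ≤-trans (+-monoˡ-≤ u x≤y) (+-monoʳ-≤ y u≤v)

  +-nonNeg : ∀ {x y} → 0# ≤ x → 0# ≤ y → 0# ≤ x + y
  +-nonNeg 0≤x 0≤y = ≤-trans (≤-reflexive (sym (+-identityˡ 0#))) (+-mono-≤ 0≤x 0≤y)

  -- An inequality is certified by a nonnegative d together with a ring identity.
  ≤-from-gap : ∀ {x y d} → 0# ≤ d → x + d ≈ y → x ≤ y
  ≤-from-gap {x} {y} {d} 0≤d x+d≈y = begin
    x      ≈⟨ +-identityʳ x ⟨
    x + 0# ≤⟨ +-monoʳ-≤ x 0≤d ⟩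
    x + d  ≈⟨ x+d≈y ⟩
    y      ∎

  0≤y-x : ∀ {x y} → x ≤ y → 0# ≤ y - x
  0≤y-x {x} {y} x≤y = begin
    0#    ≈⟨ -‿inverseʳ x ⟨
    x - x ≤⟨ +-monoˡ-≤ (- x) x≤y ⟩
    y - x ∎

  0≤y-x⁻¹ : ∀ {x y} → 0# ≤ y - x → x ≤ y
  0≤y-x⁻¹ {x} {y} 0≤d = ≤-from-gap 0≤d (solve 2 (λ x y → x :+ (y :- x) := y) refl x y)

  0≤-x : ∀ {x} → x ≤ 0# → 0# ≤ - x
  0≤-x {x} x≤0 = ≤-trans (0≤y-x x≤0) (≤-reflexive (+-identityˡ (- x)))

  *-monoʳ-≤ : ∀ {x y z} → 0# ≤ z → x ≤ y → z * x ≤ z * y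
  *-monoʳ-≤ {x} {y} {z} 0≤z x≤y = ≤-from-gap (*-nonNeg 0≤z (0≤y-x x≤y))
    (solve 3 (λ x y z → z :* x :+ z :* (y :- x) := z :* y) refl x y z)

  *-monoˡ-≤ : ∀ {x y z} → 0# ≤ z → x ≤ y → x * z ≤ y * z
  *-monoˡ-≤ {x} {y} {z} 0≤z x≤y = begin
    x * z ≈⟨ *-comm x z ⟩
    z * x ≤⟨ *-monoʳ-≤ 0≤z x≤y ⟩
    z * y ≈⟨ *-comm z y ⟩
    y * z ∎

  *-mono-≤ : ∀ {x y u v} → 0# ≤ x → x ≤ y → 0# ≤ u → u ≤ v → x * u ≤ y * v
  *-mono-≤ 0≤x x≤y 0≤u u≤v =
    ≤-trans (*-monoˡ-≤ 0≤u x≤y) (*-monoʳ-≤ (≤-trans 0≤x x≤y) u≤v)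

  x²-nonNeg : ∀ x → 0# ≤ x * x
  x²-nonNeg x with total 0# x
  ... | inj₁ 0≤x = *-nonNeg 0≤x 0≤x
  ... | inj₂ x≤0 = ≤-trans (*-nonNeg (0≤-x x≤0) (0≤-x x≤0))
    (≤-reflexive (solve 1 (λ x → (:- x) :* (:- x) := x :* x) refl x))

  0≤1 : 0# ≤ 1#
  0≤1 = ≤-trans (x²-nonNeg 1#) (≤-reflexive (*-identityˡ 1#))

  1≰0 : ¬ 1# ≤ 0#
  1≰0 1≤0 = 0≉1 (antisym 0≤1 1≤0)

  x*y≉0 : ∀ {x y} → ¬ x ≈ 0# → ¬ y ≈ 0# → ¬ x * y ≈ 0#
  x*y≉0 {x} {y} x≉0 y≉0 xy≈0 = y≉0 (begin-equality
    y                ≈⟨ *-identityˡ y ⟨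
    1# * y           ≈⟨ *-congʳ (*-inverseʳ x x≉0) ⟨
    x * x ⁻¹ * y     ≈⟨ solve 3 (λ x y i → x :* i :* y := i :* (x :* y)) refl x y (x ⁻¹) ⟩
    x ⁻¹ * (x * y)   ≈⟨ *-congˡ xy≈0 ⟩
    x ⁻¹ * 0#        ≈⟨ zeroʳ (x ⁻¹) ⟩
    0#               ∎)

  x²≈0⇒x≈0 : ∀ {x} → x * x ≈ 0# → x ≈ 0#
  x²≈0⇒x≈0 {x} x²≈0 with x ≟ 0#
  ... | yes x≈0 = x≈0
  ... | no  x≉0 = contradiction x²≈0 (x*y≉0 x≉0 x≉0)

  ⁻¹-nonNeg : ∀ {x} → 0# ≤ x → ¬ x ≈ 0# → 0# ≤ x ⁻¹
  ⁻¹-nonNeg {x} 0≤x x≉0 = begin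
    0#                ≤⟨ *-nonNeg 0≤x (x²-nonNeg (x ⁻¹)) ⟩
    x * (x ⁻¹ * x ⁻¹) ≈⟨ *-assoc x (x ⁻¹) (x ⁻¹) ⟨
    x * x ⁻¹ * x ⁻¹   ≈⟨ *-congʳ (*-inverseʳ x x≉0) ⟩
    1# * x ⁻¹         ≈⟨ *-identityˡ (x ⁻¹) ⟩
    x ⁻¹              ∎

  ⁻¹-≉0 : ∀ {x} → ¬ x ≈ 0# → ¬ x ⁻¹ ≈ 0#
  ⁻¹-≉0 {x} x≉0 i≈0 = 0≉1 (begin-equality
    0#       ≈⟨ zeroʳ x ⟨
    x * 0#   ≈⟨ *-congˡ i≈0 ⟨
    x * x ⁻¹ ≈⟨ *-inverseʳ x x≉0 ⟩
    1#       ∎)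

  x/y*y : ∀ x {y} → ¬ y ≈ 0# → x / y * y ≈ x
  x/y*y x {y} y≉0 = begin-equality
    x * y ⁻¹ * y   ≈⟨ solve 3 (λ x y i → x :* i :* y := x :* (y :* i)) refl x y (y ⁻¹) ⟩
    x * (y * y ⁻¹) ≈⟨ *-congˡ (*-inverseʳ y y≉0) ⟩
    x * 1#         ≈⟨ *-identityʳ x ⟩
    x              ∎

  *-cancelˡ : ∀ {x y z} → ¬ z ≈ 0# → z * x ≈ z * y → x ≈ y
  *-cancelˡ {x} {y} {z} z≉0 eq = begin-equality
    x          ≈⟨ x/y*y x z≉0 ⟨
    x / z * z  ≈⟨ solve 3 (λ x z i → x :* i :* z := z :* x :* i) refl x z (z ⁻¹) ⟩
    z * x / z  ≈⟨ *-congʳ eq ⟩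
    z * y / z  ≈⟨ solve 3 (λ x z i → x :* i :* z := z :* x :* i) refl y z (z ⁻¹) ⟨
    y / z * z  ≈⟨ x/y*y y z≉0 ⟩
    y          ∎

  *-cancelˡ-≤ : ∀ {x y z} → 0# ≤ z → ¬ z ≈ 0# → z * x ≤ z * y → x ≤ y
  *-cancelˡ-≤ {x} {y} {z} 0≤z z≉0 zx≤zy = begin
    x               ≈⟨ x/y*y x z≉0 ⟨
    x * z ⁻¹ * z    ≈⟨ solve 3 (λ x z i → x :* i :* z := z :* x :* i) refl x z (z ⁻¹) ⟩
    z * x * z ⁻¹    ≤⟨ *-monoˡ-≤ (⁻¹-nonNeg 0≤z z≉0) zx≤zy ⟩
    z * y * z ⁻¹    ≈⟨ solve 3 (λ x z i → x :* i :* z := z :* x :* i) refl y z (z ⁻¹) ⟨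
    y * z ⁻¹ * z    ≈⟨ x/y*y y z≉0 ⟩
    y               ∎

  ^-nonNeg : ∀ {x} n → 0# ≤ x → 0# ≤ x ^ n
  ^-nonNeg zero    0≤x = 0≤1
  ^-nonNeg (suc n) 0≤x = *-nonNeg 0≤x (^-nonNeg n 0≤x)

  ^-mono-≤ : ∀ {x y} n → 0# ≤ x → x ≤ y → x ^ n ≤ y ^ n
  ^-mono-≤ zero    0≤x x≤y = ≤-refl
  ^-mono-≤ (suc n) 0≤x x≤y = *-mono-≤ 0≤x x≤y (^-nonNeg n 0≤x) (^-mono-≤ n 0≤x x≤y)

  x^n≉0 : ∀ {x} n → ¬ x ≈ 0# → ¬ x ^ n ≈ 0#
  x^n≉0 zero    x≉0 1≈0 = 0≉1 (sym 1≈0)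
  x^n≉0 (suc n) x≉0     = x*y≉0 x≉0 (x^n≉0 n x≉0)

  -- If y ≤ x and x is not zero, the product of x with its lower power is at most that of y with the
  -- same lower power of x, and this positive power cancels.
  ^-cancel-≤ : ∀ {x y} n .{{_ : NonZero n}} → 0# ≤ y → x ^ n ≤ y ^ n → x ≤ y
  ^-cancel-≤ {x} {y} (suc n) 0≤y xⁿ≤yⁿ with total x y | x ≟ 0#
  ... | inj₁ x≤y | _       = x≤y
  ... | inj₂ _   | yes x≈0 = ≤-trans (≤-reflexive x≈0) 0≤y
  ... | inj₂ y≤x | no  x≉0 =
    *-cancelˡ-≤ (^-nonNeg n (≤-trans 0≤y y≤x)) (x^n≉0 n x≉0) (begin
      x ^ n * x ≈⟨ *-comm (x ^ n) x ⟩
      x * x ^ n ≤⟨ xⁿ≤yⁿ ⟩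
      y * y ^ n ≤⟨ *-monoʳ-≤ 0≤y (^-mono-≤ n 0≤y y≤x) ⟩
      y * x ^ n ≈⟨ *-comm y (x ^ n) ⟩
      x ^ n * y ∎)

  x^2 : ∀ x → x ^ 2 ≈ x * x
  x^2 x = *-congˡ (*-identityʳ x)

  square-cancel-≤ : ∀ {x y} → 0# ≤ y → x * x ≤ y * y → x ≤ y
  square-cancel-≤ {x} {y} 0≤y x²≤y² = ^-cancel-≤ 2 0≤y (begin
    x ^ 2 ≈⟨ x^2 x ⟩
    x * x ≤⟨ x²≤y² ⟩
    y * y ≈⟨ x^2 y ⟨
    y ^ 2 ∎)

  root-nonNeg : ∀ n .{{_ : NonZero n}} x → 0# ≤ root n x
  root-nonNeg n x with 0# ≤? x
  ... | yes 0≤x = proj₁ (proj₂ (root-exists n 0≤x))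
  ... | no  _   = ≤-refl

  root-^ : ∀ n .{{_ : NonZero n}} {x} → 0# ≤ x → root n x ^ n ≈ x
  root-^ n {x} 0≤x with 0# ≤? x
  ... | yes 0≤x′ = proj₂ (proj₂ (root-exists n 0≤x′))
  ... | no  0≰x  = contradiction 0≤x 0≰x

  √-square : ∀ {x} → 0# ≤ x → √ x * √ x ≈ x
  √-square {x} 0≤x = trans (sym (x^2 (√ x))) (root-^ 2 0≤x)

  fromℕ-nonNeg : ∀ n → 0# ≤ fromℕ n
  fromℕ-nonNeg zero    = ≤-refl
  fromℕ-nonNeg (suc n) = +-nonNeg 0≤1 (fromℕ-nonNeg n)

  fromℕ≉0 : ∀ n .{{_ : NonZero n}} → ¬ fromℕ n ≈ 0#
  fromℕ≉0 (suc n) eq = 1≰0 (≤-from-gap (fromℕ-nonNeg n) eq)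

  fromℕ-+ : ∀ m n → fromℕ (m ℕ.+ n) ≈ fromℕ m + fromℕ n
  fromℕ-+ = ×-homo-+ 1#

  fromℕ-* : ∀ m n → fromℕ (m ℕ.* n) ≈ fromℕ m * fromℕ n
  fromℕ-* = ×1-homo-*

  fromℕ-^ : ∀ m n → fromℕ (m ℕ.^ n) ≈ fromℕ m ^ n
  fromℕ-^ m zero    = +-identityʳ 1#
  fromℕ-^ m (suc n) = trans (fromℕ-* m (m ℕ.^ n)) (*-congˡ (fromℕ-^ m n))

  ½-double : ½ + ½ ≈ 1#
  ½-double = begin-equality
    -- `fromℕ 2` unfolds to `1# + (1# + 0#)`; the polynomial is spelled so as to denote exactly
    -- that.
    ½ + ½        ≈⟨ solve 1 (λ h → h :+ h := h :* (:1 :+ (:1 :+ :0))) refl ½ ⟩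
    ½ * fromℕ 2  ≈⟨ x/y*y 1# (fromℕ≉0 2) ⟩
    1#           ∎

  double-cancel-≤ : ∀ {x y} → x + x ≤ y + y → x ≤ y
  double-cancel-≤ {x} {y} xx≤yy = *-cancelˡ-≤ (fromℕ-nonNeg 2) (fromℕ≉0 2) (begin
    fromℕ 2 * x ≈⟨ double x ⟩
    x + x       ≤⟨ xx≤yy ⟩
    y + y       ≈⟨ double y ⟨
    fromℕ 2 * y ∎)
    where
    double : ∀ x → fromℕ 2 * x ≈ x + x
    double = solve 1 (λ x → (:1 :+ (:1 :+ :0)) :* x := x :+ x) refl

  -- At (-B , A) the form equals A (A C - B²), and A cancels unless it vanishes; (C , -B) serves in
  -- the same way when C does not vanish. If both vanish, the value at (1 , -B) is -2 B².
  discriminant : ∀ {A B C} → (∀ s t → 0# ≤ s * s * A + (s * t * B + s * t * B) + t * t * C) →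
                 B * B ≤ A * C
  discriminant {A} {B} {C} nonNeg with A ≟ 0# | C ≟ 0#
  ... | no A≉0 | _ = *-cancelˡ-≤ 0≤A A≉0 (≤-from-gap (nonNeg (- B) A)
          (solve 3 (λ A B C → A :* (B :* B) :+ ((:- B) :* (:- B) :* A :+
             ((:- B) :* A :* B :+ (:- B) :* A :* B) :+ A :* A :* C) := A :* (A :* C)) refl A B C))
    where
    0≤A : 0# ≤ A
    0≤A = ≤-trans (nonNeg 1# 0#) (≤-reflexive (solve 3 (λ A B C → :1 :* :1 :* A :+
      (:1 :* :0 :* B :+ :1 :* :0 :* B) :+ :0 :* :0 :* C := A)
      refl A B C))
  ... | yes _ | no C≉0 = *-cancelˡ-≤ 0≤C C≉0 (≤-from-gap (nonNeg C (- B))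
          (solve 3 (λ A B C → C :* (B :* B) :+ (C :* C :* A :+
             (C :* (:- B) :* B :+ C :* (:- B) :* B) :+ (:- B) :* (:- B) :* C) := C :* (A :* C)) refl A B C))
    where
    0≤C : 0# ≤ C
    0≤C = ≤-trans (nonNeg 0# 1#) (≤-reflexive (solve 3 (λ A B C → :0 :* :0 :* A :+
      (:0 :* :1 :* B :+ :0 :* :1 :* B) :+ :1 :* :1 :* C := C)
      refl A B C))
  ... | yes A≈0 | yes C≈0 = begin
          B * B   ≤⟨ double-cancel-≤ (≤-from-gap (nonNeg 1# (- B)) eq) ⟩
          0#      ≈⟨ zeroˡ C ⟨
          0# * C  ≈⟨ *-congʳ A≈0 ⟨
          A * C   ∎
    where
    eq : B * B + B * B + (1# * 1# * A + (1# * - B * B + 1# * - B * B) + - B * - B * C) ≈ 0# + 0#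
    eq = begin-equality
      B * B + B * B + (1# * 1# * A + (1# * - B * B + 1# * - B * B) + - B * - B * C)
        ≈⟨ solve 3 (λ A B C → B :* B :+ B :* B :+ (:1 :* :1 :* A :+
             (:1 :* (:- B) :* B :+ :1 :* (:- B) :* B) :+ (:- B) :* (:- B) :* C)
             := A :+ B :* B :* C) refl A B C ⟩
      A + B * B * C   ≈⟨ +-cong A≈0 (trans (*-congˡ C≈0) (zeroʳ (B * B))) ⟩
      0# + 0#         ∎

-- Inner products and symmetric operators.

module InnerProduct (ℝ : CompleteOrderedField) where

  open OrderedField ℝ public
  open Spectral ℝ public using (Vector; ⟨_,_⟩; ∥_∥; 𝟙)
  open import Algebra.Properties.Semiring.Sum semiring public
    using (sum; ∑-distrib-+; *-distribˡ-sum; *-distribʳ-sum; ∑-comm; sum-permute)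
    renaming (sum-cong-≋ to sum-cong)
  open import Relation.Binary.Reasoning.PartialOrder ≤-poset

  infix  4 _≋_
  infixl 6 _⊕_
  infixr 7 _•_

  _≋_ : ∀ {N} → Vector N → Vector N → Set
  α ≋ β = ∀ v → α v ≈ β v

  _⊕_ : ∀ {N} → Vector N → Vector N → Vector N
  (α ⊕ β) v = α v + β v

  _•_ : ∀ {N} → Carrier → Vector N → Vector N
  (s • α) v = s * α v

  sum-nonNeg : ∀ {N} {α : Vector N} → (∀ v → 0# ≤ α v) → 0# ≤ sum α
  sum-nonNeg {zero}  0≤α = ≤-refl
  sum-nonNeg {suc N} 0≤α = +-nonNeg (0≤α zero) (sum-nonNeg (λ v → 0≤α (suc v)))

  sum-mono-≤ : ∀ {N} {α β : Vector N} → (∀ v → α v ≤ β v) → sum α ≤ sum β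
  sum-mono-≤ {zero}  α≤β = ≤-refl
  sum-mono-≤ {suc N} α≤β = +-mono-≤ (α≤β zero) (sum-mono-≤ (λ v → α≤β (suc v)))

  sum-const : ∀ N x → sum {N} (λ _ → x) ≈ fromℕ N * x
  sum-const zero    x = sym (zeroˡ x)
  sum-const (suc N) x = begin-equality
    x + sum {N} (λ _ → x)  ≈⟨ +-congˡ (sum-const N x) ⟩
    x + fromℕ N * x        ≈⟨ solve 2 (λ x n → x :+ n :* x := (:1 :+ n) :* x) refl x (fromℕ N) ⟩
    (1# + fromℕ N) * x     ∎

  ⟨⟩-cong : ∀ {N} {α α′ β β′ : Vector N} → α ≋ α′ → β ≋ β′ → ⟨ α , β ⟩ ≈ ⟨ α′ , β′ ⟩
  ⟨⟩-cong α≋α′ β≋β′ = sum-cong (λ v → *-cong (α≋α′ v) (β≋β′ v))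

  ⟨⟩-comm : ∀ {N} (α β : Vector N) → ⟨ α , β ⟩ ≈ ⟨ β , α ⟩
  ⟨⟩-comm α β = sum-cong (λ v → *-comm (α v) (β v))

  ⟨⟩-linearˡ : ∀ {N} s t (α β γ : Vector N) →
               ⟨ s • α ⊕ t • β , γ ⟩ ≈ s * ⟨ α , γ ⟩ + t * ⟨ β , γ ⟩
  ⟨⟩-linearˡ s t α β γ = begin-equality
    sum (λ v → (s * α v + t * β v) * γ v)
      ≈⟨ sum-cong (λ v → solve 5 (λ s t a b c → (s :* a :+ t :* b) :* c := s :* (a :* c) :+ t :* (b :* c))
           refl s t (α v) (β v) (γ v)) ⟩
    sum (λ v → s * (α v * γ v) + t * (β v * γ v))
      ≈⟨ ∑-distrib-+ (λ v → s * (α v * γ v)) (λ v → t * (β v * γ v)) ⟩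
    sum (λ v → s * (α v * γ v)) + sum (λ v → t * (β v * γ v))
      ≈⟨ +-cong (*-distribˡ-sum s (λ v → α v * γ v)) (*-distribˡ-sum t (λ v → β v * γ v)) ⟨
    s * ⟨ α , γ ⟩ + t * ⟨ β , γ ⟩ ∎

  ⟨⟩-linearʳ : ∀ {N} s t (α β γ : Vector N) →
               ⟨ γ , s • α ⊕ t • β ⟩ ≈ s * ⟨ γ , α ⟩ + t * ⟨ γ , β ⟩
  ⟨⟩-linearʳ s t α β γ = begin-equality
    ⟨ γ , s • α ⊕ t • β ⟩           ≈⟨ ⟨⟩-comm γ (s • α ⊕ t • β) ⟩
    ⟨ s • α ⊕ t • β , γ ⟩           ≈⟨ ⟨⟩-linearˡ s t α β γ ⟩
    s * ⟨ α , γ ⟩ + t * ⟨ β , γ ⟩   ≈⟨ +-cong (*-congˡ (⟨⟩-comm α γ)) (*-congˡ (⟨⟩-comm β γ)) ⟩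
    s * ⟨ γ , α ⟩ + t * ⟨ γ , β ⟩   ∎

  ⟨⟩-nonNeg : ∀ {N} (α : Vector N) → 0# ≤ ⟨ α , α ⟩
  ⟨⟩-nonNeg α = sum-nonNeg (λ v → x²-nonNeg (α v))

  sum≈0⇒≈0 : ∀ {N} {α : Vector N} → (∀ v → 0# ≤ α v) → sum α ≤ 0# → ∀ v → α v ≈ 0#
  sum≈0⇒≈0 {suc N} {α} 0≤α Σ≤0 zero = antisym (begin
    α zero                               ≤⟨ ≤-from-gap (sum-nonNeg (λ v → 0≤α (suc v))) refl ⟩
    sum α                                ≤⟨ Σ≤0 ⟩
    0#                                   ∎) (0≤α zero)
  sum≈0⇒≈0 {suc N} {α} 0≤α Σ≤0 (suc v) = sum≈0⇒≈0 (λ v → 0≤α (suc v))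
    (≤-trans (≤-from-gap (0≤α zero) (+-comm _ _)) Σ≤0) v

  ⟨⟩-definite : ∀ {N} (α : Vector N) → ⟨ α , α ⟩ ≤ 0# → ∀ v → α v ≈ 0#
  ⟨⟩-definite α αα≤0 v = x²≈0⇒x≈0 (sum≈0⇒≈0 (λ v → x²-nonNeg (α v)) αα≤0 v)

  ⟨⟩≉0 : ∀ {N} (α : Vector N) → ¬ (∀ v → α v ≈ 0#) → ¬ ⟨ α , α ⟩ ≈ 0#
  ⟨⟩≉0 α α≉0 αα≈0 = α≉0 (⟨⟩-definite α (≤-reflexive αα≈0))

  ∥∥-nonNeg : ∀ {N} (α : Vector N) → 0# ≤ ∥ α ∥
  ∥∥-nonNeg α = root-nonNeg 2 ⟨ α , α ⟩

  ∥∥-square : ∀ {N} (α : Vector N) → ∥ α ∥ * ∥ α ∥ ≈ ⟨ α , α ⟩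
  ∥∥-square α = √-square (⟨⟩-nonNeg α)

  -- Operators are functions rather than matrices, so that averaging and permuting coordinates are
  -- expressed directly; respect for pointwise equality then has to be a field.
  record Symmetric {N} (T : Vector N → Vector N) : Set where
    field
      T-cong    : ∀ {α β} → α ≋ β → T α ≋ T β
      linear    : ∀ s t α β → T (s • α ⊕ t • β) ≋ s • T α ⊕ t • T β
      symmetric : ∀ α β → ⟨ T α , β ⟩ ≈ ⟨ α , T β ⟩

  module _ {N} {T : Vector N → Vector N} (T-sym : Symmetric T) where
    open Symmetric T-sym

    -- At `id-symmetric` this is the expansion of |s α + t β|², the source of most norm computations
    -- below.
    form-expand : ∀ s t α β → let γ = s • α ⊕ t • β in
      ⟨ T γ , γ ⟩ ≈ s * s * ⟨ T α , α ⟩ + (s * t * ⟨ T α , β ⟩ + s * t * ⟨ T α , β ⟩)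
                  + t * t * ⟨ T β , β ⟩
    form-expand s t α β = begin-equality
      ⟨ T γ , γ ⟩                                ≈⟨ ⟨⟩-cong (linear s t α β) (λ _ → refl) ⟩
      ⟨ s • T α ⊕ t • T β , γ ⟩                  ≈⟨ ⟨⟩-linearˡ s t (T α) (T β) γ ⟩
      s * ⟨ T α , γ ⟩ + t * ⟨ T β , γ ⟩          ≈⟨ +-cong (*-congˡ (⟨⟩-linearʳ s t α β (T α)))
                                                           (*-congˡ (⟨⟩-linearʳ s t α β (T β))) ⟩
      s * (s * ⟨ T α , α ⟩ + t * ⟨ T α , β ⟩) + t * (s * ⟨ T β , α ⟩ + t * ⟨ T β , β ⟩)
        ≈⟨ +-congˡ (*-congˡ (+-congʳ (*-congˡ (trans (symmetric β α) (⟨⟩-comm β (T α)))))) ⟩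
      s * (s * ⟨ T α , α ⟩ + t * ⟨ T α , β ⟩) + t * (s * ⟨ T α , β ⟩ + t * ⟨ T β , β ⟩)
        ≈⟨ solve 5 (λ s t a b c → s :* (s :* a :+ t :* b) :+ t :* (s :* b :+ t :* c)
             := s :* s :* a :+ (s :* t :* b :+ s :* t :* b) :+ t :* t :* c)
             refl s t ⟨ T α , α ⟩ ⟨ T α , β ⟩ ⟨ T β , β ⟩ ⟩
      s * s * ⟨ T α , α ⟩ + (s * t * ⟨ T α , β ⟩ + s * t * ⟨ T α , β ⟩) + t * t * ⟨ T β , β ⟩ ∎
      where γ = s • α ⊕ t • β

    -- The values of the form on the span of α and β are a nonnegative binary form. Degenerate forms
    -- must be covered: the result is applied to I - A and I + A, whose product is zero for the edge
    -- involution A.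
    cauchy-schwarz-form : (∀ α → 0# ≤ ⟨ T α , α ⟩) → ∀ α β →
      ⟨ T α , β ⟩ * ⟨ T α , β ⟩ ≤ ⟨ T α , α ⟩ * ⟨ T β , β ⟩
    cauchy-schwarz-form T-psd α β = discriminant (λ s t →
      ≤-trans (T-psd (s • α ⊕ t • β)) (≤-reflexive (form-expand s t α β)))

  id-symmetric : ∀ {N} → Symmetric {N} (λ α → α)
  id-symmetric = record
    { T-cong = λ α≋β → α≋β ; linear = λ _ _ _ _ _ → refl ; symmetric = λ _ _ → refl }

  cauchy-schwarz : ∀ {N} (α β : Vector N) → ⟨ α , β ⟩ * ⟨ α , β ⟩ ≤ ⟨ α , α ⟩ * ⟨ β , β ⟩
  cauchy-schwarz = cauchy-schwarz-form id-symmetric ⟨⟩-nonNeg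

  combination : ∀ {N} → Carrier → (Vector N → Vector N) → Carrier → (Vector N → Vector N) →
                Vector N → Vector N
  combination a S b T α = a • S α ⊕ b • T α

  combination-symmetric : ∀ {N} a b {S T : Vector N → Vector N} →
    Symmetric S → Symmetric T → Symmetric (combination a S b T)
  combination-symmetric a b {S} {T} S-sym T-sym = record
    { T-cong    = λ α≋β v → +-cong (*-congˡ (S.T-cong α≋β v)) (*-congˡ (T.T-cong α≋β v))
    ; linear    = λ s t α β v → begin-equality
        a * S (s • α ⊕ t • β) v + b * T (s • α ⊕ t • β) v
          ≈⟨ +-cong (*-congˡ (S.linear s t α β v)) (*-congˡ (T.linear s t α β v)) ⟩
        a * (s * S α v + t * S β v) + b * (s * T α v + t * T β v)
          ≈⟨ solve 8 (λ a b s t p q x y → a :* (s :* p :+ t :* q) :+ b :* (s :* x :+ t :* y)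
               := s :* (a :* p :+ b :* x) :+ t :* (a :* q :+ b :* y))
               refl a b s t (S α v) (S β v) (T α v) (T β v) ⟩
        s * (a * S α v + b * T α v) + t * (a * S β v + b * T β v) ∎
    ; symmetric = λ α β → begin-equality
        ⟨ a • S α ⊕ b • T α , β ⟩          ≈⟨ ⟨⟩-linearˡ a b (S α) (T α) β ⟩
        a * ⟨ S α , β ⟩ + b * ⟨ T α , β ⟩  ≈⟨ +-cong (*-congˡ (S.symmetric α β)) (*-congˡ (T.symmetric α β)) ⟩
        a * ⟨ α , S β ⟩ + b * ⟨ α , T β ⟩  ≈⟨ ⟨⟩-linearʳ a b (S β) (T β) α ⟨
        ⟨ α , a • S β ⊕ b • T β ⟩          ∎
    }
    where module S = Symmetric S-sym
          module T = Symmetric T-sym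

  sandwich-symmetric : ∀ {N} {S T : Vector N → Vector N} →
    Symmetric S → Symmetric T → Symmetric (λ α → S (T (S α)))
  sandwich-symmetric {S = S} {T} S-sym T-sym = record
    { T-cong    = λ α≋β → S.T-cong (T.T-cong (S.T-cong α≋β))
    ; linear    = λ s t α β v →
        trans (S.T-cong (T.T-cong (S.linear s t α β)) v)
        (trans (S.T-cong (T.linear s t (S α) (S β)) v) (S.linear s t (T (S α)) (T (S β)) v))
    ; symmetric = λ α β →
        trans (S.symmetric (T (S α)) β) (trans (T.symmetric (S α) (S β)) (S.symmetric α (T (S β))))
    }
    where module S = Symmetric S-sym
          module T = Symmetric T-sym

  Contraction : ∀ {N} → (Vector N → Vector N) → Set
  Contraction T = ∀ α → ⟨ T α , T α ⟩ ≤ ⟨ α , α ⟩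

  -- A sign σ = ±1, so that σ x ≤ c for both signs says |x| ≤ c.
  Sign : Carrier → Set
  Sign σ = σ * σ ≈ 1#

  sign-1 : Sign 1#
  sign-1 = *-identityˡ 1#

  sign--1 : Sign (- 1#)
  sign--1 = solve 0 ((:- :1) :* (:- :1) := :1) refl

  -- This is |α - σ β|² ≥ 0, with σ² = 1 removing the sign from the last square.
  signed-am-gm : ∀ {N} {σ} → Sign σ → (α β : Vector N) →
    σ * ⟨ α , β ⟩ + σ * ⟨ α , β ⟩ ≤ ⟨ α , α ⟩ + ⟨ β , β ⟩
  signed-am-gm {σ = σ} σ²≈1 α β = ≤-from-gap (⟨⟩-nonNeg (1# • α ⊕ (- σ) • β)) (begin-equality
    σ * ⟨ α , β ⟩ + σ * ⟨ α , β ⟩ + ⟨ 1# • α ⊕ (- σ) • β , 1# • α ⊕ (- σ) • β ⟩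
      ≈⟨ +-congˡ (form-expand id-symmetric 1# (- σ) α β) ⟩
    σ * ⟨ α , β ⟩ + σ * ⟨ α , β ⟩ + (1# * 1# * ⟨ α , α ⟩ +
      (1# * - σ * ⟨ α , β ⟩ + 1# * - σ * ⟨ α , β ⟩) + - σ * - σ * ⟨ β , β ⟩)
      ≈⟨ solve 4 (λ s a b c → s :* b :+ s :* b :+ (:1 :* :1 :* a :+
           (:1 :* (:- s) :* b :+ :1 :* (:- s) :* b) :+ (:- s) :* (:- s) :* c)
           := a :+ s :* s :* c) refl σ ⟨ α , α ⟩ ⟨ α , β ⟩ ⟨ β , β ⟩ ⟩
    ⟨ α , α ⟩ + σ * σ * ⟨ β , β ⟩   ≈⟨ +-congˡ (trans (*-congʳ σ²≈1) (*-identityˡ _)) ⟩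
    ⟨ α , α ⟩ + ⟨ β , β ⟩           ∎)

  contraction-form : ∀ {N} {T : Vector N → Vector N} → Contraction T → ∀ {σ} → Sign σ → ∀ α →
                     σ * ⟨ T α , α ⟩ ≤ ⟨ α , α ⟩
  contraction-form {T = T} T-contr {σ} σ²≈1 α = double-cancel-≤ (begin
    σ * ⟨ T α , α ⟩ + σ * ⟨ T α , α ⟩   ≤⟨ signed-am-gm σ²≈1 (T α) α ⟩
    ⟨ T α , T α ⟩ + ⟨ α , α ⟩           ≤⟨ +-monoˡ-≤ ⟨ α , α ⟩ (T-contr α) ⟩
    ⟨ α , α ⟩ + ⟨ α , α ⟩               ∎)

-- Positive definite forms on a coordinate space are coercive.

module QuadraticForms (ℝ : CompleteOrderedField) where

  open InnerProduct ℝ public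
  open Spectral ℝ public using (_∙_)
  open import Relation.Binary.Reasoning.PartialOrder ≤-poset

  δ : ∀ {N} → Fin N → Vector N
  δ i j = if does (i Fin.≟ j) then 1# else 0#

  sum-0 : ∀ {N} (α : Vector N) → sum (λ v → 0# * α v) ≈ 0#
  sum-0 α = trans (sym (*-distribˡ-sum 0# α)) (zeroˡ (sum α))

  ⟨δ,⟩ : ∀ {N} (i : Fin N) (α : Vector N) → ⟨ δ i , α ⟩ ≈ α i
  ⟨δ,⟩ zero α = begin-equality
    1# * α zero + sum (λ v → 0# * α (suc v)) ≈⟨ +-cong (*-identityˡ _) (sum-0 (λ v → α (suc v))) ⟩
    α zero + 0#                              ≈⟨ +-identityʳ _ ⟩
    α zero                                   ∎
  ⟨δ,⟩ (suc i) α = begin-equality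
    0# * α zero + ⟨ δ i , (λ v → α (suc v)) ⟩ ≈⟨ +-cong (zeroˡ _) (⟨δ,⟩ i (λ v → α (suc v))) ⟩
    0# + α (suc i)                            ≈⟨ +-identityˡ _ ⟩
    α (suc i)                                 ∎

  -- The list of (s , ℓ) stands for the quadratic form Σ s ⟨ ℓ , x ⟩².
  Form : ℕ → Set
  Form n = List (Carrier × Vector n)

  ⟪_⟫ : ∀ {n} → Form n → Vector n → Carrier
  ⟪ [] ⟫          x = 0#
  ⟪ (s , ℓ) ∷ q ⟫ x = s * (⟨ ℓ , x ⟩ * ⟨ ℓ , x ⟩) + ⟪ q ⟫ x

  -- `leading`, `mixed` and `trailing` are the blocks b, c and r in q (x₀ , y) = b x₀² + 2 x₀ ⟨c ,
  -- y⟩ + r (y).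
  leading : ∀ {n} → Form (suc n) → Carrier
  leading []            = 0#
  leading ((s , ℓ) ∷ q) = s * (ℓ zero * ℓ zero) + leading q

  mixed : ∀ {n} → Form (suc n) → Vector n
  mixed []            = 0# • 𝟙
  mixed ((s , ℓ) ∷ q) = (s * ℓ zero) • (λ v → ℓ (suc v)) ⊕ 1# • mixed q

  trailing : ∀ {n} → Form (suc n) → Form n
  trailing []            = []
  trailing ((s , ℓ) ∷ q) = (s , (λ v → ℓ (suc v))) ∷ trailing q

  module _ {n : ℕ} where

    split : (q : Form (suc n)) (x : Vector (suc n)) →
      let x₀ = x zero ; y = λ v → x (suc v) ; c = ⟨ mixed q , y ⟩ in
      ⟪ q ⟫ x ≈ leading q * (x₀ * x₀) + (x₀ * c + x₀ * c) + ⟪ trailing q ⟫ y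
    split [] x = begin-equality
      0#  ≈⟨ solve 1 (λ x → :0 := :0 :* (x :* x) :+ (x :* :0 :+ x :* :0) :+ :0) refl (x zero) ⟩
      0# * (x₀ * x₀) + (x₀ * 0# + x₀ * 0#) + 0#
        ≈⟨ +-congʳ (+-congˡ (+-cong (*-congˡ c≈0) (*-congˡ c≈0))) ⟨
      0# * (x₀ * x₀) + (x₀ * c + x₀ * c) + 0# ∎
      where
      x₀ = x zero
      y = λ v → x (suc v)
      c = ⟨ 0# • 𝟙 , y ⟩
      c≈0 : c ≈ 0#
      c≈0 = begin-equality
        sum (λ v → 0# * 1# * y v) ≈⟨ sum-cong {n} {λ v → 0# * 1# * y v} (λ v → *-congʳ (zeroˡ 1#)) ⟩
        sum (λ v → 0# * y v)      ≈⟨ sum-0 y ⟩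
        0#                        ∎
    split ((s , ℓ) ∷ q) x = begin-equality
      s * (⟨ ℓ , x ⟩ * ⟨ ℓ , x ⟩) + ⟪ q ⟫ x ≈⟨ +-congˡ (split q x) ⟩
      s * (⟨ ℓ , x ⟩ * ⟨ ℓ , x ⟩) +
        (leading q * (x₀ * x₀) + (x₀ * c + x₀ * c) + ⟪ trailing q ⟫ y)
        ≈⟨ solve 7 (λ s l x₀ a b c t →
             s :* ((l :* x₀ :+ a) :* (l :* x₀ :+ a)) :+ (b :* (x₀ :* x₀) :+ (x₀ :* c :+ x₀ :* c) :+ t)
             := (s :* (l :* l) :+ b) :* (x₀ :* x₀) :+
                (x₀ :* (s :* l :* a :+ :1 :* c) :+ x₀ :* (s :* l :* a :+ :1 :* c)) :+
                (s :* (a :* a) :+ t))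
             refl s (ℓ zero) x₀ ⟨ ℓ′ , y ⟩ (leading q) c (⟪ trailing q ⟫ y) ⟩
      leading q⁺ * (x₀ * x₀) + (x₀ * d + x₀ * d) + ⟪ trailing q⁺ ⟫ y
        ≈⟨ +-congʳ (+-congˡ (+-cong (*-congˡ d≈) (*-congˡ d≈))) ⟨
      leading q⁺ * (x₀ * x₀) + (x₀ * ⟨ mixed q⁺ , y ⟩ + x₀ * ⟨ mixed q⁺ , y ⟩) + ⟪ trailing q⁺ ⟫ y ∎
      where
      q⁺ = (s , ℓ) ∷ q
      x₀ = x zero
      y = λ v → x (suc v)
      ℓ′ = λ v → ℓ (suc v)
      c = ⟨ mixed q , y ⟩
      d = s * ℓ zero * ⟨ ℓ′ , y ⟩ + 1# * c
      d≈ : ⟨ mixed q⁺ , y ⟩ ≈ d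
      d≈ = ⟨⟩-linearˡ (s * ℓ zero) 1# ℓ′ (mixed q) y

  ⟪⟫-0 : ∀ {n} (q : Form n) → ⟪ q ⟫ (λ _ → 0#) ≈ 0#
  ⟪⟫-0 [] = refl
  ⟪⟫-0 ((s , ℓ) ∷ q) = begin-equality
    s * (⟨ ℓ , (λ _ → 0#) ⟩ * ⟨ ℓ , (λ _ → 0#) ⟩) + ⟪ q ⟫ (λ _ → 0#)
      ≈⟨ +-cong (*-congˡ (*-congʳ (trans (⟨⟩-comm ℓ (λ _ → 0#)) (sum-0 ℓ)))) (⟪⟫-0 q) ⟩
    s * (0# * ⟨ ℓ , (λ _ → 0#) ⟩) + 0# ≈⟨ solve 2 (λ s a → s :* (:0 :* a) :+ :0 := :0) refl s ⟨ ℓ , (λ _ → 0#) ⟩ ⟩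
    0# ∎

  infixr 5 _◂_
  _◂_ : ∀ {n} → Carrier → Vector n → Vector (suc n)
  (x ◂ y) zero    = x
  (x ◂ y) (suc v) = y v

  -- The bound is stated with the constant on the side of q; K ≥ 1 keeps K invertible even when the
  -- zero vector is the only one.
  IsCoercive : ∀ {n} → (Vector n → Set) → Form n → Set
  IsCoercive {n} P q = ∃ λ K → 1# ≤ K × (∀ x → P x → ⟨ x , x ⟩ ≤ K * ⟪ q ⟫ x)

  HasNonPositive : ∀ {n} → (Vector n → Set) → Form n → Set
  HasNonPositive P q = ∃ λ x → P x × ¬ (∀ v → x v ≈ 0#) × ⟪ q ⟫ x ≤ 0#

  -- Completing the square in the first variable: with b the leading coefficient
  -- and c the mixed one,  b x₀² + 2 c x₀ + r = b (x₀ + c / b)² + (r - c² / b).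
  schur : ∀ {n} → Form (suc n) → Form n
  schur q = (- (leading q ⁻¹) , mixed q) ∷ trailing q

  module Schur {n} (q : Form (suc n)) (b≉0 : ¬ leading q ≈ 0#) where

    b i : Carrier
    b = leading q
    i = b ⁻¹

    bi≈1 : b * i ≈ 1#
    bi≈1 = *-inverseʳ b b≉0

    module _ (x : Vector (suc n)) where

      x₀ = x zero
      y : Vector n
      y v = x (suc v)
      c r z : Carrier
      c = ⟨ mixed q , y ⟩
      r = ⟪ trailing q ⟫ y
      z = x₀ + i * c

      complete-square : ⟪ q ⟫ x ≈ b * (z * z) + ⟪ schur q ⟫ y
      complete-square = begin-equality
        ⟪ q ⟫ x                                       ≈⟨ split q x ⟩
        b * (x₀ * x₀) + (x₀ * c + x₀ * c) + r
          -- As a ring identity this holds only up to a multiple of b i - 1, which is carried along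
          -- and then replaced by zero.
          ≈⟨ solve 5 (λ b i x c r → b :* (x :* x) :+ (x :* c :+ x :* c) :+ r :=
               b :* ((x :+ i :* c) :* (x :+ i :* c)) :+ ((:- i) :* (c :* c) :+ r)
               :- (b :* i :- :1) :* (x :* c :+ x :* c :+ i :* c :* c))
             refl b i x₀ c r ⟩
        b * (z * z) + (- i * (c * c) + r) - (b * i - 1#) * (x₀ * c + x₀ * c + i * c * c)
          ≈⟨ +-congˡ (-‿cong (*-congʳ (+-congʳ bi≈1))) ⟩
        b * (z * z) + (- i * (c * c) + r) - (1# - 1#) * (x₀ * c + x₀ * c + i * c * c)
          ≈⟨ solve 2 (λ p q → p :- (:1 :- :1) :* q := p) refl _ _ ⟩
        b * (z * z) + (- i * (c * c) + r)             ∎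

  -- Induction on the dimension. If b ≤ 0, the first basis vector is a witness. Otherwise a witness
  -- y for the Schur complement lifts with x₀ = -c / b, which kills the square, while coercivity
  -- lifts because x₀² ≤ 2 z² + 2 (c / b)² and c² is at most |y|² times the squared norm of
  -- `mixed q`.
  dichotomy : ∀ {n} (q : Form n) → IsCoercive U q ⊎ HasNonPositive U q
  dichotomy {zero} q = inj₁ (1# , ≤-refl , λ x _ → ≤-reflexive (begin-equality
    0#                   ≈⟨ zeroʳ 1# ⟨
    1# * 0#              ≈⟨ *-congˡ (vanishes q x) ⟨
    1# * ⟪ q ⟫ x         ∎))
    where
    vanishes : (q : Form 0) (x : Vector 0) → ⟪ q ⟫ x ≈ 0#
    vanishes []            x = refl
    vanishes ((s , ℓ) ∷ q) x = trans (+-cong (trans (*-congˡ (zeroˡ 0#)) (zeroʳ s)) (vanishes q x)) (+-identityˡ 0#)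
  dichotomy {suc n} q with leading q ≤? 0#
  ... | yes b≤0 = inj₂ (e , _ , (λ e≈0 → 0≉1 (sym (e≈0 zero))) , (begin
    ⟪ q ⟫ e
      ≈⟨ split q e ⟩
    leading q * (1# * 1#) + (1# * c + 1# * c) + ⟪ trailing q ⟫ (λ _ → 0#)
      ≈⟨ +-cong (+-congˡ (+-cong (*-congˡ c≈0) (*-congˡ c≈0))) (⟪⟫-0 (trailing q)) ⟩
    leading q * (1# * 1#) + (1# * 0# + 1# * 0#) + 0#
      ≈⟨ solve 1 (λ b → b :* (:1 :* :1) :+ (:1 :* :0 :+ :1 :* :0) :+ :0 := b) refl (leading q) ⟩
    leading q   ≤⟨ b≤0 ⟩
    0#          ∎))
    where
    e = 1# ◂ (λ _ → 0#)
    c = ⟨ mixed q , (λ _ → 0#) ⟩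
    c≈0 : c ≈ 0#
    c≈0 = trans (⟨⟩-comm (mixed q) (λ _ → 0#)) (sum-0 (mixed q))
  ... | no b≰0 = [ coercive , nonPositive ]′ (dichotomy (schur q))
    where
    open Schur q (λ b≈0 → b≰0 (≤-reflexive b≈0))
    0≤b : 0# ≤ b
    0≤b = [ (λ 0≤b → 0≤b) , (λ b≤0 → contradiction b≤0 b≰0) ]′ (total 0# b)
    0≤i : 0# ≤ i
    0≤i = ⁻¹-nonNeg 0≤b (λ b≈0 → b≰0 (≤-reflexive b≈0))
    coercive : IsCoercive U (schur q) → _
    coercive (K , 1≤K , bound) = inj₁ (K′ , ≤-trans 1≤K (≤-from-gap 0≤gap eq) , λ x _ → coercive-at x)
      where
      0≤K = ≤-trans 0≤1 1≤K
      w = ⟨ mixed q , mixed q ⟩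
      0≤w = ⟨⟩-nonNeg (mixed q)
      L = 1# + (i * i * w + i * i * w)
      -- 2 z² is 2 i times b z², and L |y|² is at most L K times the Schur complement; K′ adds both
      -- factors.
      K′ = i + i + L * K
      0≤i²w = *-nonNeg (x²-nonNeg i) 0≤w
      0≤L = +-nonNeg 0≤1 (+-nonNeg 0≤i²w 0≤i²w)
      0≤gap : 0# ≤ i + i + (i * i * w + i * i * w) * K
      0≤gap = +-nonNeg (+-nonNeg 0≤i 0≤i) (*-nonNeg (+-nonNeg 0≤i²w 0≤i²w) 0≤K)
      eq : K + (i + i + (i * i * w + i * i * w) * K) ≈ K′
      eq = solve 3 (λ k i a → k :+ (i :+ i :+ a :* k) := i :+ i :+ (:1 :+ a) :* k) refl K i _
      coercive-at : ∀ x → ⟨ x , x ⟩ ≤ K′ * ⟪ q ⟫ x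
      coercive-at x = begin
        x₀ x * x₀ x + Y
          ≤⟨ ≤-from-gap (x²-nonNeg (z x + i * c x)) (solve 4 (λ x i c y →
               let z = x :+ i :* c in x :* x :+ y :+ (z :+ i :* c) :* (z :+ i :* c)
               := z :* z :+ z :* z :+ (i :* i :* (c :* c) :+ i :* i :* (c :* c) :+ y)) refl (x₀ x) i (c x) Y) ⟩
        Z + Z + (i * i * (c x * c x) + i * i * (c x * c x) + Y)
          ≤⟨ +-monoʳ-≤ (Z + Z) (+-monoˡ-≤ Y (+-mono-≤ i²c²≤ i²c²≤)) ⟩
        Z + Z + (i * i * (w * Y) + i * i * (w * Y) + Y)
          ≈⟨ solve 4 (λ z i w y → z :+ z :+ (i :* i :* (w :* y) :+ i :* i :* (w :* y) :+ y)
               := z :+ z :+ (:1 :+ (i :* i :* w :+ i :* i :* w)) :* y) refl Z i w Y ⟩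
        Z + Z + L * Y
          ≤⟨ +-monoʳ-≤ (Z + Z) (*-monoʳ-≤ 0≤L (bound (y x) _)) ⟩
        Z + Z + L * (K * S)
          ≈⟨ +-congʳ (+-cong (*-identityˡ Z) (*-identityˡ Z)) ⟨
        1# * Z + 1# * Z + L * (K * S)
          ≈⟨ +-congʳ (+-cong (*-congʳ bi≈1) (*-congʳ bi≈1)) ⟨
        b * i * Z + b * i * Z + L * (K * S)
          ≤⟨ ≤-from-gap (+-nonNeg (*-nonNeg (*-nonNeg 0≤L 0≤K) (*-nonNeg 0≤b (x²-nonNeg (z x))))
                                  (*-nonNeg (+-nonNeg 0≤i 0≤i) 0≤S))
               (solve 6 (λ b i z l k s → b :* i :* z :+ b :* i :* z :+ l :* (k :* s) :+
                 (l :* k :* (b :* z) :+ (i :+ i) :* s) := (i :+ i :+ l :* k) :* (b :* z :+ s))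
                 refl b i Z L K S) ⟩
        K′ * (b * Z + S)
          ≈⟨ *-congˡ (complete-square x) ⟨
        K′ * ⟪ q ⟫ x ∎
        where
        Y = ⟨ y x , y x ⟩
        Z = z x * z x
        S = ⟪ schur q ⟫ (y x)
        i²c²≤ : i * i * (c x * c x) ≤ i * i * (w * Y)
        i²c²≤ = *-monoʳ-≤ (x²-nonNeg i) (cauchy-schwarz (mixed q) (y x))
        0≤S : 0# ≤ S
        0≤S = *-cancelˡ-≤ 0≤K (λ K≈0 → 1≰0 (≤-trans 1≤K (≤-reflexive K≈0))) (begin
          K * 0#   ≈⟨ zeroʳ K ⟩
          0#       ≤⟨ ⟨⟩-nonNeg (y x) ⟩
          Y        ≤⟨ bound (y x) _ ⟩
          K * S    ∎)
    nonPositive : HasNonPositive U (schur q) → _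
    nonPositive (y′ , _ , y≉0 , S≤0) =
      inj₂ (x , _ , (λ x≈0 → y≉0 (λ v → x≈0 (suc v))) , (begin
        ⟪ q ⟫ x                              ≈⟨ complete-square x ⟩
        b * (z x * z x) + ⟪ schur q ⟫ y′     ≈⟨ +-congʳ (*-congˡ (*-cong (-‿inverseˡ _) (-‿inverseˡ _))) ⟩
        b * (0# * 0#) + ⟪ schur q ⟫ y′       ≈⟨ solve 2 (λ b s → b :* (:0 :* :0) :+ s := s) refl b _ ⟩
        ⟪ schur q ⟫ y′                       ≤⟨ S≤0 ⟩
        0#                                   ∎))
      where
      x = - (i * ⟨ mixed q , y′ ⟩) ◂ y′

-- The norm on balanced vectors is attained.

module AttainedNorm (ℝ : CompleteOrderedField) where

  open QuadraticForms ℝ public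
  open import Relation.Binary.Reasoning.PartialOrder ≤-poset

  Balanced : ∀ {N} → Vector N → Set
  Balanced α = ⟨ α , 𝟙 ⟩ ≈ 0#

  balance : ∀ {n} → Vector n → Vector (suc n)
  balance y = - ⟨ y , 𝟙 ⟩ ◂ y

  balance-balanced : ∀ {n} (y : Vector n) → Balanced (balance y)
  balance-balanced y = trans (+-congʳ (*-identityʳ _)) (-‿inverseˡ ⟨ y , 𝟙 ⟩)

  head-balanced : ∀ {n} (x : Vector (suc n)) → Balanced x →
                  x zero ≈ - ⟨ (λ v → x (suc v)) , 𝟙 ⟩
  head-balanced x x⊥𝟙 = begin-equality
    x₀                    ≈⟨ solve 2 (λ x s → x := (x :* :1 :+ s) :- s) refl x₀ s ⟩
    x₀ * 1# + s - s       ≈⟨ +-congʳ x⊥𝟙 ⟩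
    0# - s                ≈⟨ +-identityˡ (- s) ⟩
    - s                   ∎
    where
    x₀ = x zero
    s = ⟨ (λ v → x (suc v)) , 𝟙 ⟩

  -- The pullback of q along `balance`: substituting minus the sum of the other coordinates for the
  -- first one turns ℓ into ℓ′ - ℓ₀ 𝟙. Thus the dichotomy for a coordinate space also serves the
  -- hyperplane 𝟙^⊥.
  restrict : ∀ {n} → Form (suc n) → Form n
  restrict []            = []
  restrict ((s , ℓ) ∷ q) = (s , 1# • (λ v → ℓ (suc v)) ⊕ (- ℓ zero) • 𝟙) ∷ restrict q

  restrict-⟪⟫ : ∀ {n} (q : Form (suc n)) x → Balanced x →
                ⟪ restrict q ⟫ (λ v → x (suc v)) ≈ ⟪ q ⟫ x
  restrict-⟪⟫ []            x x⊥𝟙 = refl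
  restrict-⟪⟫ ((s , ℓ) ∷ q) x x⊥𝟙 =
    +-cong (*-congˡ (*-cong ℓ≈ ℓ≈)) (restrict-⟪⟫ q x x⊥𝟙)
    where
    ℓ′ = λ v → ℓ (suc v)
    y = λ v → x (suc v)
    ℓ≈ : ⟨ 1# • ℓ′ ⊕ (- ℓ zero) • 𝟙 , y ⟩ ≈ ⟨ ℓ , x ⟩
    ℓ≈ = begin-equality
      ⟨ 1# • ℓ′ ⊕ (- ℓ zero) • 𝟙 , y ⟩           ≈⟨ ⟨⟩-linearˡ 1# (- ℓ zero) ℓ′ 𝟙 y ⟩
      1# * ⟨ ℓ′ , y ⟩ + - ℓ zero * ⟨ 𝟙 , y ⟩     ≈⟨ +-congˡ (*-congˡ (⟨⟩-comm 𝟙 y)) ⟩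
      1# * ⟨ ℓ′ , y ⟩ + - ℓ zero * ⟨ y , 𝟙 ⟩
        ≈⟨ solve 3 (λ a l s → :1 :* a :+ (:- l) :* s := l :* (:- s) :+ a)
             refl ⟨ ℓ′ , y ⟩ (ℓ zero) ⟨ y , 𝟙 ⟩ ⟩
      ℓ zero * - ⟨ y , 𝟙 ⟩ + ⟨ ℓ′ , y ⟩          ≈⟨ +-congʳ (*-congˡ (head-balanced x x⊥𝟙)) ⟨
      ℓ zero * x zero + ⟨ ℓ′ , y ⟩               ∎

  -- The eliminated coordinate is a sum of m others, so by Cauchy-Schwarz its square is at most m
  -- |y|²; this costs the factor m + 1 in the constant.
  dichotomy-balanced : ∀ {n} (q : Form (suc n)) → IsCoercive Balanced q ⊎ HasNonPositive Balanced q
  dichotomy-balanced {n} q = [ coercive , nonPositive ]′ (dichotomy (restrict q))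
    where
    m = ⟨ 𝟙 {n} , 𝟙 {n} ⟩
    0≤m : 0# ≤ m
    0≤m = ⟨⟩-nonNeg {n} 𝟙
    coercive : IsCoercive U (restrict q) → _
    coercive (K , 1≤K , bound) = inj₁ (K′ , 1≤K′ , coercive-at)
      where
      K′ = (m + 1#) * K
      1≤K′ : 1# ≤ K′
      1≤K′ = ≤-trans 1≤K (≤-from-gap (*-nonNeg 0≤m (≤-trans 0≤1 1≤K))
        (solve 2 (λ m k → k :+ m :* k := (m :+ :1) :* k) refl m K))
      coercive-at : ∀ x → Balanced x → ⟨ x , x ⟩ ≤ K′ * ⟪ q ⟫ x
      coercive-at x x⊥𝟙 = begin
        x zero * x zero + Y             ≈⟨ +-congʳ (*-cong (head-balanced x x⊥𝟙) (head-balanced x x⊥𝟙)) ⟩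
        - s * - s + Y                   ≈⟨ +-congʳ (solve 1 (λ s → (:- s) :* (:- s) := s :* s) refl s) ⟩
        s * s + Y                       ≤⟨ +-monoˡ-≤ Y (cauchy-schwarz y 𝟙) ⟩
        Y * m + Y                       ≈⟨ solve 2 (λ y m → y :* m :+ y := (m :+ :1) :* y) refl Y m ⟩
        (m + 1#) * Y                    ≤⟨ *-monoʳ-≤ (+-nonNeg 0≤m 0≤1) (bound y _) ⟩
        (m + 1#) * (K * ⟪ restrict q ⟫ y) ≈⟨ *-assoc _ _ _ ⟨
        K′ * ⟪ restrict q ⟫ y           ≈⟨ *-congˡ (restrict-⟪⟫ q x x⊥𝟙) ⟩
        K′ * ⟪ q ⟫ x                    ∎
        where
        y = λ v → x (suc v)
        Y = ⟨ y , y ⟩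
        s = ⟨ y , 𝟙 ⟩
    nonPositive : HasNonPositive U (restrict q) → _
    nonPositive (y , _ , y≉0 , q≤0) =
      inj₂ (balance y , balance-balanced y , (λ x≈0 → y≉0 (λ v → x≈0 (suc v))) ,
        ≤-trans (≤-reflexive (sym (restrict-⟪⟫ q (balance y) (balance-balanced y)))) q≤0)

  ⟪⟫-++ : ∀ {n} (q q′ : Form n) x → ⟪ q ++ q′ ⟫ x ≈ ⟪ q ⟫ x + ⟪ q′ ⟫ x
  ⟪⟫-++ []            q′ x = sym (+-identityˡ _)
  ⟪⟫-++ ((s , ℓ) ∷ q) q′ x = trans (+-congˡ (⟪⟫-++ q q′ x)) (sym (+-assoc _ _ _))

  Matrix : ℕ → ℕ → Set
  Matrix m n = Fin m → Fin n → Carrier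

  -- The form s |A x|², with the rows of A as its functionals; for A = `δ` it is s |x|².
  scaledGram : ∀ {m n} → Carrier → Matrix m n → Form n
  scaledGram s A = tabulate (λ u → s , A u)

  ⟪scaledGram⟫ : ∀ {m n} s (A : Matrix m n) x →
    ⟪ scaledGram s A ⟫ x ≈ s * sum (λ u → ⟨ A u , x ⟩ * ⟨ A u , x ⟩)
  ⟪scaledGram⟫ {zero}  s A x = sym (zeroʳ s)
  ⟪scaledGram⟫ {suc m} s A x =
    trans (+-congˡ (⟪scaledGram⟫ s (λ u → A (suc u)) x)) (sym (distribˡ s _ _))

  ∥∥≉0 : ∀ {N} (α : Vector N) → ¬ (∀ v → α v ≈ 0#) → ¬ ∥ α ∥ ≈ 0#
  ∥∥≉0 α α≉0 ∥α∥≈0 = ⟨⟩≉0 α α≉0 (begin-equality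
    ⟨ α , α ⟩       ≈⟨ ∥∥-square α ⟨
    ∥ α ∥ * ∥ α ∥   ≈⟨ *-congˡ ∥α∥≈0 ⟩
    ∥ α ∥ * 0#      ≈⟨ zeroʳ ∥ α ∥ ⟩
    0#              ∎)
  ratio-nonNeg : ∀ {N M} (α : Vector N) (β : Vector M) → ¬ (∀ v → β v ≈ 0#) → 0# ≤ ∥ α ∥ / ∥ β ∥
  ratio-nonNeg α β β≉0 = *-nonNeg (∥∥-nonNeg α) (⁻¹-nonNeg (∥∥-nonNeg β) (∥∥≉0 β β≉0))

  module _ {N M} (α : Vector N) (β : Vector M) (β≉0 : ¬ (∀ v → β v ≈ 0#)) where

    ratio-square : let r = ∥ α ∥ / ∥ β ∥ in r * r * ⟨ β , β ⟩ ≈ ⟨ α , α ⟩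
    ratio-square = begin-equality
      r * r * ⟨ β , β ⟩          ≈⟨ *-congˡ (∥∥-square β) ⟨
      r * r * (∥ β ∥ * ∥ β ∥)    ≈⟨ solve 2 (λ r b → r :* r :* (b :* b) := r :* b :* (r :* b)) refl r ∥ β ∥ ⟩
      r * ∥ β ∥ * (r * ∥ β ∥)    ≈⟨ *-cong (x/y*y ∥ α ∥ (∥∥≉0 β β≉0)) (x/y*y ∥ α ∥ (∥∥≉0 β β≉0)) ⟩
      ∥ α ∥ * ∥ α ∥              ≈⟨ ∥∥-square α ⟩
      ⟨ α , α ⟩                  ∎
      where r = ∥ α ∥ / ∥ β ∥

    ratio-≤ : ∀ {c} → 0# ≤ c → ⟨ α , α ⟩ ≤ c * c * ⟨ β , β ⟩ → ∥ α ∥ / ∥ β ∥ ≤ c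
    ratio-≤ {c} 0≤c αα≤ = square-cancel-≤ 0≤c (*-cancelˡ-≤ (⟨⟩-nonNeg β) (⟨⟩≉0 β β≉0) (begin
      ⟨ β , β ⟩ * (r * r)   ≈⟨ *-comm _ _ ⟩
      r * r * ⟨ β , β ⟩     ≈⟨ ratio-square ⟩
      ⟨ α , α ⟩             ≤⟨ αα≤ ⟩
      c * c * ⟨ β , β ⟩     ≈⟨ *-comm _ _ ⟩
      ⟨ β , β ⟩ * (c * c)   ∎))
      where r = ∥ α ∥ / ∥ β ∥

    ≤-ratio : ∀ {c} → c * c * ⟨ β , β ⟩ ≤ ⟨ α , α ⟩ → c ≤ ∥ α ∥ / ∥ β ∥
    ≤-ratio {c} ≤αα = square-cancel-≤ (ratio-nonNeg α β β≉0) (*-cancelˡ-≤ (⟨⟩-nonNeg β) (⟨⟩≉0 β β≉0) (begin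
      ⟨ β , β ⟩ * (c * c)   ≈⟨ *-comm _ _ ⟩
      c * c * ⟨ β , β ⟩     ≤⟨ ≤αα ⟩
      ⟨ α , α ⟩             ≈⟨ ratio-square ⟨
      r * r * ⟨ β , β ⟩     ≈⟨ *-comm _ _ ⟩
      ⟨ β , β ⟩ * (r * r)   ∎))
      where r = ∥ α ∥ / ∥ β ∥

    ratio-≤⁻¹ : ∀ {c} → ∥ α ∥ / ∥ β ∥ ≤ c → ⟨ α , α ⟩ ≤ c * c * ⟨ β , β ⟩
    ratio-≤⁻¹ {c} r≤c = begin
      ⟨ α , α ⟩             ≈⟨ ratio-square ⟨
      r * r * ⟨ β , β ⟩     ≤⟨ *-monoˡ-≤ (⟨⟩-nonNeg β) (*-mono-≤ 0≤r r≤c 0≤r r≤c) ⟩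
      c * c * ⟨ β , β ⟩     ∎
      where r = ∥ α ∥ / ∥ β ∥
            0≤r = ratio-nonNeg α β β≉0

  Ratio : ∀ {N} → Matrix N N → Carrier → Set
  Ratio A r = ∃ λ α → Balanced α × ¬ (∀ v → α v ≈ 0#) × r ≈ ∥ A ∙ α ∥ / ∥ α ∥

  ratio-maximum : ∀ {n} (A : Matrix (suc (suc n)) (suc (suc n))) →
                  Contraction (A ∙_) → ∃ (IsMaximum (Ratio A))
  ratio-maximum {n} A A-contr = s , attained (dichotomy-balanced q) , s-upper
    where
    e : Vector (suc (suc n))
    -- The vector (-1 , 1 , 0 , ...) makes the set of ratios nonempty; two coordinates are what it
    -- takes.
    e = balance (1# ◂ (λ _ → 0#))

    e⊥𝟙 : Balanced e
    e⊥𝟙 = balance-balanced {suc n} (1# ◂ (λ _ → 0#))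

    e≉0 : ¬ (∀ v → e v ≈ 0#)
    e≉0 e≈0 = 0≉1 (sym (e≈0 (suc zero)))

    r₀ : Carrier
    r₀ = ∥ A ∙ e ∥ / ∥ e ∥

    r₀-ratio : Ratio A r₀
    r₀-ratio = e , e⊥𝟙 , e≉0 , refl

    1-upper : UpperBound (Ratio A) 1#
    1-upper {r} (α , α⊥𝟙 , α≉0 , r≈) = begin
      r                   ≈⟨ r≈ ⟩
      ∥ A ∙ α ∥ / ∥ α ∥   ≤⟨ ratio-≤ (A ∙ α) α α≉0 0≤1 (begin
        ⟨ A ∙ α , A ∙ α ⟩     ≤⟨ A-contr α ⟩
        ⟨ α , α ⟩             ≈⟨ solve 1 (λ a → :1 :* :1 :* a := a) refl ⟨ α , α ⟩ ⟨
        1# * 1# * ⟨ α , α ⟩   ∎) ⟩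
      1#                  ∎

    s-supremum = supremum (Ratio A) (r₀ , r₀-ratio) (1# , 1-upper)
    s = proj₁ s-supremum
    s-upper : UpperBound (Ratio A) s
    s-upper = proj₁ (proj₂ s-supremum)
    s-least : ∀ {b} → UpperBound (Ratio A) b → s ≤ b
    s-least = proj₂ (proj₂ s-supremum)

    0≤s : 0# ≤ s
    0≤s = ≤-trans (ratio-nonNeg (A ∙ e) e e≉0) (s-upper r₀-ratio)

    q : Form (suc (suc n))
    q = scaledGram (s * s) δ ++ scaledGram (- 1#) A

    ⟪q⟫ : ∀ α → ⟪ q ⟫ α ≈ s * s * ⟨ α , α ⟩ - ⟨ A ∙ α , A ∙ α ⟩
    ⟪q⟫ α = begin-equality
      ⟪ q ⟫ α ≈⟨ ⟪⟫-++ (scaledGram (s * s) δ) (scaledGram (- 1#) A) α ⟩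
      ⟪ scaledGram (s * s) δ ⟫ α + ⟪ scaledGram (- 1#) A ⟫ α
        ≈⟨ +-cong (⟪scaledGram⟫ (s * s) δ α) (⟪scaledGram⟫ (- 1#) A α) ⟩
      s * s * ⟨ (λ u → ⟨ δ u , α ⟩) , (λ u → ⟨ δ u , α ⟩) ⟩ + - 1# * ⟨ A ∙ α , A ∙ α ⟩
        ≈⟨ +-cong (*-congˡ (⟨⟩-cong (λ u → ⟨δ,⟩ u α) (λ u → ⟨δ,⟩ u α)))
             (solve 1 (λ a → (:- :1) :* a := :- a) refl ⟨ A ∙ α , A ∙ α ⟩) ⟩
      s * s * ⟨ α , α ⟩ - ⟨ A ∙ α , A ∙ α ⟩ ∎

    attained : IsCoercive Balanced q ⊎ HasNonPositive Balanced q → Ratio A s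
    attained (inj₂ (α , α⊥𝟙 , α≉0 , q≤0)) = α , α⊥𝟙 , α≉0 ,
      antisym (≤-ratio (A ∙ α) α α≉0 (begin
        s * s * ⟨ α , α ⟩
          ≈⟨ solve 2 (λ a b → a := a :- b :+ b) refl _ _ ⟩
        s * s * ⟨ α , α ⟩ - ⟨ A ∙ α , A ∙ α ⟩ + ⟨ A ∙ α , A ∙ α ⟩
          ≈⟨ +-congʳ (⟪q⟫ α) ⟨
        ⟪ q ⟫ α + ⟨ A ∙ α , A ∙ α ⟩
          ≤⟨ +-monoˡ-≤ _ q≤0 ⟩
        0# + ⟨ A ∙ α , A ∙ α ⟩
          ≈⟨ +-identityˡ _ ⟩
        ⟨ A ∙ α , A ∙ α ⟩ ∎))
      (s-upper (α , α⊥𝟙 , α≉0 , refl))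
    attained (inj₁ (K , 1≤K , bound)) = contradiction s²≤s²-i s²≰s²-i
      where
      K≉0 : ¬ K ≈ 0#
      K≉0 K≈0 = 1≰0 (≤-trans 1≤K (≤-reflexive K≈0))
      0≤K = ≤-trans 0≤1 1≤K
      i = K ⁻¹
      0≤i = ⁻¹-nonNeg 0≤K K≉0
      -- Coercivity with constant K lowers the bound s² on |A α|² / |α|² by 1 / K, so √ d would be
      -- an upper bound smaller than s.
      d = s * s - i

      s²≰s²-i : ¬ s * s ≤ d
      s²≰s²-i s²≤d = ⁻¹-≉0 K≉0 (antisym (≤-from-gap (0≤y-x s²≤d)
        (solve 2 (λ a i → i :+ (a :- i :- a) := :0) refl (s * s) i)) 0≤i)

      contracts : ∀ α → Balanced α → ⟨ A ∙ α , A ∙ α ⟩ ≤ d * ⟨ α , α ⟩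
      contracts α α⊥𝟙 = 0≤y-x⁻¹ (*-cancelˡ-≤ 0≤K K≉0 (begin
        K * 0#                                        ≈⟨ zeroʳ K ⟩
        0#                                            ≤⟨ 0≤y-x (bound α α⊥𝟙) ⟩
        K * ⟪ q ⟫ α - a                               ≈⟨ +-congʳ (*-congˡ (⟪q⟫ α)) ⟩
        K * (s * s * a - b) - a                       ≈⟨ +-congˡ (-‿cong (*-identityˡ a)) ⟨
        K * (s * s * a - b) - 1# * a                  ≈⟨ +-congˡ (-‿cong (*-congʳ (*-inverseʳ K K≉0))) ⟨
        K * (s * s * a - b) - K * i * a
          ≈⟨ solve 5 (λ k s i a b → k :* (s :* s :* a :- b) :- k :* i :* a := k :* ((s :* s :- i) :* a :- b))
               refl K s i a b ⟩
        K * (d * a - b)                               ∎))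
        where
        a = ⟨ α , α ⟩
        b = ⟨ A ∙ α , A ∙ α ⟩

      -- `√` is 0 on negative arguments, so √ d squares to d only after this check; |A e|² ≤ d |e|²
      -- provides it.
      0≤d : 0# ≤ d
      0≤d = *-cancelˡ-≤ (⟨⟩-nonNeg e) (⟨⟩≉0 e e≉0) (begin
        ⟨ e , e ⟩ * 0#       ≈⟨ zeroʳ _ ⟩
        0#                   ≤⟨ ⟨⟩-nonNeg (A ∙ e) ⟩
        ⟨ A ∙ e , A ∙ e ⟩    ≤⟨ contracts e e⊥𝟙 ⟩
        d * ⟨ e , e ⟩        ≈⟨ *-comm d _ ⟩
        ⟨ e , e ⟩ * d        ∎)

      s≤√d : s ≤ √ d
      s≤√d = s-least λ { {r} (α , α⊥𝟙 , α≉0 , r≈) → begin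
        r                   ≈⟨ r≈ ⟩
        ∥ A ∙ α ∥ / ∥ α ∥   ≤⟨ ratio-≤ (A ∙ α) α α≉0 (root-nonNeg 2 d) (begin
          ⟨ A ∙ α , A ∙ α ⟩     ≤⟨ contracts α α⊥𝟙 ⟩
          d * ⟨ α , α ⟩         ≈⟨ *-congʳ (√-square 0≤d) ⟨
          √ d * √ d * ⟨ α , α ⟩ ∎) ⟩
        √ d                 ∎ }

      s²≤s²-i : s * s ≤ d
      s²≤s²-i = ≤-trans (*-mono-≤ 0≤s s≤√d 0≤s s≤√d) (≤-reflexive (√-square 0≤d))

-- The scalar inequality behind f.

module ZigZagBound (ℝ : CompleteOrderedField) where

  open AttainedNorm ℝ public
  open import Relation.Binary.Reasoning.PartialOrder ≤-poset

  1-x²-nonNeg : ∀ {x} → InUnitInterval x → 0# ≤ 1# - x * x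
  1-x²-nonNeg (0≤x , x≤1) = 0≤y-x (≤-trans (*-mono-≤ 0≤x x≤1 0≤x x≤1) (≤-reflexive (*-identityˡ 1#)))

  -- f is the larger root of t² = (1 − λ₂²) λ₁ t + λ₂².
  module _ {λ₁ λ₂} (λ₁∈ : InUnitInterval λ₁) (λ₂∈ : InUnitInterval λ₂) where
    private
      a R r F : Carrier
      a = 1# - λ₂ ^ 2
      R = a ^ 2 * λ₁ ^ 2 + fromℕ 4 * λ₂ ^ 2
      r = √ R
      F = f λ₁ λ₂

      a≈ : a ≈ 1# - λ₂ * λ₂
      a≈ = +-congˡ (-‿cong (x^2 λ₂))

      0≤a : 0# ≤ a
      0≤a = ≤-trans (1-x²-nonNeg λ₂∈) (≤-reflexive (sym a≈))

      0≤½ : 0# ≤ ½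
      0≤½ = *-nonNeg 0≤1 (⁻¹-nonNeg (fromℕ-nonNeg 2) (fromℕ≉0 2))

      0≤4λ₂² : 0# ≤ fromℕ 4 * λ₂ ^ 2
      0≤4λ₂² = *-nonNeg (fromℕ-nonNeg 4) (^-nonNeg 2 (proj₁ λ₂∈))

      0≤R : 0# ≤ R
      0≤R = +-nonNeg (*-nonNeg (^-nonNeg 2 0≤a) (^-nonNeg 2 (proj₁ λ₁∈))) 0≤4λ₂²

    f-nonNeg : 0# ≤ F
    f-nonNeg = +-nonNeg (*-nonNeg (*-nonNeg 0≤½ 0≤a) (proj₁ λ₁∈)) (*-nonNeg 0≤½ (root-nonNeg 2 R))

    f-quadratic : F * F ≈ (1# - λ₂ * λ₂) * λ₁ * F + λ₂ * λ₂
    f-quadratic = begin-equality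
      F * F
        -- All that is known of ½ is ½ + ½ = 1, so its occurrences are grouped into such sums.
        ≈⟨ solve 4 (λ h a l r → (h :* a :* l :+ h :* r) :* (h :* a :* l :+ h :* r)
             := (h :+ h) :* (a :* l :* (h :* a :* l :+ h :* r)) :+ h :* h :* (r :* r :- a :* a :* (l :* l)))
             refl ½ a λ₁ r ⟩
      (½ + ½) * (a * λ₁ * F) + ½ * ½ * (r * r - a * a * (λ₁ * λ₁))
        ≈⟨ +-congˡ (*-congˡ (+-congʳ (√-square 0≤R))) ⟩
      (½ + ½) * (a * λ₁ * F) + ½ * ½ * (R - a * a * (λ₁ * λ₁))
        ≈⟨ +-congˡ (solve 4 (λ h a l m → h :* h :* (a :^ 2 :* l :^ 2 :+ (:1 :+ (:1 :+ (:1 :+ (:1 :+ :0)))) :* m :^ 2 :- a :* a :* (l :* l))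
             := (h :+ h) :* (h :+ h) :* (m :* m)) refl ½ a λ₁ λ₂) ⟩
      (½ + ½) * (a * λ₁ * F) + (½ + ½) * (½ + ½) * (λ₂ * λ₂)
        ≈⟨ +-cong (*-congʳ ½-double) (*-congʳ (*-cong ½-double ½-double)) ⟩
      1# * (a * λ₁ * F) + 1# * 1# * (λ₂ * λ₂)
        ≈⟨ +-cong (trans (*-identityˡ _) (*-congʳ (*-congʳ a≈))) (trans (*-congʳ (*-identityˡ 1#)) (*-identityˡ _)) ⟩
      (1# - λ₂ * λ₂) * λ₁ * F + λ₂ * λ₂ ∎

    f-larger-root : (1# - λ₂ * λ₂) * λ₁ ≤ F
    f-larger-root = begin
      (1# - λ₂ * λ₂) * λ₁            ≈⟨ *-congʳ a≈ ⟨
      a * λ₁                         ≈⟨ *-identityˡ _ ⟨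
      1# * (a * λ₁)                  ≈⟨ *-congʳ ½-double ⟨
      (½ + ½) * (a * λ₁)             ≈⟨ solve 3 (λ h a l → (h :+ h) :* (a :* l) := h :* a :* l :+ h :* (a :* l)) refl ½ a λ₁ ⟩
      ½ * a * λ₁ + ½ * (a * λ₁)      ≤⟨ +-monoʳ-≤ _ (*-monoʳ-≤ 0≤½ aλ₁≤r) ⟩
      F                              ∎
      where
      aλ₁≤r : a * λ₁ ≤ r
      aλ₁≤r = square-cancel-≤ (root-nonNeg 2 R) (begin
        a * λ₁ * (a * λ₁)  ≤⟨ ≤-from-gap 0≤4λ₂² (+-congʳ (solve 2 (λ a l → a :* l :* (a :* l) := a :^ 2 :* l :^ 2) refl a λ₁)) ⟩
        R                  ≈⟨ √-square 0≤R ⟨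
        r * r              ∎)

    -- For F ≥ 1 and b = 1 - λ₂², the equation gives F² = b λ₁ F + λ₂² ≤ (b λ₁ + λ₂²) F², that is b
    -- (1 - λ₁) F² ≤ 0. The factors are nonnegative, so b or 1 - λ₁ vanishes.
    1≤f⇒λ≈1 : 1# ≤ F → λ₁ ≈ 1# ⊎ λ₂ ≈ 1#
    1≤f⇒λ≈1 1≤F with (1# - λ₂ * λ₂) ≟ 0# | (1# - λ₁) ≟ 0#
    ... | yes 1-λ₂²≈0 | _ = inj₂ (antisym (proj₂ λ₂∈) (square-cancel-≤ (proj₁ λ₂∈) (begin
            1# * 1#                        ≈⟨ solve 1 (λ m → :1 :* :1 := :1 :- m :* m :+ m :* m) refl λ₂ ⟩
            1# - λ₂ * λ₂ + λ₂ * λ₂         ≈⟨ +-congʳ 1-λ₂²≈0 ⟩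
            0# + λ₂ * λ₂                   ≈⟨ +-identityˡ _ ⟩
            λ₂ * λ₂                        ∎)))
    ... | _ | yes 1-λ₁≈0 = inj₁ (begin-equality
            λ₁                 ≈⟨ +-identityˡ λ₁ ⟨
            0# + λ₁            ≈⟨ +-congʳ 1-λ₁≈0 ⟨
            1# - λ₁ + λ₁       ≈⟨ solve 1 (λ l → :1 :- l :+ l := :1) refl λ₁ ⟩
            1#                 ∎)
    ... | no 1-λ₂²≉0 | no 1-λ₁≉0 = contradiction
            (antisym defect≤0 (*-nonNeg (*-nonNeg (1-x²-nonNeg λ₂∈) (0≤y-x (proj₂ λ₁∈))) (x²-nonNeg F)))
            (x*y≉0 (x*y≉0 1-λ₂²≉0 1-λ₁≉0) (x*y≉0 F≉0 F≉0))
      where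
      F≉0 : ¬ F ≈ 0#
      F≉0 F≈0 = 1≰0 (≤-trans 1≤F (≤-reflexive F≈0))
      b = 1# - λ₂ * λ₂
      0≤bλ₁ : 0# ≤ b * λ₁
      0≤bλ₁ = *-nonNeg (1-x²-nonNeg λ₂∈) (proj₁ λ₁∈)
      defect≤0 : b * (1# - λ₁) * (F * F) ≤ 0#
      defect≤0 = begin
        b * (1# - λ₁) * (F * F)
          ≈⟨ solve 3 (λ m l F → (:1 :- m :* m) :* (:1 :- l) :* (F :* F)
               := F :* F :- ((:1 :- m :* m) :* l :* (F :* F) :+ m :* m :* (F :* F))) refl λ₂ λ₁ F ⟩
        F * F - (b * λ₁ * (F * F) + λ₂ * λ₂ * (F * F))
          ≤⟨ ≤-from-gap (+-nonNeg (*-nonNeg 0≤bλ₁ (*-nonNeg f-nonNeg (0≤y-x 1≤F)))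
                           (*-nonNeg (x²-nonNeg λ₂) (*-nonNeg (+-nonNeg f-nonNeg 0≤1) (0≤y-x 1≤F))))
               (solve 4 (λ F b l m → F :* F :- (b :* l :* (F :* F) :+ m :* m :* (F :* F))
                 :+ (b :* l :* (F :* (F :- :1)) :+ m :* m :* ((F :+ :1) :* (F :- :1)))
                 := F :* F :- (b :* l :* F :+ m :* m)) refl F b λ₁ λ₂) ⟩
        F * F - (b * λ₁ * F + λ₂ * λ₂)
          ≈⟨ +-congʳ f-quadratic ⟩
        b * λ₁ * F + λ₂ * λ₂ - (b * λ₁ * F + λ₂ * λ₂)
          ≈⟨ -‿inverseʳ _ ⟩
        0# ∎

  module LargerRoot {l m F : Carrier} (l∈ : InUnitInterval l) (m∈ : InUnitInterval m) (0≤F : 0# ≤ F)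
    (quadratic : F * F ≈ (1# - m * m) * l * F + m * m) (larger : (1# - m * m) * l ≤ F) where

    0≤l = proj₁ l∈
    0≤m = proj₁ m∈
    0≤b = 1-x²-nonNeg m∈

    -- The quadratic equation rearranges to (F + m² l) (F - l) = m² (1 - l²) ≥ 0. If the first
    -- factor vanishes, `larger` gives l ≤ F + m² l = 0.
    l≤F : l ≤ F
    l≤F with F + m * m * l ≟ 0#
    ... | yes F+m²l≈0 = begin
      l                     ≈⟨ solve 2 (λ m l → l := (:1 :- m :* m) :* l :+ m :* m :* l) refl m l ⟩
      (1# - m * m) * l + m * m * l ≤⟨ +-monoˡ-≤ (m * m * l) larger ⟩
      F + m * m * l         ≈⟨ F+m²l≈0 ⟩
      0#                    ≤⟨ 0≤F ⟩
      F                     ∎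
    ... | no F+m²l≉0 = 0≤y-x⁻¹ (*-cancelˡ-≤ (+-nonNeg 0≤F (*-nonNeg (x²-nonNeg m) 0≤l)) F+m²l≉0 (begin
      (F + m * m * l) * 0#        ≈⟨ zeroʳ _ ⟩
      0#                          ≤⟨ *-nonNeg (x²-nonNeg m) (1-x²-nonNeg l∈) ⟩
      m * m * (1# - l * l)
        ≈⟨ solve 3 (λ m l F → m :* m :* (:1 :- l :* l)
             := (:1 :- m :* m) :* l :* F :+ m :* m :- (:1 :- m :* m) :* l :* F :- m :* m :* (l :* l)) refl m l F ⟩
      (1# - m * m) * l * F + m * m - (1# - m * m) * l * F - m * m * (l * l)
        ≈⟨ +-congʳ (+-congʳ quadratic) ⟨
      F * F - (1# - m * m) * l * F - m * m * (l * l)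
        ≈⟨ solve 3 (λ m l F → F :* F :- (:1 :- m :* m) :* l :* F :- m :* m :* (l :* l)
             := (F :+ m :* m :* l) :* (F :- l)) refl m l F ⟩
      (F + m * m * l) * (F - l) ∎))

    -- The equation contains m² ≤ F², hence m ≤ F, and m² ≤ m on the unit interval.
    m²≤F : m * m ≤ F
    m²≤F = begin
      m * m   ≤⟨ *-monoʳ-≤ 0≤m (proj₂ m∈) ⟩
      m * 1#  ≈⟨ *-identityʳ m ⟩
      m       ≤⟨ square-cancel-≤ 0≤F (≤-trans (≤-from-gap (*-nonNeg (*-nonNeg 0≤b 0≤l) 0≤F) (+-comm _ _))
                                              (≤-reflexive (sym quadratic))) ⟩
      F       ∎

    -- Read U = |u|², α = ⟨Au,u⟩, W = |w|², β = ⟨Aw,w⟩, s = ⟨Au,w⟩ for u ⊥ w and a symmetric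
    -- contraction A: the two bounds on s² are the Cauchy–Schwarz inequalities of I ∓ A.
    module _ {U X W α β s} (0≤U : 0# ≤ U) (0≤X : 0# ≤ X) (α≤lU : α ≤ l * U) (W≤m²X : W ≤ m * m * X)
      (α≤U : 0# ≤ U - α) (-α≤U : 0# ≤ U + α) (β≤W : 0# ≤ W - β) (-β≤W : 0# ≤ W + β)
      (s²≤₁ : s * s ≤ (U - α) * (W - β)) (s²≤₂ : s * s ≤ (U + α) * (W + β)) where

      private
        y₁ y₂ D : Carrier
        y₁ = F * U - α
        y₂ = F * X - β
        D = m * m * ((U - α) * (U + α))

        0≤y₁ : 0# ≤ y₁
        0≤y₁ = 0≤y-x (≤-trans α≤lU (*-monoˡ-≤ 0≤U l≤F))

        0≤y₂ : 0# ≤ y₂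
        0≤y₂ = 0≤y-x (≤-trans (0≤y-x⁻¹ β≤W) (≤-trans W≤m²X (*-monoˡ-≤ 0≤X m²≤F)))

        s²≤0⇒ : s * s ≤ 0# → s * s ≤ y₁ * y₂
        s²≤0⇒ s²≤0 = ≤-trans s²≤0 (*-nonNeg 0≤y₁ 0≤y₂)

        -- The quadratic equation enters here: the gap is (1 - m²) F U (l U - α). Equality at α = l
        -- U is the equation itself, times U².
        D≤ : D ≤ y₁ * (F * U + m * m * α)
        D≤ = ≤-from-gap (*-nonNeg (*-nonNeg (*-nonNeg 0≤b 0≤F) 0≤U) (0≤y-x α≤lU)) (begin-equality
          D + (1# - m * m) * F * U * (l * U - α)
            ≈⟨ solve 5 (λ m F U l α → m :* m :* ((U :- α) :* (U :+ α)) :+ (:1 :- m :* m) :* F :* U :* (l :* U :- α)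
                 := ((:1 :- m :* m) :* l :* F :+ m :* m) :* (U :* U) :- (:1 :- m :* m) :* F :* U :* α :- m :* m :* (α :* α))
                 refl m F U l α ⟩
          ((1# - m * m) * l * F + m * m) * (U * U) - (1# - m * m) * F * U * α - m * m * (α * α)
            ≈⟨ +-congʳ (+-congʳ (*-congʳ quadratic)) ⟨
          F * F * (U * U) - (1# - m * m) * F * U * α - m * m * (α * α)
            ≈⟨ solve 4 (λ m F U α → F :* F :* (U :* U) :- (:1 :- m :* m) :* F :* U :* α :- m :* m :* (α :* α)
                 := (F :* U :- α) :* (F :* U :+ m :* m :* α)) refl m F U α ⟩
          y₁ * (F * U + m * m * α) ∎)

        -- The two Cauchy-Schwarz bounds are averaged with weights (F + m²) (U + α) and (F - m²) (U
        -- - α). Then U² - α² factors out, leaving 2 F W - 2 m² β, which W ≤ m² X bounds by 2 m² y₂.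
        s²D≤ : s * s * (F * U + m * m * α) ≤ D * y₂
        s²D≤ = double-cancel-≤ (begin
          s * s * (F * U + m * m * α) + s * s * (F * U + m * m * α)
            ≈⟨ solve 5 (λ s F m U α → s :* s :* (F :* U :+ m :* m :* α) :+ s :* s :* (F :* U :+ m :* m :* α)
                 := (F :+ m :* m) :* (U :+ α) :* (s :* s) :+ (F :- m :* m) :* (U :- α) :* (s :* s)) refl s F m U α ⟩
          (F + m * m) * (U + α) * (s * s) + (F - m * m) * (U - α) * (s * s)
            ≤⟨ +-mono-≤ (*-monoʳ-≤ (*-nonNeg (+-nonNeg 0≤F (x²-nonNeg m)) -α≤U) s²≤₁)
                        (*-monoʳ-≤ (*-nonNeg (0≤y-x m²≤F) α≤U) s²≤₂) ⟩
          (F + m * m) * (U + α) * ((U - α) * (W - β)) + (F - m * m) * (U - α) * ((U + α) * (W + β))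
            ≤⟨ ≤-from-gap (*-nonNeg (*-nonNeg (+-nonNeg 0≤F 0≤F) (*-nonNeg α≤U -α≤U)) (0≤y-x W≤m²X))
                 (solve 7 (λ F m U α W β X →
                   (F :+ m :* m) :* (U :+ α) :* ((U :- α) :* (W :- β)) :+ (F :- m :* m) :* (U :- α) :* ((U :+ α) :* (W :+ β))
                   :+ (F :+ F) :* ((U :- α) :* (U :+ α)) :* (m :* m :* X :- W)
                   := m :* m :* ((U :- α) :* (U :+ α)) :* (F :* X :- β) :+ m :* m :* ((U :- α) :* (U :+ α)) :* (F :* X :- β))
                   refl F m U α W β X) ⟩
          D * y₂ + D * y₂ ∎)

        -- `D≤` and `s²D≤` share the factor F U + m² α; combining them leaves D to cancel. If a
        -- factor of D vanishes, one of the two bounds on s² is already at most 0.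
        s²≤y₁y₂ : s * s ≤ y₁ * y₂
        s²≤y₁y₂ with (U - α) ≟ 0# | (U + α) ≟ 0# | m ≟ 0#
        ... | yes A≈0 | _ | _ = s²≤0⇒ (≤-trans s²≤₁ (≤-reflexive (trans (*-congʳ A≈0) (zeroˡ _))))
        ... | _ | yes A≈0 | _ = s²≤0⇒ (≤-trans s²≤₂ (≤-reflexive (trans (*-congʳ A≈0) (zeroˡ _))))
        ... | _ | _ | yes m≈0 = s²≤0⇒ (begin
          s * s               ≤⟨ s²≤₁ ⟩
          (U - α) * (W - β)   ≤⟨ *-monoʳ-≤ α≤U W-β≤0 ⟩
          (U - α) * 0#        ≈⟨ zeroʳ _ ⟩
          0#                  ∎)
          where
          W≤0 : W ≤ 0#
          W≤0 = begin
            W                 ≤⟨ W≤m²X ⟩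
            m * m * X         ≈⟨ *-congʳ (*-congʳ m≈0) ⟩
            0# * m * X        ≈⟨ solve 2 (λ m x → :0 :* m :* x := :0) refl m X ⟩
            0#                ∎
          W-β≤0 : W - β ≤ 0#
          W-β≤0 = begin
            W - β   ≤⟨ ≤-from-gap -β≤W (solve 2 (λ w b → w :- b :+ (w :+ b) := w :+ w) refl W β) ⟩
            W + W   ≤⟨ +-mono-≤ W≤0 W≤0 ⟩
            0# + 0# ≈⟨ +-identityˡ 0# ⟩
            0#      ∎
        ... | no A₁≉0 | no A₂≉0 | no m≉0 = *-cancelˡ-≤ 0≤D D≉0 (begin
          D * (s * s)                              ≈⟨ *-comm D _ ⟩
          s * s * D                                ≤⟨ *-monoʳ-≤ (x²-nonNeg s) D≤ ⟩
          s * s * (y₁ * (F * U + m * m * α))       ≈⟨ solve 3 (λ s y z → s :* s :* (y :* z) := y :* (s :* s :* z)) refl s y₁ _ ⟩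
          y₁ * (s * s * (F * U + m * m * α))       ≤⟨ *-monoʳ-≤ 0≤y₁ s²D≤ ⟩
          y₁ * (D * y₂)                            ≈⟨ solve 3 (λ y d z → y :* (d :* z) := d :* (y :* z)) refl y₁ D y₂ ⟩
          D * (y₁ * y₂)                            ∎)
          where
          0≤D : 0# ≤ D
          0≤D = *-nonNeg (x²-nonNeg m) (*-nonNeg α≤U -α≤U)
          D≉0 : ¬ D ≈ 0#
          D≉0 = x*y≉0 (x*y≉0 m≉0 m≉0) (x*y≉0 A₁≉0 A₂≉0)

      -- The symmetric matrix with diagonal y₁ , y₂ and off-diagonal entry -s has nonnegative
      -- determinant, so (2 s)² ≤ 4 y₁ y₂ ≤ (y₁ + y₂)².
      zigzag-scalar : α + (s + s) + β ≤ F * (U + X)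
      zigzag-scalar = begin
        α + (s + s) + β    ≤⟨ +-monoˡ-≤ β (+-monoʳ-≤ α 2s≤) ⟩
        α + (y₁ + y₂) + β  ≈⟨ solve 5 (λ a b F U X → a :+ (F :* U :- a :+ (F :* X :- b)) :+ b := F :* (U :+ X)) refl α β F U X ⟩
        F * (U + X)        ∎
        where
        2s≤ : s + s ≤ y₁ + y₂
        2s≤ = square-cancel-≤ (+-nonNeg 0≤y₁ 0≤y₂) (begin
          (s + s) * (s + s)                              ≈⟨ solve 1 (λ s → (s :+ s) :* (s :+ s) := (s :* s :+ s :* s) :+ (s :* s :+ s :* s)) refl s ⟩
          s * s + s * s + (s * s + s * s)                ≤⟨ +-mono-≤ (+-mono-≤ s²≤y₁y₂ s²≤y₁y₂) (+-mono-≤ s²≤y₁y₂ s²≤y₁y₂) ⟩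
          y₁ * y₂ + y₁ * y₂ + (y₁ * y₂ + y₁ * y₂)        ≤⟨ ≤-from-gap (x²-nonNeg (y₁ - y₂))
              (solve 2 (λ y z → y :* z :+ y :* z :+ (y :* z :+ y :* z) :+ (y :- z) :* (y :- z) := (y :+ z) :* (y :+ z)) refl y₁ y₂) ⟩
          (y₁ + y₂) * (y₁ + y₂)                          ∎)

-- The form of the cube, and norms recovered from forms.

module Operators (ℝ : CompleteOrderedField) where

  open ZigZagBound ℝ public
  open import Relation.Binary.Reasoning.PartialOrder ≤-poset

  sign-neg : ∀ {σ} → Sign σ → Sign (- σ)
  sign-neg {σ} σ²≈1 = trans (solve 1 (λ s → (:- s) :* (:- s) := s :* s) refl σ) σ²≈1

  -- The triangle inequality in squared form: `signed-am-gm` bounds the cross terms, and the weights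
  -- add up to (a + b)².
  combination-contraction : ∀ {N} {a b} {S T : Vector N → Vector N} → 0# ≤ a → 0# ≤ b → a + b ≈ 1# →
    Contraction S → Contraction T → Contraction (combination a S b T)
  combination-contraction {a = a} {b} {S} {T} 0≤a 0≤b a+b≈1 S-contr T-contr α = begin
    ⟨ a • S α ⊕ b • T α , a • S α ⊕ b • T α ⟩
      ≈⟨ form-expand id-symmetric a b (S α) (T α) ⟩
    a * a * ⟨ S α , S α ⟩ + (a * b * ⟨ S α , T α ⟩ + a * b * ⟨ S α , T α ⟩) + b * b * ⟨ T α , T α ⟩
      ≤⟨ +-mono-≤ (+-mono-≤ (*-monoʳ-≤ (x²-nonNeg a) (S-contr α)) cross) (*-monoʳ-≤ (x²-nonNeg b) (T-contr α)) ⟩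
    a * a * ⟨ α , α ⟩ + a * b * (⟨ α , α ⟩ + ⟨ α , α ⟩) + b * b * ⟨ α , α ⟩
      ≈⟨ solve 3 (λ a b x → a :* a :* x :+ a :* b :* (x :+ x) :+ b :* b :* x := (a :+ b) :* (a :+ b) :* x) refl a b ⟨ α , α ⟩ ⟩
    (a + b) * (a + b) * ⟨ α , α ⟩
      ≈⟨ trans (*-congʳ (trans (*-cong a+b≈1 a+b≈1) (*-identityˡ 1#))) (*-identityˡ _) ⟩
    ⟨ α , α ⟩ ∎
    where
    c = ⟨ S α , T α ⟩
    cross : a * b * c + a * b * c ≤ a * b * (⟨ α , α ⟩ + ⟨ α , α ⟩)
    cross = begin
      a * b * c + a * b * c            ≈⟨ solve 3 (λ a b c → a :* b :* c :+ a :* b :* c := a :* b :* (:1 :* c :+ :1 :* c)) refl a b c ⟩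
      a * b * (1# * c + 1# * c)        ≤⟨ *-monoʳ-≤ (*-nonNeg 0≤a 0≤b) (≤-trans (signed-am-gm sign-1 (S α) (T α)) (+-mono-≤ (S-contr α) (T-contr α))) ⟩
      a * b * (⟨ α , α ⟩ + ⟨ α , α ⟩)  ∎

  module _ {N} {A : Vector N → Vector N} (A-sym : Symmetric A) (A-contr : Contraction A) where

    orthogonal-cauchy-schwarz : ∀ {τ} → Sign τ → ∀ u w → ⟨ u , w ⟩ ≈ 0# →
      τ * ⟨ A u , w ⟩ * (τ * ⟨ A u , w ⟩) ≤ (⟨ u , u ⟩ + τ * ⟨ A u , u ⟩) * (⟨ w , w ⟩ + τ * ⟨ A w , w ⟩)
    orthogonal-cauchy-schwarz {τ} τ²≈1 u w u⊥w = begin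
      τ * ⟨ A u , w ⟩ * (τ * ⟨ A u , w ⟩)  ≈⟨ *-cong off-diagonal off-diagonal ⟨
      ⟨ I+τA u , w ⟩ * ⟨ I+τA u , w ⟩      ≤⟨ cauchy-schwarz-form I+τA-sym psd u w ⟩
      ⟨ I+τA u , u ⟩ * ⟨ I+τA w , w ⟩      ≈⟨ *-cong (entry u u) (entry w w) ⟩
      (⟨ u , u ⟩ + τ * ⟨ A u , u ⟩) * (⟨ w , w ⟩ + τ * ⟨ A w , w ⟩) ∎
      where
      I+τA = combination 1# (λ α → α) τ A
      I+τA-sym = combination-symmetric 1# τ id-symmetric A-sym
      entry : ∀ α β → ⟨ I+τA α , β ⟩ ≈ ⟨ α , β ⟩ + τ * ⟨ A α , β ⟩
      entry α β = trans (⟨⟩-linearˡ 1# τ α (A α) β) (+-congʳ (*-identityˡ _))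
      off-diagonal : ⟨ I+τA u , w ⟩ ≈ τ * ⟨ A u , w ⟩
      off-diagonal = trans (entry u w) (trans (+-congʳ u⊥w) (+-identityˡ _))
      psd : ∀ α → 0# ≤ ⟨ I+τA α , α ⟩
      psd α = begin
        0#                                   ≤⟨ 0≤y-x (contraction-form A-contr (sign-neg τ²≈1) α) ⟩
        ⟨ α , α ⟩ - - τ * ⟨ A α , α ⟩        ≈⟨ solve 3 (λ x t a → x :- (:- t) :* a := x :+ t :* a) refl ⟨ α , α ⟩ τ ⟨ A α , α ⟩ ⟩
        ⟨ α , α ⟩ + τ * ⟨ A α , α ⟩          ≈⟨ entry α α ⟨
        ⟨ I+τA α , α ⟩                       ∎

  -- A is the operator of G₁, B that of the copies of G₂ and P the averaging over each copy.
  record ZigZag {N} (A B P : Vector N → Vector N) (l m : Carrier) : Set where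
    field
      A-sym        : Symmetric A
      A-contr      : Contraction A
      A-involutive : ∀ α → A (A α) ≋ α
      B-sym        : Symmetric B
      B-contr      : Contraction B
      P-sym        : Symmetric P
      P-idem       : ∀ α → P (P α) ≋ P α
      BP           : ∀ α → B (P α) ≋ P α
      A-on-P       : ∀ {σ} → Sign σ → ∀ α → Balanced α → σ * ⟨ A (P α) , P α ⟩ ≤ l * ⟨ P α , P α ⟩
      B-on-P⊥      : ∀ α → let γ = 1# • α ⊕ (- 1#) • P α in ⟨ B γ , B γ ⟩ ≤ m * m * ⟨ γ , γ ⟩

  module ZigZagProperties {N} {A B P : Vector N → Vector N} {l m F} (zz : ZigZag A B P l m)
    (l∈ : InUnitInterval l) (m∈ : InUnitInterval m) (0≤F : 0# ≤ F)
    (quadratic : F * F ≈ (1# - m * m) * l * F + m * m) (larger : (1# - m * m) * l ≤ F) where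

    open ZigZag zz
    private
      module A = Symmetric A-sym
      module B = Symmetric B-sym
      module P = Symmetric P-sym

    zigzag-form : ∀ {σ} → Sign σ → ∀ α → Balanced α → σ * ⟨ A (B α) , B α ⟩ ≤ F * ⟨ α , α ⟩
    zigzag-form {σ} σ²≈1 α α⊥𝟙 = begin
      σ * ⟨ A (B α) , B α ⟩      ≈⟨ *-congˡ (⟨⟩-cong (A.T-cong Bα≋) Bα≋) ⟩
      σ * ⟨ A (1# • u ⊕ 1# • w) , 1# • u ⊕ 1# • w ⟩  ≈⟨ *-congˡ (form-expand A-sym 1# 1# u w) ⟩
      σ * (1# * 1# * Au + (1# * 1# * As + 1# * 1# * As) + 1# * 1# * Aw)
        ≈⟨ solve 4 (λ σ a s b → σ :* (:1 :* :1 :* a :+ (:1 :* :1 :* s :+ :1 :* :1 :* s) :+ :1 :* :1 :* b)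
             := σ :* a :+ (σ :* s :+ σ :* s) :+ σ :* b) refl σ Au As Aw ⟩
      σ * Au + (σ * As + σ * As) + σ * Aw
        -- The sign is absorbed into the entries σ ⟨Au,u⟩, σ ⟨Au,w⟩ and σ ⟨Aw,w⟩, so one scalar
        -- inequality serves both signs; X is |v|² and W is |B v|².
        ≤⟨ zigzag-scalar (⟨⟩-nonNeg u) (⟨⟩-nonNeg v) (A-on-P σ²≈1 α α⊥𝟙) (B-on-P⊥ α)
             (0≤y-x (contraction-form A-contr σ²≈1 u)) (bound⁻ u)
             (0≤y-x (contraction-form A-contr σ²≈1 w)) (bound⁻ w) cs⁻ (orthogonal-cauchy-schwarz A-sym A-contr σ²≈1 u w u⊥w) ⟩
      F * (⟨ u , u ⟩ + ⟨ v , v ⟩)  ≈⟨ *-congˡ pythagoras ⟨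
      F * ⟨ α , α ⟩                ∎
      where
      open LargerRoot l∈ m∈ 0≤F quadratic larger
      u v w : Vector N
      u = P α
      v = 1# • α ⊕ (- 1#) • P α
      w = B v
      Au = ⟨ A u , u ⟩
      As = ⟨ A u , w ⟩
      Aw = ⟨ A w , w ⟩

      α≋ : α ≋ 1# • u ⊕ 1# • v
      α≋ x = solve 2 (λ a p → a := :1 :* p :+ :1 :* (:1 :* a :+ (:- :1) :* p)) refl (α x) (u x)

      Bα≋ : B α ≋ 1# • u ⊕ 1# • w
      Bα≋ x = trans (B.T-cong α≋ x) (trans (B.linear 1# 1# u v x) (+-congʳ (*-congˡ (BP α x))))

      u⊥v : ⟨ u , v ⟩ ≈ 0#
      u⊥v = begin-equality
        ⟨ u , v ⟩                             ≈⟨ ⟨⟩-linearʳ 1# (- 1#) α u u ⟩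
        1# * ⟨ u , α ⟩ + - 1# * ⟨ P α , u ⟩   ≈⟨ +-congˡ (*-congˡ (trans (P.symmetric α (P α)) (trans (⟨⟩-comm α (P (P α))) (⟨⟩-cong (P-idem α) (λ _ → refl))))) ⟩
        1# * ⟨ u , α ⟩ + - 1# * ⟨ u , α ⟩     ≈⟨ solve 1 (λ a → :1 :* a :+ (:- :1) :* a := :0) refl ⟨ u , α ⟩ ⟩
        0#                                    ∎

      u⊥w : ⟨ u , w ⟩ ≈ 0#
      u⊥w = begin-equality
        ⟨ u , B v ⟩   ≈⟨ B.symmetric u v ⟨
        ⟨ B u , v ⟩   ≈⟨ ⟨⟩-cong (BP α) (λ _ → refl) ⟩
        ⟨ u , v ⟩     ≈⟨ u⊥v ⟩
        0#            ∎

      pythagoras : ⟨ α , α ⟩ ≈ ⟨ u , u ⟩ + ⟨ v , v ⟩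
      pythagoras = begin-equality
        ⟨ α , α ⟩   ≈⟨ ⟨⟩-cong α≋ α≋ ⟩
        ⟨ 1# • u ⊕ 1# • v , 1# • u ⊕ 1# • v ⟩ ≈⟨ form-expand id-symmetric 1# 1# u v ⟩
        1# * 1# * ⟨ u , u ⟩ + (1# * 1# * ⟨ u , v ⟩ + 1# * 1# * ⟨ u , v ⟩) + 1# * 1# * ⟨ v , v ⟩
          ≈⟨ +-congʳ (+-congˡ (+-cong (*-congˡ u⊥v) (*-congˡ u⊥v))) ⟩
        1# * 1# * ⟨ u , u ⟩ + (1# * 1# * 0# + 1# * 1# * 0#) + 1# * 1# * ⟨ v , v ⟩
          ≈⟨ solve 2 (λ a b → :1 :* :1 :* a :+ (:1 :* :1 :* :0 :+ :1 :* :1 :* :0) :+ :1 :* :1 :* b := a :+ b) refl ⟨ u , u ⟩ ⟨ v , v ⟩ ⟩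
        ⟨ u , u ⟩ + ⟨ v , v ⟩ ∎

      bound⁻ : ∀ γ → 0# ≤ ⟨ γ , γ ⟩ + σ * ⟨ A γ , γ ⟩
      bound⁻ γ = ≤-trans (0≤y-x (contraction-form A-contr (sign-neg σ²≈1) γ))
        (≤-reflexive (solve 3 (λ x t a → x :- (:- t) :* a := x :+ t :* a) refl ⟨ γ , γ ⟩ σ ⟨ A γ , γ ⟩))

      cs⁻ : σ * As * (σ * As) ≤ (⟨ u , u ⟩ - σ * Au) * (⟨ w , w ⟩ - σ * Aw)
      cs⁻ = begin
        σ * As * (σ * As)           ≈⟨ solve 2 (λ t a → t :* a :* (t :* a) := (:- t) :* a :* ((:- t) :* a)) refl σ As ⟩
        - σ * As * (- σ * As)       ≤⟨ orthogonal-cauchy-schwarz A-sym A-contr (sign-neg σ²≈1) u w u⊥w ⟩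
        (⟨ u , u ⟩ + - σ * Au) * (⟨ w , w ⟩ + - σ * Aw)
          ≈⟨ solve 5 (λ t u a w b → (u :+ (:- t) :* a) :* (w :+ (:- t) :* b) := (u :- t :* a) :* (w :- t :* b)) refl σ ⟨ u , u ⟩ Au ⟨ w , w ⟩ Aw ⟩
        (⟨ u , u ⟩ - σ * Au) * (⟨ w , w ⟩ - σ * Aw) ∎

    -- Of the eight terms of (a A + b B)³ only a b² B A B is not just bounded by contractivity.
    module _ {a b} (0≤a : 0# ≤ a) (0≤b : 0# ≤ b) (a+b≈1 : a + b ≈ 1#) where

      private
        M : Vector N → Vector N
        M = combination a A b B

      cube-form : ∀ {σ} → Sign σ → ∀ α → Balanced α →
        σ * ⟨ M (M (M α)) , α ⟩ ≤ (1# - a * b * b + a * b * b * F) * ⟨ α , α ⟩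
      cube-form {σ} σ²≈1 α α⊥𝟙 = begin
        σ * ⟨ M (M (M α)) , α ⟩        ≈⟨ *-congˡ (Symmetric.symmetric (combination-symmetric a b A-sym B-sym) (M (M α)) α) ⟩
        σ * ⟨ M y , y ⟩                ≈⟨ *-congˡ (⟨⟩-linearˡ a b (A y) (B y) y) ⟩
        σ * (a * ⟨ A y , y ⟩ + b * ⟨ B y , y ⟩)
          -- With y = M α, only ⟨A y , y⟩ has to be expanded to expose B A B; ⟨B y , y⟩ is bounded
          -- as a whole. Afterwards A A = I shortens the other terms.
          ≈⟨ *-congˡ (+-congʳ (*-congˡ (form-expand A-sym a b (A α) (B α)))) ⟩
        σ * (a * (a * a * ⟨ A (A α) , A α ⟩ + (a * b * ⟨ A (A α) , B α ⟩ + a * b * ⟨ A (A α) , B α ⟩) + b * b * Z) + b * ⟨ B y , y ⟩)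
          ≈⟨ *-congˡ (+-congʳ (*-congˡ (+-congʳ (+-cong (*-congˡ AA) (+-cong (*-congˡ AB) (*-congˡ AB)))))) ⟩
        σ * (a * (a * a * p₁ + (a * b * p₂ + a * b * p₂) + b * b * Z) + b * p₃)
          ≈⟨ solve 7 (λ σ a b p q z r → σ :* (a :* (a :* a :* p :+ (a :* b :* q :+ a :* b :* q) :+ b :* b :* z) :+ b :* r)
               := a :* a :* a :* (σ :* p) :+ (a :* a :* b :+ a :* a :* b) :* (σ :* q) :+ a :* b :* b :* (σ :* z) :+ b :* (σ :* r)) refl σ a b p₁ p₂ Z p₃ ⟩
        a * a * a * (σ * p₁) + (a * a * b + a * a * b) * (σ * p₂) + a * b * b * (σ * Z) + b * (σ * p₃)
          ≤⟨ +-mono-≤ (+-mono-≤ (+-mono-≤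
               (*-monoʳ-≤ (*-nonNeg (*-nonNeg 0≤a 0≤a) 0≤a) (contraction-form A-contr σ²≈1 α))
               (*-monoʳ-≤ (+-nonNeg 0≤aab 0≤aab) (contraction-form B-contr σ²≈1 α)))
               (*-monoʳ-≤ (*-nonNeg (*-nonNeg 0≤a 0≤b) 0≤b) (zigzag-form σ²≈1 α α⊥𝟙)))
               (*-monoʳ-≤ 0≤b (≤-trans (contraction-form B-contr σ²≈1 y) (combination-contraction 0≤a 0≤b a+b≈1 A-contr B-contr α))) ⟩
        a * a * a * X + (a * a * b + a * a * b) * X + a * b * b * (F * X) + b * X
          -- The weights of the other terms are a³ + 2 a² b + b = a (a + b)² + b - a b², which is 1
          -- - a b².
          ≈⟨ solve 4 (λ a b F x → a :* a :* a :* x :+ (a :* a :* b :+ a :* a :* b) :* x :+ a :* b :* b :* (F :* x) :+ b :* x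
               := (a :* ((a :+ b) :* (a :+ b)) :+ b :- a :* b :* b :+ a :* b :* b :* F) :* x) refl a b F X ⟩
        (a * ((a + b) * (a + b)) + b - a * b * b + a * b * b * F) * X
          ≈⟨ *-congʳ (+-congʳ (+-congʳ (trans (+-congʳ (trans (*-congˡ (trans (*-cong a+b≈1 a+b≈1) (*-identityˡ 1#))) (*-identityʳ a))) a+b≈1))) ⟩
        (1# - a * b * b + a * b * b * F) * X ∎
        where
        y = M α
        X = ⟨ α , α ⟩
        p₁ = ⟨ A α , α ⟩
        p₂ = ⟨ B α , α ⟩
        p₃ = ⟨ B y , y ⟩
        Z = ⟨ A (B α) , B α ⟩
        0≤aab = *-nonNeg (*-nonNeg 0≤a 0≤a) 0≤b
        AA : ⟨ A (A α) , A α ⟩ ≈ p₁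
        AA = trans (A.symmetric (A α) (A α)) (⟨⟩-cong {α = A α} (λ _ → refl) (A-involutive α))
        AB : ⟨ A (A α) , B α ⟩ ≈ p₂
        AB = trans (⟨⟩-cong (A-involutive α) (λ _ → refl)) (⟨⟩-comm α (B α))

  module _ {N} {T : Vector N → Vector N} (T-sym : Symmetric T)
    (T-balanced : ∀ α → Balanced α → Balanced (T α)) where
    open Symmetric T-sym

    -- Polarisation: 4 ⟨Tα,β⟩ = ⟨T(α+β),α+β⟩ − ⟨T(α−β),α−β⟩.
    bilinear-from-form : ∀ {c} → (∀ {σ} → Sign σ → ∀ α → Balanced α → σ * ⟨ T α , α ⟩ ≤ c * ⟨ α , α ⟩) →
      ∀ α β → Balanced α → Balanced β → ⟨ T α , β ⟩ + ⟨ T α , β ⟩ ≤ c * (⟨ α , α ⟩ + ⟨ β , β ⟩)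
    bilinear-from-form {c} form α β α⊥𝟙 β⊥𝟙 = double-cancel-≤ (begin
      t + t + (t + t)
        ≈⟨ solve 3 (λ t p q → t :+ t :+ (t :+ t)
             := :1 :* (:1 :* :1 :* p :+ (:1 :* :1 :* t :+ :1 :* :1 :* t) :+ :1 :* :1 :* q)
             :+ (:- :1) :* (:1 :* :1 :* p :+ (:1 :* (:- :1) :* t :+ :1 :* (:- :1) :* t) :+ (:- :1) :* (:- :1) :* q))
             refl t Tαα Tββ ⟩
      1# * (1# * 1# * Tαα + (1# * 1# * t + 1# * 1# * t) + 1# * 1# * Tββ) +
      - 1# * (1# * 1# * Tαα + (1# * - 1# * t + 1# * - 1# * t) + - 1# * - 1# * Tββ)
        ≈⟨ +-cong (*-congˡ (form-expand T-sym 1# 1# α β)) (*-congˡ (form-expand T-sym 1# (- 1#) α β)) ⟨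
      1# * ⟨ T γ₊ , γ₊ ⟩ + - 1# * ⟨ T γ₋ , γ₋ ⟩
        ≤⟨ +-mono-≤ (form sign-1 γ₊ (balanced 1#)) (form sign--1 γ₋ (balanced (- 1#))) ⟩
      c * ⟨ γ₊ , γ₊ ⟩ + c * ⟨ γ₋ , γ₋ ⟩
        ≈⟨ +-cong (*-congˡ (form-expand id-symmetric 1# 1# α β)) (*-congˡ (form-expand id-symmetric 1# (- 1#) α β)) ⟩
      c * (1# * 1# * αα + (1# * 1# * αβ + 1# * 1# * αβ) + 1# * 1# * ββ) +
      c * (1# * 1# * αα + (1# * - 1# * αβ + 1# * - 1# * αβ) + - 1# * - 1# * ββ)
        ≈⟨ solve 4 (λ c p t q →
             c :* (:1 :* :1 :* p :+ (:1 :* :1 :* t :+ :1 :* :1 :* t) :+ :1 :* :1 :* q)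
             :+ c :* (:1 :* :1 :* p :+ (:1 :* (:- :1) :* t :+ :1 :* (:- :1) :* t) :+ (:- :1) :* (:- :1) :* q)
             := c :* (p :+ q) :+ c :* (p :+ q))
             refl c αα αβ ββ ⟩
      c * (αα + ββ) + c * (αα + ββ) ∎)
      where
      Tαα = ⟨ T α , α ⟩
      Tββ = ⟨ T β , β ⟩
      αα = ⟨ α , α ⟩
      ββ = ⟨ β , β ⟩
      αβ = ⟨ α , β ⟩
      t = ⟨ T α , β ⟩
      γ₊ = 1# • α ⊕ 1# • β
      γ₋ = 1# • α ⊕ (- 1#) • β
      balanced : ∀ s → Balanced (1# • α ⊕ s • β)
      balanced s = begin-equality
        ⟨ 1# • α ⊕ s • β , 𝟙 ⟩        ≈⟨ ⟨⟩-linearˡ 1# s α β 𝟙 ⟩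
        1# * ⟨ α , 𝟙 ⟩ + s * ⟨ β , 𝟙 ⟩ ≈⟨ +-cong (*-congˡ α⊥𝟙) (*-congˡ β⊥𝟙) ⟩
        1# * 0# + s * 0#              ≈⟨ solve 1 (λ s → :1 :* :0 :+ s :* :0 := :0) refl s ⟩
        0#                            ∎

    -- The bilinear bound at (c α , T α).
    norm-from-form : ∀ {c} → 0# ≤ c → (∀ {σ} → Sign σ → ∀ α → Balanced α → σ * ⟨ T α , α ⟩ ≤ c * ⟨ α , α ⟩) →
      ∀ α → Balanced α → ⟨ T α , T α ⟩ ≤ c * c * ⟨ α , α ⟩
    norm-from-form {c} 0≤c form α α⊥𝟙 with c ≟ 0#
    -- Here c cannot be cancelled, but the bilinear bound at (α , T α) already has a zero right-hand
    -- side.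
    ... | yes c≈0 = double-cancel-≤ (begin
      ⟨ T α , T α ⟩ + ⟨ T α , T α ⟩      ≤⟨ bilinear-from-form form α (T α) α⊥𝟙 (T-balanced α α⊥𝟙) ⟩
      c * (⟨ α , α ⟩ + ⟨ T α , T α ⟩)    ≈⟨ trans (*-congʳ c≈0) (zeroˡ _) ⟩
      0#                                 ≤⟨ +-nonNeg 0≤ccX 0≤ccX ⟩
      c * c * ⟨ α , α ⟩ + c * c * ⟨ α , α ⟩ ∎)
      where 0≤ccX = *-nonNeg (x²-nonNeg c) (⟨⟩-nonNeg α)
    ... | no c≉0 = *-cancelˡ-≤ 0≤c c≉0 (begin
      c * Y                  ≈⟨ solve 2 (λ c y → c :* y := c :* y :+ c :* y :- c :* y) refl c Y ⟩
      c * Y + c * Y - c * Y  ≤⟨ +-monoˡ-≤ (- (c * Y)) doubled ⟩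
      c * (c * c * X + Y) - c * Y ≈⟨ solve 3 (λ c x y → c :* (c :* c :* x :+ y) :- c :* y := c :* (c :* c :* x)) refl c X Y ⟩
      c * (c * c * X)        ∎)
      where
      X = ⟨ α , α ⟩
      Y = ⟨ T α , T α ⟩
      -- A multiple written as a two-term combination, the shape in which `linear` is stated.
      cα = c • α ⊕ 0# • α
      scale-form : ∀ β → ⟨ cα , β ⟩ ≈ c * ⟨ α , β ⟩
      scale-form β = trans (⟨⟩-linearˡ c 0# α α β) (trans (+-congˡ (zeroˡ _)) (+-identityʳ _))
      doubled : c * Y + c * Y ≤ c * (c * c * X + Y)
      doubled = begin
        c * Y + c * Y                           ≈⟨ +-cong Tcα Tcα ⟨
        ⟨ T cα , T α ⟩ + ⟨ T cα , T α ⟩         ≤⟨ bilinear-from-form form cα (T α) (trans (scale-form 𝟙) (trans (*-congˡ α⊥𝟙) (zeroʳ c))) (T-balanced α α⊥𝟙) ⟩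
        c * (⟨ cα , cα ⟩ + Y)                   ≈⟨ *-congˡ (+-congʳ (trans (scale-form cα) (trans (*-congˡ (trans (⟨⟩-comm α cα) (scale-form α))) (sym (*-assoc c c X))))) ⟩
        c * (c * c * X + Y)                     ∎
        where
        Tcα : ⟨ T cα , T α ⟩ ≈ c * Y
        Tcα = trans (⟨⟩-cong (linear c 0# α α) (λ _ → refl)) (trans (⟨⟩-linearˡ c 0# (T α) (T α) (T α)) (trans (+-congˡ (zeroˡ _)) (+-identityʳ _)))

  -- ⟨Tα,Tα⟩ = ⟨α,T²α⟩ and ⟨T²α,T²α⟩ = ⟨Tα,T³α⟩, so Cauchy–Schwarz gives |Tα|³ ≤ |T³α| |α|².
  norm-from-cube : ∀ {N} {T : Vector N → Vector N} → Symmetric T → ∀ α {r} → 0# ≤ r →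
    ⟨ T (T (T α)) , T (T (T α)) ⟩ ≤ r ^ 3 * r ^ 3 * ⟨ α , α ⟩ → ⟨ T α , T α ⟩ ≤ r * r * ⟨ α , α ⟩
  norm-from-cube {T = T} T-sym α {r} 0≤r cube≤ with ⟨ T α , T α ⟩ ≟ 0#
  ... | yes y≈0 = ≤-trans (≤-reflexive y≈0) (*-nonNeg (x²-nonNeg r) (⟨⟩-nonNeg α))
  -- In squared norms, y⁴ ≤ x² z² ≤ y (r² x)³; cancelling y leaves a comparison of cubes.
  ... | no y≉0 = ^-cancel-≤ 3 (*-nonNeg (x²-nonNeg r) 0≤x) (*-cancelˡ-≤ 0≤y y≉0 (begin
    y * (y ^ 3)                      ≈⟨ solve 1 (λ y → y :* y :^ 3 := y :* y :* (y :* y)) refl y ⟩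
    y * y * (y * y)                  ≤⟨ *-mono-≤ (x²-nonNeg y) y²≤ (x²-nonNeg y) y²≤ ⟩
    x * z * (x * z)                  ≈⟨ solve 2 (λ x z → x :* z :* (x :* z) := x :* x :* (z :* z)) refl x z ⟩
    x * x * (z * z)                  ≤⟨ *-monoʳ-≤ (x²-nonNeg x) z²≤ ⟩
    x * x * (y * ⟨ T³α , T³α ⟩)      ≤⟨ *-monoʳ-≤ (x²-nonNeg x) (*-monoʳ-≤ 0≤y cube≤) ⟩
    x * x * (y * (r ^ 3 * r ^ 3 * x)) ≈⟨ solve 3 (λ x y r → x :* x :* (y :* (r :^ 3 :* r :^ 3 :* x)) := y :* (r :* r :* x) :^ 3) refl x y r ⟩
    y * (r * r * x) ^ 3              ∎))
    where
    open Symmetric T-sym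
    T²α = T (T α)
    T³α = T T²α
    x = ⟨ α , α ⟩
    y = ⟨ T α , T α ⟩
    z = ⟨ T²α , T²α ⟩
    0≤x = ⟨⟩-nonNeg α
    0≤y = ⟨⟩-nonNeg (T α)
    y²≤ : y * y ≤ x * z
    y²≤ = ≤-trans (≤-reflexive (*-cong (symmetric α (T α)) (symmetric α (T α)))) (cauchy-schwarz α T²α)
    z²≤ : z * z ≤ y * ⟨ T³α , T³α ⟩
    z²≤ = ≤-trans (≤-reflexive (*-cong (symmetric (T α) T²α) (symmetric (T α) T²α))) (cauchy-schwarz (T α) T³α)

-- Walk operators and the second eigenvalue.

module WalkOperator (ℝ : CompleteOrderedField) where

  open Operators ℝ public
  open Spectral ℝ public using (adjacency; edgeCount; IsExpander)
  open import Relation.Binary.Reasoning.PartialOrder ≤-poset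

  [_]ᵇ : Bool → Carrier
  [ b ]ᵇ = if b then 1# else 0#

  Σᴸ : ∀ {A : Set} → (A → Carrier) → List A → Carrier
  Σᴸ h []       = 0#
  Σᴸ h (x ∷ xs) = h x + Σᴸ h xs

  Σᴸ-++ : ∀ {A : Set} (h : A → Carrier) xs ys → Σᴸ h (xs ++ ys) ≈ Σᴸ h xs + Σᴸ h ys
  Σᴸ-++ h []       ys = sym (+-identityˡ _)
  Σᴸ-++ h (x ∷ xs) ys = trans (+-congˡ (Σᴸ-++ h xs ys)) (sym (+-assoc _ _ _))

  Σᴸ-map : ∀ {A B : Set} (h : B → Carrier) (g : A → B) xs → Σᴸ h (map g xs) ≡ Σᴸ (λ x → h (g x)) xs
  Σᴸ-map h g []       = ≡.refl
  Σᴸ-map h g (x ∷ xs) = ≡.cong (λ y → h (g x) + y) (Σᴸ-map h g xs)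

  Σᴸ-× : ∀ {A B : Set} (h : A × B → Carrier) xs ys →
         Σᴸ h (cartesianProduct xs ys) ≈ Σᴸ (λ x → Σᴸ (λ y → h (x , y)) ys) xs
  Σᴸ-× h []       ys = refl
  Σᴸ-× h (x ∷ xs) ys = trans (Σᴸ-++ h (map (x ,_) ys) (cartesianProduct xs ys))
    (+-cong (reflexive (Σᴸ-map h (x ,_) ys)) (Σᴸ-× h xs ys))

  Σᴸ-tabulate : ∀ {A : Set} {n} (h : A → Carrier) (g : Fin n → A) → Σᴸ h (tabulate g) ≡ sum (λ i → h (g i))
  Σᴸ-tabulate {n = zero}  h g = ≡.refl
  Σᴸ-tabulate {n = suc n} h g = ≡.cong (λ y → h (g zero) + y) (Σᴸ-tabulate h (λ i → g (suc i)))

  length-filter : ∀ {A : Set} {P : Pred A 0ℓ} (P? : Decidable P) xs →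
                  fromℕ (length (filter P? xs)) ≈ Σᴸ (λ x → [ does (P? x) ]ᵇ) xs
  length-filter P? [] = refl
  length-filter P? (x ∷ xs) with does (P? x)
  ... | false = trans (length-filter P? xs) (sym (+-identityˡ _))
  ... | true  = +-congˡ (length-filter P? xs)

  δ-× : ∀ {m n} (x y : Fin m × Fin n) →
        [ does (≡-dec Fin._≟_ Fin._≟_ x y) ]ᵇ ≈ δ (proj₁ x) (proj₁ y) * δ (proj₂ x) (proj₂ y)
  δ-× (w , k) (v , j) with w Fin.≟ v
  ... | no _       = sym (zeroˡ _)
  ... | yes ≡.refl = sym (*-identityˡ _)

  walk : ∀ {N D} → RegularGraph N D → Vector N → Vector N
  walk {D = D} G α u = fromℕ D ⁻¹ * sum (λ i → α (proj₁ (rot G (u , i))))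

  Σδ : ∀ {n} (k : Fin n) → sum (δ k) ≈ 1#
  Σδ k = trans (sum-cong {x = δ k} (λ j → sym (*-identityʳ (δ k j)))) (⟨δ,⟩ k 𝟙)

  -- For each label i exactly one label j matches the far end of the edge, so the sum over j
  -- collapses.
  edgeCount-δ : ∀ {N D} (G : RegularGraph N D) u v →
                fromℕ (edgeCount G u v) ≈ sum (λ i → δ (proj₁ (rot G (u , i))) v)
  edgeCount-δ {D = D} G u v = begin-equality
    fromℕ (edgeCount G u v)
      ≈⟨ length-filter (λ (i , j) → same i j) (cartesianProduct (allFin D) (allFin D)) ⟩
    Σᴸ (λ (i , j) → [ does (same i j) ]ᵇ) (cartesianProduct (allFin D) (allFin D))
      ≈⟨ Σᴸ-× (λ (i , j) → [ does (same i j) ]ᵇ) (allFin D) (allFin D) ⟩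
    Σᴸ (λ i → Σᴸ (λ j → [ does (same i j) ]ᵇ) (allFin D)) (allFin D)
      ≡⟨ Σᴸ-tabulate (λ i → Σᴸ (λ j → [ does (same i j) ]ᵇ) (allFin D)) (λ i → i) ⟩
    sum (λ i → Σᴸ (λ j → [ does (same i j) ]ᵇ) (allFin D))
      ≈⟨ sum-cong {D} (λ i → row i) ⟩
    sum (λ i → δ (proj₁ (rot G (u , i))) v) ∎
    where
    same : ∀ i j → _
    same i j = ≡-dec Fin._≟_ Fin._≟_ (rot G (u , i)) (v , j)
    row : ∀ i → Σᴸ (λ j → [ does (same i j) ]ᵇ) (allFin D) ≈ δ (proj₁ (rot G (u , i))) v
    row i = let (w , k) = rot G (u , i) in begin-equality
      Σᴸ (λ j → [ does (same i j) ]ᵇ) (allFin D) ≡⟨ Σᴸ-tabulate (λ j → [ does (same i j) ]ᵇ) (λ j → j) ⟩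
      sum (λ j → [ does (same i j) ]ᵇ)           ≈⟨ sum-cong {D} (λ j → δ-× (rot G (u , i)) (v , j)) ⟩
      sum (λ j → δ w v * δ k j)                  ≈⟨ *-distribˡ-sum (δ w v) (δ k) ⟨
      δ w v * sum (δ k)                          ≈⟨ *-congˡ (Σδ k) ⟩
      δ w v * 1#                                 ≈⟨ *-identityʳ _ ⟩
      δ w v                                      ∎

  adjacency≋walk : ∀ {N D} (G : RegularGraph N D) α → adjacency G ∙ α ≋ walk G α
  adjacency≋walk {N} {D} G α u = begin-equality
    sum (λ v → fromℕ (edgeCount G u v) * d * α v)
      ≈⟨ sum-cong {N} (λ v → entry v) ⟩
    sum (λ v → d * sum (λ i → δ (w i) v * α v))
      ≈⟨ *-distribˡ-sum d (λ v → sum (λ i → δ (w i) v * α v)) ⟨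
    d * sum (λ v → sum (λ i → δ (w i) v * α v))
      ≈⟨ *-congˡ (∑-comm {N} {D} (λ v i → δ (w i) v * α v)) ⟩
    d * sum (λ i → sum (λ v → δ (w i) v * α v))
      ≈⟨ *-congˡ (sum-cong {D} (λ i → ⟨δ,⟩ (w i) α)) ⟩
    d * sum (λ i → α (w i)) ∎
    where
    d = fromℕ D ⁻¹
    w : Fin D → Fin N
    w i = proj₁ (rot G (u , i))
    entry : ∀ v → fromℕ (edgeCount G u v) * d * α v ≈ d * sum (λ i → δ (w i) v * α v)
    entry v = begin-equality
      fromℕ (edgeCount G u v) * d * α v     ≈⟨ *-congʳ (*-congʳ (edgeCount-δ G u v)) ⟩
      sum (λ i → δ (w i) v) * d * α v       ≈⟨ solve 3 (λ s d a → s :* d :* a := d :* (s :* a)) refl _ d (α v) ⟩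
      d * (sum (λ i → δ (w i) v) * α v)     ≈⟨ *-congˡ (*-distribʳ-sum (α v) (λ i → δ (w i) v)) ⟩
      d * sum (λ i → δ (w i) v * α v)       ∎

  sum-+ : ∀ m {n} (h : Vector (m ℕ.+ n)) → sum h ≈ sum (λ i → h (i ↑ˡ n)) + sum (λ j → h (m ↑ʳ j))
  sum-+ zero    h = sym (+-identityˡ _)
  sum-+ (suc m) h = trans (+-congˡ (sum-+ m (λ i → h (suc i)))) (sym (+-assoc _ _ _))

  sum-* : ∀ m n (h : Vector (m ℕ.* n)) → sum h ≈ sum {m} (λ i → sum {n} (λ j → h (combine i j)))
  sum-* zero    n h = refl
  sum-* (suc m) n h = trans (sum-+ n h) (+-congˡ (sum-* m n (λ x → h (n ↑ʳ x))))

  sum-involution : ∀ {N} (h : Vector N) (φ : Fin N → Fin N) → (∀ x → φ (φ x) ≡ x) →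
                   sum (λ x → h (φ x)) ≈ sum h
  sum-involution h φ φφ = sym (sum-permute h (permutation φ φ φφ φφ))

  module _ {N D} (G : RegularGraph N D) where

    -- Edge ends as a single index set, so that a rotation map becomes an involution of `Fin` and
    -- sums can be permuted. For G₁ it also acts on the vertices of the replacement product.
    rotᶠ : Fin (N ℕ.* D) → Fin (N ℕ.* D)
    rotᶠ x = uncurry combine (rot G (remQuot {N} D x))

    rotᶠ-involutive : ∀ x → rotᶠ (rotᶠ x) ≡ x
    rotᶠ-involutive x = ≡.trans
      (≡.cong (λ e → uncurry combine (rot G e)) (remQuot-combine (proj₁ (rot G (remQuot D x))) (proj₂ (rot G (remQuot D x)))))
      (≡.trans (≡.cong (uncurry combine) (rot-involutive G (remQuot D x))) (combine-remQuot {N} D x))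

    rotᶠ-combine : ∀ v i → rotᶠ (combine v i) ≡ uncurry combine (rot G (v , i))
    rotᶠ-combine v i = ≡.cong (λ e → uncurry combine (rot G e)) (remQuot-combine v i)

    sum-rot : (F : Fin N × Fin D → Carrier) →
              sum (λ u → sum (λ i → F (rot G (u , i)))) ≈ sum (λ u → sum (λ i → F (u , i)))
    sum-rot F = begin-equality
      sum (λ u → sum (λ i → F (rot G (u , i))))
        ≈⟨ sum-cong {N} (λ u → sum-cong {D} (λ i → reflexive (≡.cong F (unfold u i)))) ⟨
      sum {N} (λ u → sum {D} (λ i → h (rotᶠ (combine u i))))
        ≈⟨ sum-* N D (λ x → h (rotᶠ x)) ⟨
      sum (λ x → h (rotᶠ x))
        ≈⟨ sum-involution h rotᶠ rotᶠ-involutive ⟩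
      sum h
        ≈⟨ sum-* N D h ⟩
      sum {N} (λ u → sum {D} (λ i → h (combine u i)))
        ≈⟨ sum-cong {N} (λ u → sum-cong {D} (λ i → reflexive (≡.cong F (remQuot-combine u i)))) ⟩
      sum (λ u → sum (λ i → F (u , i))) ∎
      where
      h : Vector (N ℕ.* D)
      h x = F (remQuot {N} D x)
      unfold : ∀ u i → remQuot {N} D (rotᶠ (combine u i)) ≡ rot G (u , i)
      unfold u i = ≡.trans (≡.cong (remQuot {N} D) (rotᶠ-combine u i))
        (remQuot-combine (proj₁ (rot G (u , i))) (proj₂ (rot G (u , i))))

    walk-symmetric : Symmetric (walk G)
    walk-symmetric = record
      { T-cong    = λ α≋β u → *-congˡ (sum-cong {D} (λ i → α≋β _))
      ; linear    = walk-linear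
      ; symmetric = λ α β → begin-equality
          ⟨ walk G α , β ⟩                         ≈⟨ pull α β ⟩
          d * sum (λ u → sum (λ i → α (n u i) * β u))
            ≈⟨ *-congˡ (sum-cong {N} (λ u → sum-cong {D} (λ i →
                 trans (*-comm _ _) (*-congʳ (reflexive (≡.cong (λ e → β (proj₁ e)) (≡.sym (rot-involutive G (u , i))))))))) ⟩
          d * sum (λ u → sum (λ i → β (proj₁ (rot G (rot G (u , i)))) * α (n u i)))
            ≈⟨ *-congˡ (sum-rot (λ e → β (proj₁ (rot G e)) * α (proj₁ e))) ⟩
          d * sum (λ u → sum (λ i → β (n u i) * α u)) ≈⟨ pull β α ⟨
          ⟨ walk G β , α ⟩                         ≈⟨ ⟨⟩-comm (walk G β) α ⟩
          ⟨ α , walk G β ⟩                         ∎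
      }
      where
      d = fromℕ D ⁻¹
      n : Fin N → Fin D → Fin N
      n u i = proj₁ (rot G (u , i))
      pull : ∀ α β → ⟨ walk G α , β ⟩ ≈ d * sum (λ u → sum (λ i → α (n u i) * β u))
      pull α β = begin-equality
        sum (λ u → d * sum (λ i → α (n u i)) * β u)
          ≈⟨ sum-cong {N} (λ u → trans (*-assoc _ _ _) (*-congˡ (*-distribʳ-sum (β u) (λ i → α (n u i))))) ⟩
        sum (λ u → d * sum (λ i → α (n u i) * β u))
          ≈⟨ *-distribˡ-sum d (λ u → sum (λ i → α (n u i) * β u)) ⟨
        d * sum (λ u → sum (λ i → α (n u i) * β u)) ∎
      walk-linear : ∀ s t α β → walk G (s • α ⊕ t • β) ≋ s • walk G α ⊕ t • walk G β
      walk-linear s t α β u = begin-equality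
        d * sum (λ i → s * α (n u i) + t * β (n u i))
          ≈⟨ *-congˡ (∑-distrib-+ (λ i → s * α (n u i)) (λ i → t * β (n u i))) ⟩
        d * (sum (λ i → s * α (n u i)) + sum (λ i → t * β (n u i)))
          ≈⟨ *-congˡ (+-cong (*-distribˡ-sum s (λ i → α (n u i))) (*-distribˡ-sum t (λ i → β (n u i)))) ⟨
        d * (s * sum (λ i → α (n u i)) + t * sum (λ i → β (n u i)))
          ≈⟨ solve 5 (λ d s t a b → d :* (s :* a :+ t :* b) := s :* (d :* a) :+ t :* (d :* b)) refl d s t _ _ ⟩
        s * (d * sum (λ i → α (n u i))) + t * (d * sum (λ i → β (n u i))) ∎

    module _ .{{D≢0 : NonZero D}} where

      private
        d = fromℕ D ⁻¹

        Dd≈1 : fromℕ D * d ≈ 1#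
        Dd≈1 = *-inverseʳ (fromℕ D) (fromℕ≉0 D)

        average-const : ∀ x → d * sum {D} (λ _ → x) ≈ x
        average-const x = begin-equality
          d * sum {D} (λ _ → x)  ≈⟨ *-congˡ (sum-const D x) ⟩
          d * (fromℕ D * x)      ≈⟨ solve 3 (λ d n x → d :* (n :* x) := n :* d :* x) refl d (fromℕ D) x ⟩
          fromℕ D * d * x        ≈⟨ *-congʳ Dd≈1 ⟩
          1# * x                 ≈⟨ *-identityˡ x ⟩
          x                      ∎

      walk-const : ∀ x → walk G (λ _ → x) ≋ (λ _ → x)
      walk-const x u = average-const x

      walk-balanced : ∀ α → Balanced α → Balanced (walk G α)
      walk-balanced α α⊥𝟙 = begin-equality
        ⟨ walk G α , 𝟙 ⟩ ≈⟨ Symmetric.symmetric walk-symmetric α 𝟙 ⟩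
        ⟨ α , walk G 𝟙 ⟩ ≈⟨ ⟨⟩-cong {α = α} (λ _ → refl) (walk-const 1#) ⟩
        ⟨ α , 𝟙 ⟩        ≈⟨ α⊥𝟙 ⟩
        0#               ∎

      -- Cauchy-Schwarz against 𝟙 at each vertex bounds the squared mean by the mean of squares;
      -- permuting edge ends then counts every α (u)² exactly D times.
      walk-contraction : Contraction (walk G)
      walk-contraction α = begin
        sum (λ u → walk G α u * walk G α u)
          ≤⟨ sum-mono-≤ (λ u → jensen u) ⟩
        sum (λ u → d * sum (λ i → α (n u i) * α (n u i)))
          ≈⟨ *-distribˡ-sum d (λ u → sum (λ i → α (n u i) * α (n u i))) ⟨
        d * sum (λ u → sum (λ i → α (n u i) * α (n u i)))
          ≈⟨ *-congˡ (sum-rot (λ e → α (proj₁ e) * α (proj₁ e))) ⟩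
        d * sum (λ u → sum {D} (λ i → α u * α u))
          ≈⟨ *-distribˡ-sum d (λ u → sum {D} (λ i → α u * α u)) ⟩
        sum (λ u → d * sum {D} (λ i → α u * α u))
          ≈⟨ sum-cong {N} (λ u → average-const (α u * α u)) ⟩
        ⟨ α , α ⟩ ∎
        where
        n : Fin N → Fin D → Fin N
        n u i = proj₁ (rot G (u , i))
        0≤d : 0# ≤ d
        0≤d = ⁻¹-nonNeg (fromℕ-nonNeg D) (fromℕ≉0 D)
        jensen : ∀ u → walk G α u * walk G α u ≤ d * sum (λ i → α (n u i) * α (n u i))
        jensen u = begin
          d * sum a * (d * sum a)       ≈⟨ solve 2 (λ d s → d :* s :* (d :* s) := d :* d :* (s :* s)) refl d (sum a) ⟩
          d * d * (sum a * sum a)       ≈⟨ *-congˡ (*-cong Σa Σa) ⟩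
          d * d * (⟨ a , 𝟙 ⟩ * ⟨ a , 𝟙 ⟩) ≤⟨ *-monoʳ-≤ (x²-nonNeg d) (cauchy-schwarz a 𝟙) ⟩
          d * d * (⟨ a , a ⟩ * ⟨ 𝟙 {D} , 𝟙 {D} ⟩)
            ≈⟨ *-congˡ (*-congˡ (trans (sum-cong {D} {λ _ → 1# * 1#} (λ _ → *-identityˡ 1#)) (trans (sum-const D 1#) (*-identityʳ _)))) ⟩
          d * d * (⟨ a , a ⟩ * fromℕ D)
            ≈⟨ solve 3 (λ d q n → d :* d :* (q :* n) := n :* d :* (d :* q)) refl d ⟨ a , a ⟩ (fromℕ D) ⟩
          fromℕ D * d * (d * ⟨ a , a ⟩) ≈⟨ trans (*-congʳ Dd≈1) (*-identityˡ _) ⟩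
          d * ⟨ a , a ⟩                 ∎
          where
          a : Vector D
          a i = α (n u i)
          Σa : sum a ≈ ⟨ a , 𝟙 ⟩
          Σa = sum-cong {x = a} (λ i → sym (*-identityʳ (a i)))

      walk-bound : ∀ {μ} → 0# ≤ μ → IsExpander G μ → ∀ α → Balanced α →
                   ⟨ walk G α , walk G α ⟩ ≤ μ * μ * ⟨ α , α ⟩
      walk-bound {μ} 0≤μ (l , (_ , l-max) , l≤μ) α α⊥𝟙 with ⟨ α , α ⟩ ≟ 0#
      ... | yes αα≈0 = ≤-trans (walk-contraction α) (≤-trans (≤-reflexive αα≈0) (*-nonNeg (x²-nonNeg μ) (⟨⟩-nonNeg α)))
      ... | no αα≉0 = begin
        ⟨ walk G α , walk G α ⟩                   ≈⟨ ⟨⟩-cong (adjacency≋walk G α) (adjacency≋walk G α) ⟨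
        ⟨ adjacency G ∙ α , adjacency G ∙ α ⟩     ≤⟨ ratio-≤⁻¹ (adjacency G ∙ α) α α≉0
          (≤-trans (proj₂ (l-max N≢1) (α , α⊥𝟙 , α≉0 , refl)) l≤μ) ⟩
        μ * μ * ⟨ α , α ⟩                         ∎
        where
        α≉0 : ¬ (∀ v → α v ≈ 0#)
        α≉0 α≈0 = αα≉0 (trans (⟨⟩-cong {β = α} α≈0 (λ _ → refl)) (sum-0 α))
        -- On one vertex balanced means zero, so a nonzero α selects the clause of
        -- `IsSecondEigenvalue` about the maximum.
        N≢1 : N ≢ 1
        N≢1 ≡.refl = α≉0 λ { zero → trans (trans (sym (*-identityʳ _)) (sym (+-identityʳ _))) α⊥𝟙 }

  walk-form-bound : ∀ {N D} (G : RegularGraph N D) .{{_ : NonZero D}} {μ} → 0# ≤ μ → IsExpander G μ →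
    ∀ {σ} → Sign σ → ∀ α → Balanced α → σ * ⟨ walk G α , α ⟩ ≤ μ * ⟨ α , α ⟩
  walk-form-bound G {μ} 0≤μ expander {σ} σ²≈1 α α⊥𝟙 =
    square-cancel-≤ (*-nonNeg 0≤μ (⟨⟩-nonNeg α)) (begin
      σ * a * (σ * a)              ≈⟨ solve 2 (λ s a → s :* a :* (s :* a) := s :* s :* (a :* a)) refl σ a ⟩
      σ * σ * (a * a)              ≈⟨ trans (*-congʳ σ²≈1) (*-identityˡ _) ⟩
      a * a                        ≤⟨ cauchy-schwarz (walk G α) α ⟩
      ⟨ walk G α , walk G α ⟩ * x  ≤⟨ *-monoˡ-≤ (⟨⟩-nonNeg α) (walk-bound G 0≤μ expander α α⊥𝟙) ⟩
      μ * μ * x * x                ≈⟨ solve 2 (λ m x → m :* m :* x :* x := m :* x :* (m :* x)) refl μ x ⟩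
      μ * x * (μ * x)              ∎)
    where
    a = ⟨ walk G α , α ⟩
    x = ⟨ α , α ⟩

  -- `IsExpander` asks for λ(G) itself, not just for a bound: `ratio-maximum` supplies it from two
  -- vertices on, and it is 0 by convention on one.
  expander : ∀ {N D} .{{_ : NonZero N}} .{{_ : NonZero D}} (G : RegularGraph N D) {μ} → 0# ≤ μ →
    (∀ α → Balanced α → ⟨ walk G α , walk G α ⟩ ≤ μ * μ * ⟨ α , α ⟩) → IsExpander G μ
  expander {suc zero}    G 0≤μ bound = 0# , ((λ _ → refl) , λ 1≢1 → contradiction ≡.refl 1≢1) , 0≤μ
  expander {suc (suc n)} G {μ} 0≤μ bound =
    let (l , (α , α⊥𝟙 , α≉0 , l≈) , upper) = ratio-maximum (adjacency G) adjacency-contraction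
    in l , ((λ ()) , λ _ → (α , α⊥𝟙 , α≉0 , l≈) , upper) , (begin
         l                                  ≈⟨ l≈ ⟩
         ∥ adjacency G ∙ α ∥ / ∥ α ∥        ≤⟨ ratio-≤ (adjacency G ∙ α) α α≉0 0≤μ (begin
           ⟨ adjacency G ∙ α , adjacency G ∙ α ⟩  ≈⟨ adjacency-walk α ⟩
           ⟨ walk G α , walk G α ⟩                ≤⟨ bound α α⊥𝟙 ⟩
           μ * μ * ⟨ α , α ⟩                      ∎) ⟩
         μ                                  ∎)
    where
    adjacency-walk : ∀ α → ⟨ adjacency G ∙ α , adjacency G ∙ α ⟩ ≈ ⟨ walk G α , walk G α ⟩
    adjacency-walk α = ⟨⟩-cong (adjacency≋walk G α) (adjacency≋walk G α)
    adjacency-contraction : Contraction (adjacency G ∙_)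
    adjacency-contraction α = ≤-trans (≤-reflexive (adjacency-walk α)) (walk-contraction G α)

-- The replacement product as a zig-zag of operators.

module ReplacementExpansion (ℝ : CompleteOrderedField) where

  open WalkOperator ℝ public
  open import Relation.Binary.Reasoning.PartialOrder ≤-poset

  module _ {N₁ D₁ : ℕ} where

    N : ℕ
    N = N₁ ℕ.* D₁

    cloud : Vector N → Fin N₁ → Vector D₁
    cloud α v k = α (combine v k)

    -- The operator I ⊗ T for the splitting of the vertices into N₁ copies of [D₁].
    cloudwise : (Vector D₁ → Vector D₁) → Vector N → Vector N
    cloudwise T α x = let (v , k) = remQuot {N₁} D₁ x in T (cloud α v) k

    cloudwise-combine : ∀ T α v k → cloudwise T α (combine v k) ≡ T (cloud α v) k
    cloudwise-combine T α v k = ≡.cong (λ (v , k) → T (cloud α v) k) (remQuot-combine v k)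

    ⟨⟩-cloud : ∀ α β → ⟨ α , β ⟩ ≈ sum (λ v → ⟨ cloud α v , cloud β v ⟩)
    ⟨⟩-cloud α β = sum-* N₁ D₁ (λ x → α x * β x)

    ⟨cloudwise,⟩ : ∀ T α β → ⟨ cloudwise T α , β ⟩ ≈ sum (λ v → ⟨ T (cloud α v) , cloud β v ⟩)
    ⟨cloudwise,⟩ T α β = trans (⟨⟩-cloud (cloudwise T α) β)
      (sum-cong {N₁} (λ v → ⟨⟩-cong {β = cloud β v} (λ k → reflexive (cloudwise-combine T α v k)) (λ _ → refl)))

    cloudwise-symmetric : ∀ {T} → Symmetric T → Symmetric (cloudwise T)
    cloudwise-symmetric {T} T-sym = record
      { T-cong    = λ α≋β x → T-cong (λ k → α≋β _) _
      ; linear    = λ s t α β x → linear s t _ _ _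
      ; symmetric = λ α β → begin-equality
          ⟨ cloudwise T α , β ⟩                        ≈⟨ ⟨cloudwise,⟩ T α β ⟩
          sum (λ v → ⟨ T (cloud α v) , cloud β v ⟩)
            ≈⟨ sum-cong {N₁} (λ v → trans (symmetric (cloud α v) (cloud β v)) (⟨⟩-comm (cloud α v) (T (cloud β v)))) ⟩
          sum (λ v → ⟨ T (cloud β v) , cloud α v ⟩)    ≈⟨ ⟨cloudwise,⟩ T β α ⟨
          ⟨ cloudwise T β , α ⟩                        ≈⟨ ⟨⟩-comm (cloudwise T β) α ⟩
          ⟨ α , cloudwise T β ⟩                        ∎
      }
      where open Symmetric T-sym

    cloudwise-bound : ∀ T c α → (∀ v → ⟨ T (cloud α v) , T (cloud α v) ⟩ ≤ c * ⟨ cloud α v , cloud α v ⟩) →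
                      ⟨ cloudwise T α , cloudwise T α ⟩ ≤ c * ⟨ α , α ⟩
    cloudwise-bound T c α bound = begin
      ⟨ cloudwise T α , cloudwise T α ⟩
        ≈⟨ ⟨⟩-cloud (cloudwise T α) (cloudwise T α) ⟩
      sum (λ v → ⟨ cloud (cloudwise T α) v , cloud (cloudwise T α) v ⟩)
        ≈⟨ sum-cong {N₁} (λ v → ⟨⟩-cong (T≋ v) (T≋ v)) ⟩
      sum (λ v → ⟨ T (cloud α v) , T (cloud α v) ⟩)
        ≤⟨ sum-mono-≤ {N₁} bound ⟩
      sum (λ v → c * ⟨ cloud α v , cloud α v ⟩)
        ≈⟨ *-distribˡ-sum c (λ v → ⟨ cloud α v , cloud α v ⟩) ⟨
      c * sum (λ v → ⟨ cloud α v , cloud α v ⟩)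
        ≈⟨ *-congˡ (⟨⟩-cloud α α) ⟨
      c * ⟨ α , α ⟩ ∎
      where
      T≋ : ∀ v → cloud (cloudwise T α) v ≋ T (cloud α v)
      T≋ v k = reflexive (cloudwise-combine T α v k)

    cloudwise-contraction : ∀ {T} → Contraction T → Contraction (cloudwise T)
    cloudwise-contraction {T} T-contr α = ≤-trans
      (cloudwise-bound T 1# α (λ v → ≤-trans (T-contr (cloud α v)) (≤-reflexive (sym (*-identityˡ _)))))
      (≤-reflexive (*-identityˡ _))

  -- Its walk operator averages over all vertices.
  complete : ∀ {D} → RegularGraph D D
  complete = record { rot = swap ; rot-involutive = λ _ → ≡.refl }

  -- M = a A + b B is the walk operator of the replacement product, and p = a b².
  module EdgeWeights (D₂ : ℕ) .{{_ : NonZero D₂}} where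

    D₂+1≢0 : NonZero (D₂ ℕ.+ 1)
    D₂+1≢0 = ℕ.≢-nonZero (ℕ.m+1+n≢0 D₂)

    D₂+1≉0 : ¬ fromℕ (D₂ ℕ.+ 1) ≈ 0#
    D₂+1≉0 = fromℕ≉0 (D₂ ℕ.+ 1) {{D₂+1≢0}}

    a b : Carrier
    a = fromℕ (D₂ ℕ.+ 1) ⁻¹
    b = fromℕ D₂ * a

    a+b≈1 : a + b ≈ 1#
    a+b≈1 = begin-equality
      a + fromℕ D₂ * a            ≈⟨ solve 2 (λ a n → a :+ n :* a := (n :+ (:1 :+ :0)) :* a) refl a (fromℕ D₂) ⟩
      (fromℕ D₂ + fromℕ 1) * a    ≈⟨ *-congʳ (fromℕ-+ D₂ 1) ⟨
      fromℕ (D₂ ℕ.+ 1) * a        ≈⟨ *-inverseʳ _ D₂+1≉0 ⟩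
      1#                          ∎

    0≤a : 0# ≤ a
    0≤a = ⁻¹-nonNeg (fromℕ-nonNeg (D₂ ℕ.+ 1)) D₂+1≉0

    0≤b : 0# ≤ b
    0≤b = *-nonNeg (fromℕ-nonNeg D₂) 0≤a

    p≈ab² : p D₂ ≈ a * b * b
    p≈ab² = *-cancelˡ n³≉0 (begin-equality
      fromℕ (n ℕ.^ 3) * (fromℕ (D₂ ℕ.^ 2) * fromℕ (n ℕ.^ 3) ⁻¹)
        ≈⟨ solve 3 (λ x y z → x :* (y :* z) := x :* z :* y) refl _ _ _ ⟩
      fromℕ (n ℕ.^ 3) * fromℕ (n ℕ.^ 3) ⁻¹ * fromℕ (D₂ ℕ.^ 2)
        ≈⟨ *-cong (*-inverseʳ _ n³≉0) (fromℕ-^ D₂ 2) ⟩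
      1# * fromℕ D₂ ^ 2
        ≈⟨ solve 1 (λ d → :1 :* d :^ 2 := :1 :* (:1 :* :1) :* (d :* d)) refl (fromℕ D₂) ⟩
      1# * (1# * 1#) * (fromℕ D₂ * fromℕ D₂)
        ≈⟨ *-congʳ (*-cong na (*-cong na na)) ⟨
      fromℕ n * a * (fromℕ n * a * (fromℕ n * a)) * (fromℕ D₂ * fromℕ D₂)
        ≈⟨ solve 3 (λ n a d → n :* a :* (n :* a :* (n :* a)) :* (d :* d) := n :^ 3 :* (a :* (d :* a) :* (d :* a))) refl (fromℕ n) a (fromℕ D₂) ⟩
      fromℕ n ^ 3 * (a * b * b)
        ≈⟨ *-congʳ (fromℕ-^ n 3) ⟨
      fromℕ (n ℕ.^ 3) * (a * b * b) ∎)
      where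
      n = D₂ ℕ.+ 1
      na = *-inverseʳ (fromℕ n) D₂+1≉0
      n³≉0 : ¬ fromℕ (n ℕ.^ 3) ≈ 0#
      n³≉0 n³≈0 = x^n≉0 3 D₂+1≉0 (trans (sym (fromℕ-^ n 3)) n³≈0)

    p-nonNeg : 0# ≤ p D₂
    p-nonNeg = ≤-trans (*-nonNeg (*-nonNeg 0≤a 0≤b) 0≤b) (≤-reflexive (sym p≈ab²))

    p≉0 : ¬ p D₂ ≈ 0#
    p≉0 p≈0 = x*y≉0 (x*y≉0 a≉0 b≉0) b≉0 (trans (sym p≈ab²) p≈0)
      where
      a≉0 = ⁻¹-≉0 D₂+1≉0
      b≉0 = x*y≉0 (fromℕ≉0 D₂) a≉0

    -- a b² is one of the nonnegative terms of a (a + b)² + b = 1.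
    p≤1 : p D₂ ≤ 1#
    p≤1 = begin
      p D₂        ≈⟨ p≈ab² ⟩
      a * b * b   ≤⟨ ≤-from-gap (+-nonNeg (*-nonNeg 0≤a (+-nonNeg (*-nonNeg 0≤a 0≤a) (+-nonNeg 0≤ab 0≤ab))) 0≤b)
                       (solve 2 (λ a b → a :* b :* b :+ (a :* (a :* a :+ (a :* b :+ a :* b)) :+ b)
                         := a :* ((a :+ b) :* (a :+ b)) :+ b) refl a b) ⟩
      a * ((a + b) * (a + b)) + b  ≈⟨ +-congʳ (trans (*-congˡ (trans (*-cong a+b≈1 a+b≈1) (*-identityˡ 1#))) (*-identityʳ a)) ⟩
      a + b       ≈⟨ a+b≈1 ⟩
      1#          ∎
      where 0≤ab = *-nonNeg 0≤a 0≤b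

  module Product {N₁ D₁ D₂ : ℕ} .{{_ : NonZero D₁}} .{{_ : NonZero D₂}}
    (G₁ : RegularGraph N₁ D₁) (G₂ : RegularGraph D₁ D₂) where

    G : RegularGraph (N₁ ℕ.* D₁) (D₂ ℕ.+ 1)
    G = relabel *↔× (replacementProduct G₁ G₂)

    A B P : Vector (N₁ ℕ.* D₁) → Vector (N₁ ℕ.* D₁)
    A α x = α (rotᶠ G₁ x)
    B = cloudwise {N₁} (walk G₂)
    P = cloudwise {N₁} (walk complete)

    private
      d = fromℕ D₁ ⁻¹

      mean : Vector (N₁ ℕ.* D₁) → Vector N₁
      mean α v = d * sum (λ k → α (combine v k))

    module _ {l m : Carrier} (0≤l : 0# ≤ l) (0≤m : 0# ≤ m) (G₁-exp : IsExpander G₁ l) (G₂-exp : IsExpander G₂ m) where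

      -- P α is constant on each copy, with value the mean there, so A acts on it through the edges
      -- of G₁. Both forms are D₁ times those of the vector of means, which is balanced, and λ₁
      -- applies to it.
      A-on-clouds : ∀ {σ} → Sign σ → ∀ α → Balanced α → σ * ⟨ A (P α) , P α ⟩ ≤ l * ⟨ P α , P α ⟩
      A-on-clouds {σ} σ²≈1 α α⊥𝟙 = begin
        σ * ⟨ A (P α) , P α ⟩              ≈⟨ *-congˡ AP ⟩
        σ * (fromℕ D₁ * ⟨ walk G₁ a , a ⟩) ≈⟨ solve 3 (λ s n w → s :* (n :* w) := n :* (s :* w)) refl σ (fromℕ D₁) _ ⟩
        fromℕ D₁ * (σ * ⟨ walk G₁ a , a ⟩) ≤⟨ *-monoʳ-≤ (fromℕ-nonNeg D₁) (walk-form-bound G₁ 0≤l G₁-exp σ²≈1 a a⊥𝟙) ⟩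
        fromℕ D₁ * (l * ⟨ a , a ⟩)         ≈⟨ solve 3 (λ s n w → n :* (s :* w) := s :* (n :* w)) refl l (fromℕ D₁) _ ⟩
        l * (fromℕ D₁ * ⟨ a , a ⟩)         ≈⟨ *-congˡ PP ⟨
        l * ⟨ P α , P α ⟩                  ∎
        where
        a = mean α
        Pα≡ : ∀ v k → P α (combine v k) ≡ a v
        Pα≡ = cloudwise-combine {N₁} (walk complete) α
        a⊥𝟙 : Balanced a
        a⊥𝟙 = begin-equality
          sum (λ v → a v * 1#)                        ≈⟨ sum-cong {N₁} (λ v → *-identityʳ (a v)) ⟩
          sum a                                       ≈⟨ *-distribˡ-sum {N₁} d (λ v → sum {D₁} (λ k → α (combine v k))) ⟨
          d * sum {N₁} (λ v → sum {D₁} (λ k → α (combine v k)))  ≈⟨ *-congˡ (sum-* N₁ D₁ α) ⟨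
          d * sum α                                   ≈⟨ *-congˡ (sum-cong {x = α} (λ x → sym (*-identityʳ (α x)))) ⟩
          d * ⟨ α , 𝟙 ⟩                               ≈⟨ trans (*-congˡ α⊥𝟙) (zeroʳ d) ⟩
          0#                                          ∎
        PP : ⟨ P α , P α ⟩ ≈ fromℕ D₁ * ⟨ a , a ⟩
        PP = begin-equality
          ⟨ P α , P α ⟩   ≈⟨ sum-* N₁ D₁ (λ x → P α x * P α x) ⟩
          sum {N₁} (λ v → sum {D₁} (λ k → P α (combine v k) * P α (combine v k)))
            ≈⟨ sum-cong {N₁} (λ v → sum-cong {D₁} (λ k → reflexive (≡.cong₂ _*_ (Pα≡ v k) (Pα≡ v k)))) ⟩
          sum {N₁} (λ v → sum {D₁} (λ k → a v * a v))
            ≈⟨ sum-cong {N₁} (λ v → sum-const D₁ (a v * a v)) ⟩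
          sum {N₁} (λ v → fromℕ D₁ * (a v * a v))
            ≈⟨ *-distribˡ-sum (fromℕ D₁) (λ v → a v * a v) ⟨
          fromℕ D₁ * ⟨ a , a ⟩ ∎
        AP : ⟨ A (P α) , P α ⟩ ≈ fromℕ D₁ * ⟨ walk G₁ a , a ⟩
        AP = begin-equality
          ⟨ A (P α) , P α ⟩ ≈⟨ sum-* N₁ D₁ (λ x → A (P α) x * P α x) ⟩
          sum {N₁} (λ v → sum {D₁} (λ k → P α (rotᶠ G₁ (combine v k)) * P α (combine v k)))
            ≈⟨ sum-cong {N₁} (λ v → sum-cong {D₁} (λ k → reflexive (≡.cong₂ _*_
                 (≡.trans (≡.cong (P α) (rotᶠ-combine G₁ v k)) (Pα≡ _ _)) (Pα≡ v k)))) ⟩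
          sum {N₁} (λ v → sum {D₁} (λ k → a (n v k) * a v))
            ≈⟨ sum-cong {N₁} (λ v → *-distribʳ-sum (a v) (λ k → a (n v k))) ⟨
          sum {N₁} (λ v → sum {D₁} (λ k → a (n v k)) * a v)
            ≈⟨ sum-cong {N₁} (λ v → average (sum {D₁} (λ k → a (n v k))) (a v)) ⟩
          sum {N₁} (λ v → fromℕ D₁ * (walk G₁ a v * a v))
            ≈⟨ *-distribˡ-sum (fromℕ D₁) (λ v → walk G₁ a v * a v) ⟨
          fromℕ D₁ * ⟨ walk G₁ a , a ⟩ ∎
          where
          n : Fin N₁ → Fin D₁ → Fin N₁
          n v k = proj₁ (rot G₁ (v , k))
          average : ∀ s x → s * x ≈ fromℕ D₁ * (d * s * x)
          average s x = begin-equality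
            s * x                    ≈⟨ *-identityˡ _ ⟨
            1# * (s * x)             ≈⟨ *-congʳ (*-inverseʳ (fromℕ D₁) (fromℕ≉0 D₁)) ⟨
            fromℕ D₁ * d * (s * x)   ≈⟨ solve 4 (λ n d s x → n :* d :* (s :* x) := n :* (d :* s :* x)) refl (fromℕ D₁) d s x ⟩
            fromℕ D₁ * (d * s * x)   ∎

      -- Subtracting the mean makes the vector balanced on every single copy, so λ₂ applies copy by
      -- copy.
      B-off-clouds : ∀ α → let γ = 1# • α ⊕ (- 1#) • P α in ⟨ B γ , B γ ⟩ ≤ m * m * ⟨ γ , γ ⟩
      B-off-clouds α = cloudwise-bound {N₁} (walk G₂) (m * m) γ (λ v → walk-bound G₂ 0≤m G₂-exp (cloud {N₁} γ v) (γ⊥𝟙 v))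
        where
        γ = 1# • α ⊕ (- 1#) • P α
        γ⊥𝟙 : ∀ v → Balanced (cloud {N₁} γ v)
        γ⊥𝟙 v = begin-equality
          ⟨ cloud {N₁} γ v , 𝟙 ⟩
            ≈⟨ ⟨⟩-cong {β = 𝟙} (λ k → +-congˡ (*-congˡ (reflexive (cloudwise-combine {N₁} (walk complete) α v k)))) (λ _ → refl) ⟩
          ⟨ 1# • c ⊕ (- 1#) • walk complete c , 𝟙 ⟩     ≈⟨ ⟨⟩-linearˡ 1# (- 1#) c (walk complete c) 𝟙 ⟩
          1# * ⟨ c , 𝟙 ⟩ + - 1# * ⟨ walk complete c , 𝟙 ⟩ ≈⟨ +-congˡ (*-congˡ (Symmetric.symmetric (walk-symmetric complete) c 𝟙)) ⟩
          1# * ⟨ c , 𝟙 ⟩ + - 1# * ⟨ c , walk complete 𝟙 ⟩ ≈⟨ +-congˡ (*-congˡ (⟨⟩-cong {α = c} (λ _ → refl) (walk-const complete 1#))) ⟩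
          1# * ⟨ c , 𝟙 ⟩ + - 1# * ⟨ c , 𝟙 ⟩ ≈⟨ solve 1 (λ x → :1 :* x :+ (:- :1) :* x := :0) refl ⟨ c , 𝟙 ⟩ ⟩
          0# ∎
          where c = cloud {N₁} α v

      -- P α is constant on each copy and walks fix constants. `complete` yields P P = P, and G₂
      -- yields B P = P.
      cloudwise-fixes-P : ∀ {D} (H : RegularGraph D₁ D) .{{_ : NonZero D}} → ∀ α → cloudwise {N₁} (walk H) (P α) ≋ P α
      cloudwise-fixes-P H α x =
        let (v , k) = remQuot {N₁} D₁ x in
        trans (Symmetric.T-cong (walk-symmetric H) (λ k → reflexive (cloudwise-combine {N₁} (walk complete) α v k)) k)
              (walk-const H (mean α v) k)

      zigzag : ZigZag A B P l m
      zigzag = record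
        { A-sym        = record
          { T-cong    = λ α≋β x → α≋β (rotᶠ G₁ x)
          ; linear    = λ _ _ _ _ _ → refl
          ; symmetric = λ α β → trans
              (sum-cong (λ x → *-congˡ (reflexive (≡.cong β (≡.sym (rotᶠ-involutive G₁ x))))))
              (sum-involution (λ x → α x * β (rotᶠ G₁ x)) (rotᶠ G₁) (rotᶠ-involutive G₁))
          }
        ; A-contr      = λ α → ≤-reflexive (sum-involution (λ x → α x * α x) (rotᶠ G₁) (rotᶠ-involutive G₁))
        ; A-involutive = λ α x → reflexive (≡.cong α (rotᶠ-involutive G₁ x))
        ; B-sym        = cloudwise-symmetric {N₁} (walk-symmetric G₂)
        ; B-contr      = cloudwise-contraction {N₁} (walk-contraction G₂)
        ; P-sym        = cloudwise-symmetric {N₁} (walk-symmetric complete)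
        ; P-idem       = cloudwise-fixes-P complete
        ; BP           = cloudwise-fixes-P G₂
        ; A-on-P       = A-on-clouds
        ; B-on-P⊥      = B-off-clouds
        }

    open EdgeWeights D₂

    M : Vector (N₁ ℕ.* D₁) → Vector (N₁ ℕ.* D₁)
    M = combination a A b B

    -- The last label is a step of A with weight a. The other D₂ labels have weight a each, and
    -- their sum is b times the average that B takes.
    walk-G : ∀ α → walk G α ≋ M α
    walk-G α x = begin-equality
      a * sum (λ i → α (proj₁ (rot G (x , i))))
        ≈⟨ *-congˡ (sum-+ D₂ {1} (λ i → α (proj₁ (rot G (x , i))))) ⟩
      a * (sum (λ i → α (proj₁ (rot G (x , i ↑ˡ 1)))) + (α (proj₁ (rot G (x , D₂ ↑ʳ zero))) + 0#))
        ≈⟨ *-congˡ (+-cong (sum-cong {D₂} (λ i → reflexive (step₂ i))) (trans (+-identityʳ _) (reflexive step₁))) ⟩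
      a * (S + A α x)
        ≈⟨ solve 3 (λ a s y → a :* (s :+ y) := a :* y :+ :1 :* (a :* s)) refl a S (A α x) ⟩
      a * A α x + 1# * (a * S)
        ≈⟨ +-congˡ (*-congʳ (*-inverseʳ (fromℕ D₂) (fromℕ≉0 D₂))) ⟨
      a * A α x + fromℕ D₂ * fromℕ D₂ ⁻¹ * (a * S)
        ≈⟨ +-congˡ (solve 4 (λ n i a s → n :* i :* (a :* s) := n :* a :* (i :* s)) refl (fromℕ D₂) (fromℕ D₂ ⁻¹) a S) ⟩
      a * A α x + b * (fromℕ D₂ ⁻¹ * S) ∎
      where
      v = proj₁ (remQuot {N₁} D₁ x)
      k = proj₂ (remQuot {N₁} D₁ x)
      S = sum (λ i → α (combine v (proj₁ (rot G₂ (k , i)))))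
      step₂ : ∀ i → α (proj₁ (rot G (x , i ↑ˡ 1))) ≡ α (combine v (proj₁ (rot G₂ (k , i))))
      step₂ i rewrite splitAt-↑ˡ D₂ i 1 = ≡.refl
      step₁ : α (proj₁ (rot G (x , D₂ ↑ʳ zero))) ≡ A α x
      step₁ rewrite splitAt-↑ʳ D₂ 1 zero = ≡.refl

  expansion : Carrier → Carrier → ℕ → Carrier
  expansion λ₁ λ₂ D₂ = (1# - p D₂) + p D₂ * f λ₁ λ₂

  module _ {λ₁ λ₂} (λ₁∈ : InUnitInterval λ₁) (λ₂∈ : InUnitInterval λ₂) (D₂ : ℕ) .{{_ : NonZero D₂}} where

    open EdgeWeights D₂

    expansion-nonNeg : 0# ≤ expansion λ₁ λ₂ D₂
    expansion-nonNeg = +-nonNeg (0≤y-x p≤1) (*-nonNeg p-nonNeg (f-nonNeg λ₁∈ λ₂∈))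

    replacement-expander : ∀ {N₁ D₁} .{{_ : NonZero N₁}} .{{_ : NonZero D₁}}
      (G₁ : RegularGraph N₁ D₁) (G₂ : RegularGraph D₁ D₂) → IsExpander G₁ λ₁ → IsExpander G₂ λ₂ →
      IsExpander (relabel *↔× (replacementProduct G₁ G₂)) (∛ (expansion λ₁ λ₂ D₂))
    replacement-expander {N₁} {D₁} G₁ G₂ G₁-exp G₂-exp =
      expander {{ℕ.m*n≢0 N₁ D₁}} {{D₂+1≢0}} G 0≤r (λ α α⊥𝟙 → begin
        ⟨ walk G α , walk G α ⟩   ≈⟨ ⟨⟩-cong (walk-G α) (walk-G α) ⟩
        ⟨ M α , M α ⟩             ≤⟨ norm-from-cube M-symmetric α 0≤r (begin
          ⟨ M (M (M α)) , M (M (M α)) ⟩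
            ≤⟨ norm-from-form (sandwich-symmetric M-symmetric M-symmetric)
                 (λ β β⊥𝟙 → M-balanced (M (M β)) (M-balanced (M β) (M-balanced β β⊥𝟙)))
                 expansion-nonNeg M³-form α α⊥𝟙 ⟩
          c * c * ⟨ α , α ⟩           ≈⟨ *-congʳ (*-cong r³≈c r³≈c) ⟨
          r ^ 3 * r ^ 3 * ⟨ α , α ⟩   ∎) ⟩
        r * r * ⟨ α , α ⟩         ∎)
      where
      open Product G₁ G₂
      c = expansion λ₁ λ₂ D₂
      r = ∛ c
      0≤r : 0# ≤ r
      0≤r = root-nonNeg 3 c
      r³≈c : r ^ 3 ≈ c
      r³≈c = root-^ 3 expansion-nonNeg
      zz = zigzag (proj₁ λ₁∈) (proj₁ λ₂∈) G₁-exp G₂-exp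
      M-symmetric : Symmetric M
      M-symmetric = combination-symmetric a b (ZigZag.A-sym zz) (ZigZag.B-sym zz)
      M-balanced : ∀ α → Balanced α → Balanced (M α)
      M-balanced α α⊥𝟙 = trans (⟨⟩-cong {β = 𝟙} (λ x → sym (walk-G α x)) (λ _ → refl))
                               (walk-balanced G {{D₂+1≢0}} α α⊥𝟙)
      M³-form : ∀ {σ} → Sign σ → ∀ α → Balanced α → σ * ⟨ M (M (M α)) , α ⟩ ≤ c * ⟨ α , α ⟩
      M³-form {σ} σ²≈1 α α⊥𝟙 = begin
        σ * ⟨ M (M (M α)) , α ⟩
          ≤⟨ ZigZagProperties.cube-form zz λ₁∈ λ₂∈ (f-nonNeg λ₁∈ λ₂∈) (f-quadratic λ₁∈ λ₂∈) (f-larger-root λ₁∈ λ₂∈)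
               0≤a 0≤b a+b≈1 σ²≈1 α α⊥𝟙 ⟩
        (1# - a * b * b + a * b * b * f λ₁ λ₂) * ⟨ α , α ⟩
          ≈⟨ *-congʳ (+-cong (+-congˡ (-‿cong p≈ab²)) (*-congʳ p≈ab²)) ⟨
        c * ⟨ α , α ⟩ ∎

    -- If the cube root were at least 1, so would be 1 - p + p f; then p ≤ p f, and p > 0 gives f ≥
    -- 1, which forces λ₁ or λ₂ to be 1.
    expansion<1 : λ₁ < 1# → λ₂ < 1# → ∛ (expansion λ₁ λ₂ D₂) < 1#
    expansion<1 (_ , λ₁≉1) (_ , λ₂≉1) = [ (λ r≤1 → r≤1) , (λ 1≤r → contradiction 1≤r 1≰r) ]′ (total r 1#) ,
      (λ r≈1 → 1≰r (≤-reflexive (sym r≈1)))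
      where
      c = expansion λ₁ λ₂ D₂
      r = ∛ c
      F = f λ₁ λ₂
      1≰r : ¬ 1# ≤ r
      1≰r 1≤r = [ λ₁≉1 , λ₂≉1 ]′ (1≤f⇒λ≈1 λ₁∈ λ₂∈ (*-cancelˡ-≤ p-nonNeg p≉0 (begin
        p D₂ * 1#                    ≈⟨ solve 1 (λ p → p :* :1 := p :- :1 :+ :1 :^ 3) refl (p D₂) ⟩
        p D₂ - 1# + 1# ^ 3           ≤⟨ +-monoʳ-≤ _ (^-mono-≤ 3 0≤1 1≤r) ⟩
        p D₂ - 1# + r ^ 3            ≈⟨ +-congˡ (root-^ 3 expansion-nonNeg) ⟩
        p D₂ - 1# + c                ≈⟨ solve 2 (λ p F → p :- :1 :+ (:1 :- p :+ p :* F) := p :* F) refl (p D₂) F ⟩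
        p D₂ * F                     ∎)))

-- Numerals and the program for the rotation map.

digits-injective : ∀ x y → digits x ≡ digits y → x ≡ y
digits-injective ℕᵇ.zero  ℕᵇ.zero  eq = ≡.refl
digits-injective 2[1+ x ] 2[1+ y ] eq = ≡.cong 2[1+_] (digits-injective x y (∷-injectiveʳ eq))
digits-injective 1+[2 x ] 1+[2 y ] eq = ≡.cong 1+[2_] (digits-injective x y (∷-injectiveʳ eq))

encode-injective : ∀ {m n} → encode m ≡ encode n → m ≡ n
encode-injective eq = ℕᵇ.fromℕ-injective (digits-injective _ _ eq)

-- The least bijective numeral with ℓ digits consists of digits 1 only and has the value 2^ℓ - 1.
2^length-digits : ∀ b → 2 ℕ.^ length (digits b) ℕ.≤ suc (ℕᵇ.toℕ b)
2^length-digits ℕᵇ.zero  = s≤s z≤n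
2^length-digits 2[1+ b ] = ℕ.≤-trans (ℕ.*-monoʳ-≤ 2 (2^length-digits b)) (ℕ.n≤1+n _)
2^length-digits 1+[2 b ] = ℕ.≤-trans (ℕ.*-monoʳ-≤ 2 (2^length-digits b))
  (ℕ.≤-reflexive (ℕ.*-suc 2 (ℕᵇ.toℕ b)))

length-encode : ∀ n .{{_ : NonZero n}} → length (encode n) ℕ.≤ 1 ℕ.+ ⌊log₂ n ⌋
length-encode n = begin
  length (encode n)                      ≡⟨ ⌊log₂[2^n]⌋≡n (length (encode n)) ⟨
  ⌊log₂ 2 ℕ.^ length (encode n) ⌋        ≤⟨ ⌊log₂⌋-mono-≤ (begin
    2 ℕ.^ length (encode n)                ≤⟨ 2^length-digits (ℕᵇ.fromℕ n) ⟩
    suc (ℕᵇ.toℕ (ℕᵇ.fromℕ n))              ≡⟨ ≡.cong suc (ℕᵇ.toℕ-fromℕ n) ⟩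
    1 ℕ.+ n                                ≤⟨ ℕ.+-monoˡ-≤ n (ℕ.>-nonZero⁻¹ n) ⟩
    n ℕ.+ n                                ≡⟨ ≡.cong (n ℕ.+_) (ℕ.+-identityʳ n) ⟨
    2 ℕ.* n                                ∎) ⟩
  ⌊log₂ (2 ℕ.* n) ⌋                      ≡⟨ ⌊log₂[2*b]⌋≡1+⌊log₂b⌋ n ⟩
  1 ℕ.+ ⌊log₂ n ⌋                        ∎
  where open ℕ.≤-Reasoning

-- Register 6 holds the part of i already read, reversed, and register 7 is
-- nonempty as soon as i is known to differ from D₂.
private
  Prog : Set
  Prog = Program 8 2

record-mismatch : Bool → Bool → Prog
record-mismatch false false = skip
record-mismatch true  true  = skip
record-mismatch _     _     = push 7F true

read : Bool → Prog
read b = pop 5F (push 7F true) (push 6F false ⨾ record-mismatch b false)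
                               (push 6F true  ⨾ record-mismatch b true)

-- Register 5 has to be refilled after the comparison: i is either part of the question to G₂ or
-- returned unchanged. Every branch of the last `pop` makes exactly one query, on (v , k) for G₁ and
-- on (k , i) for G₂.
compare restore rotate : Prog
compare = while 2F (pop 2F skip (read false) (read true))
        -- A leftover bit shows that i is the longer word; it is put back after being noticed.
        ⨾ pop 5F skip (push 5F false ⨾ push 7F true) (push 5F true ⨾ push 7F true)
restore = while 6F (pop 6F skip (push 5F false) (push 5F true))
rotate  = compare ⨾ restore ⨾ pop 7F (query 0F 3F 4F) (query 1F 4F 5F) (query 1F 4F 5F)

mismatch : Bool → Bool → Word → Word
mismatch false false f = f
mismatch true  true  f = f
mismatch _     _     f = true ∷ f

mismatch-refl : ∀ b f → mismatch b b f ≡ f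
mismatch-refl false f = ≡.refl
mismatch-refl true  f = ≡.refl

-- The contents of registers 5, 6 and 7 after the loop of compare.
scan : (w i c f : Word) → Word × Word × Word
scan []      i       c f = i , c , f
scan (b ∷ w) []      c f = scan w [] c (true ∷ f)
scan (b ∷ w) (x ∷ i) c f = scan w i (x ∷ c) (mismatch b x f)

-- Bits only move from i to the reversed prefix, so `restore`, which moves them back, recovers the
-- label.
scan-rebuild : ∀ w i c f → let (i′ , c′ , _) = scan w i c f in c′ ʳ++ i′ ≡ c ʳ++ i
scan-rebuild []      i       c f = ≡.refl
scan-rebuild (b ∷ w) []      c f = scan-rebuild w [] c (true ∷ f)
scan-rebuild (b ∷ w) (x ∷ i) c f = scan-rebuild w i (x ∷ c) (mismatch b x f)

scan-length : ∀ w i c f → let (_ , c′ , _) = scan w i c f in length c′ ℕ.≤ length c ℕ.+ length w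
scan-length []      i       c f = ℕ.m≤m+n (length c) 0
scan-length (b ∷ w) []      c f = ℕ.≤-trans (scan-length w [] c (true ∷ f)) (ℕ.+-monoʳ-≤ (length c) (ℕ.n≤1+n _))
scan-length (b ∷ w) (x ∷ i) c f = ℕ.≤-trans (scan-length w i (x ∷ c) (mismatch b x f))
  (ℕ.≤-reflexive (≡.sym (ℕ.+-suc (length c) (length w))))

flag : Word → Word → Word
flag []      f = f
flag (_ ∷ _) f = true ∷ f

outcome : (w i c f : Word) → Word
outcome w i c f = let (i′ , _ , f′) = scan w i c f in flag i′ f′

outcome-equal : ∀ w c f → outcome w w c f ≡ f
outcome-equal []      c f = ≡.refl
outcome-equal (b ∷ w) c f =
  ≡.trans (≡.cong (outcome w w (b ∷ c)) (mismatch-refl b f)) (outcome-equal w (b ∷ c) f)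

flag-flagged : ∀ i {f} → f ≢ [] → flag i f ≢ []
flag-flagged []      f≢[] = f≢[]
flag-flagged (_ ∷ _) f≢[] = λ ()

mismatch-flagged : ∀ b x {f} → f ≢ [] → mismatch b x f ≢ []
mismatch-flagged false false f≢[] = f≢[]
mismatch-flagged false true  f≢[] = λ ()
mismatch-flagged true  false f≢[] = λ ()
mismatch-flagged true  true  f≢[] = f≢[]

-- Register 7 only grows during a comparison, so a mismatch once found is never forgotten.
outcome-flagged : ∀ w i c {f} → f ≢ [] → outcome w i c f ≢ []
outcome-flagged []      i       c f≢[] = flag-flagged i f≢[]
outcome-flagged (b ∷ w) []      c f≢[] = outcome-flagged w [] c (λ ())
outcome-flagged (b ∷ w) (x ∷ i) c f≢[] = outcome-flagged w i (x ∷ c) (mismatch-flagged b x f≢[])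

-- The first differing position, or the end of the shorter word, raises the flag.
outcome-differs : ∀ w i c f → i ≢ w → outcome w i c f ≢ []
outcome-differs []      []      c f i≢w = contradiction ≡.refl i≢w
outcome-differs []      (x ∷ i) c f i≢w = λ ()
outcome-differs (b ∷ w) []      c f i≢w = outcome-flagged w [] c (λ ())
outcome-differs (false ∷ w) (false ∷ i) c f i≢w =
  outcome-differs w i (false ∷ c) f (λ i≡w → i≢w (≡.cong (false ∷_) i≡w))
outcome-differs (true  ∷ w) (true  ∷ i) c f i≢w =
  outcome-differs w i (true ∷ c) f (λ i≡w → i≢w (≡.cong (true ∷_) i≡w))
outcome-differs (false ∷ w) (true  ∷ i) c f i≢w = outcome-flagged w i (true ∷ c) (λ ())
outcome-differs (true  ∷ w) (false ∷ i) c f i≢w = outcome-flagged w i (false ∷ c) (λ ())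

-- Runs of the program and their cost.

module _ {O : Fin 2 → Oracle} {n d v k : Word} where

  private
    regs : Word → Word → Word → Word → Vec Word 8
    regs w i c f = n ∷ d ∷ w ∷ v ∷ k ∷ i ∷ c ∷ f ∷ []

  run-mismatch : ∀ b x {w i c f} → Run O (record-mismatch b x) (regs w i c f) (regs w i c (mismatch b x f)) 1 0
  run-mismatch false false = skip
  run-mismatch false true  = push
  run-mismatch true  false = push
  run-mismatch true  true  = skip

  run-read : ∀ b x {w i c f} →
    Run O (read b) (regs w (x ∷ i) c f) (regs w i (x ∷ c) (mismatch b x f)) 3 0
  run-read b false = pop-0 ≡.refl (push ⨾ run-mismatch b false)
  run-read b true  = pop-1 ≡.refl (push ⨾ run-mismatch b true)

  run-step : ∀ b {w i c f τ t} → Run O (read b) (regs w i c f) τ t 0 →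
    Run O (pop 2F skip (read false) (read true)) (regs (b ∷ w) i c f) τ (1 ℕ.+ t) 0
  run-step false run = pop-0 ≡.refl run
  run-step true  run = pop-1 ≡.refl run

  -- A pass costs 5 steps while i lasts: the loop test, the pop of a bit of D₂ and the 3 steps of
  -- `read`. It costs 4 afterwards, and the final test costs 1.
  run-scan : ∀ w i c f → let (i′ , c′ , f′) = scan w i c f in
    ∃[ t ] Run O (while 2F (pop 2F skip (read false) (read true))) (regs w i c f) (regs [] i′ c′ f′) t 0
         × t ℕ.≤ 1 ℕ.+ length w ℕ.* 5
  run-scan []      i       c f = 1 , while-∅ ≡.refl , ℕ.≤-refl
  run-scan (b ∷ w) []      c f =
    let (t , run , t≤) = run-scan w [] c (true ∷ f) in
    4 ℕ.+ t , while-∷ (λ ()) (run-step b (pop-∅ ≡.refl push)) run , ℕ.+-monoʳ-≤ 4 (ℕ.≤-trans t≤ (ℕ.n≤1+n _))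
  run-scan (b ∷ w) (x ∷ i) c f =
    let (t , run , t≤) = run-scan w i (x ∷ c) (mismatch b x f) in
    5 ℕ.+ t , while-∷ (λ ()) (run-step b (run-read b x)) run , ℕ.+-monoʳ-≤ 5 t≤

  run-flag : ∀ i {c f} → ∃[ t ]
    Run O (pop 5F skip (push 5F false ⨾ push 7F true) (push 5F true ⨾ push 7F true))
          (regs [] i c f) (regs [] i c (flag i f)) t 0
    × t ℕ.≤ 3
  run-flag []          = 2 , pop-∅ ≡.refl skip , s≤s (s≤s z≤n)
  run-flag (false ∷ i) = 3 , pop-0 ≡.refl (push ⨾ push) , ℕ.≤-refl
  run-flag (true  ∷ i) = 3 , pop-1 ≡.refl (push ⨾ push) , ℕ.≤-refl

  run-restore : ∀ c {i f} → Run O restore (regs [] i c f) (regs [] (c ʳ++ i) [] f) (1 ℕ.+ length c ℕ.* 3) 0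
  run-restore []          = while-∅ ≡.refl
  run-restore (false ∷ c) = while-∷ (λ ()) (pop-0 ≡.refl push) (run-restore c)
  run-restore (true  ∷ c) = while-∷ (λ ()) (pop-1 ≡.refl push) (run-restore c)

  -- Stated for an arbitrary continuation P, so that both choices of the oracle share it. The total
  -- is (1 + 5 ℓ) + 3 for `compare` and 1 + 3 ℓ for `restore`, where ℓ is the length of w.
  run-comparison : ∀ w i → ∃[ t ] ∃[ t′ ] t ℕ.+ t′ ℕ.≤ 5 ℕ.+ length w ℕ.* 8 ×
    (∀ {P τ u q} → Run O P (regs [] i [] (outcome w i [] [])) τ u q →
                   Run O (compare ⨾ restore ⨾ P) (regs w i [] []) τ (t ℕ.+ (t′ ℕ.+ u)) q)
  run-comparison w i =
    let (i′ , c′ , f′) = scan w i [] []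
        (t₁ , run₁ , t₁≤) = run-scan w i [] []
        (t₂ , run₂ , t₂≤) = run-flag i′ {c′} {f′}
    in t₁ ℕ.+ t₂ , 1 ℕ.+ length c′ ℕ.* 3 ,
       (begin
         t₁ ℕ.+ t₂ ℕ.+ (1 ℕ.+ length c′ ℕ.* 3)
           ≤⟨ ℕ.+-mono-≤ (ℕ.+-mono-≤ t₁≤ t₂≤) (s≤s (ℕ.*-monoˡ-≤ 3 (scan-length w i [] []))) ⟩
         1 ℕ.+ length w ℕ.* 5 ℕ.+ 3 ℕ.+ (1 ℕ.+ length w ℕ.* 3)
           ≡⟨ solve 1 (λ l → con 1 :+ l :* con 5 :+ con 3 :+ (con 1 :+ l :* con 3) := con 5 :+ l :* con 8) ≡.refl (length w) ⟩
         5 ℕ.+ length w ℕ.* 8 ∎) ,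
       -- `restore` ends with `c′ ʳ++ i′` in register 5, which equals i only propositionally.
       λ run → (run₁ ⨾ run₂) ⨾ (≡.subst (λ i → Run O restore (regs [] i′ c′ (flag i′ f′)) (regs [] i [] (flag i′ f′)) (1 ℕ.+ length c′ ℕ.* 3) 0)
                                   (scan-rebuild w i [] []) (run-restore c′) ⨾ run)
    where
    open ℕ.≤-Reasoning
    open +-*-Solver using (solve; con; _:+_; _:*_; _:=_)

  -- The flag is tracked only as being nonempty, hence the same program for either popped bit.
  run-flagged : ∀ {f} → f ≢ [] → ∃[ f′ ] (∀ {P P′ w i c τ t q} →
    Run O P′ (regs w i c f′) τ t q → Run O (pop 7F P P′ P′) (regs w i c f) τ (1 ℕ.+ t) q)
  run-flagged {[]}        f≢[] = contradiction ≡.refl f≢[]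
  run-flagged {false ∷ f} f≢[] = f , pop-0 ≡.refl
  run-flagged {true ∷ f}  f≢[] = f , pop-1 ≡.refl

module _ {N₁ D₁ D₂} .{{_ : NonZero D₂}} (G₁ : RegularGraph N₁ D₁) (G₂ : RegularGraph D₁ D₂)
  (v : Fin N₁) (k : Fin D₁) where

  private
    Correct : Fin (D₂ ℕ.+ 1) → Set
    Correct i = ∃[ τ ] ∃[ t ]
      (Run (rotOracles G₁ G₂) rotate (input N₁ D₁ D₂ 2 v k i) τ t 1
      × Outputs τ (rot (replacementProduct G₁ G₂) ((v , k) , i))
      × t ℕ.≤ 15 ℕ.+ 8 ℕ.* ⌊log₂ D₂ ⌋)

    -- 15 = 5 + 8 + 2: the code of D₂ may have one bit more than its logarithm, and the closing
    -- `pop` and `query` cost 2.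
    time : ∀ t t′ → t ℕ.+ t′ ℕ.≤ 5 ℕ.+ length (encode D₂) ℕ.* 8 → t ℕ.+ (t′ ℕ.+ 2) ℕ.≤ 15 ℕ.+ 8 ℕ.* ⌊log₂ D₂ ⌋
    time t t′ t≤ = begin
      t ℕ.+ (t′ ℕ.+ 2)                           ≡⟨ ℕ.+-assoc t t′ 2 ⟨
      t ℕ.+ t′ ℕ.+ 2                             ≤⟨ ℕ.+-monoˡ-≤ 2 t≤ ⟩
      5 ℕ.+ length (encode D₂) ℕ.* 8 ℕ.+ 2       ≤⟨ ℕ.+-monoˡ-≤ 2 (ℕ.+-monoʳ-≤ 5 (ℕ.*-monoˡ-≤ 8 (length-encode D₂))) ⟩
      5 ℕ.+ (1 ℕ.+ ⌊log₂ D₂ ⌋) ℕ.* 8 ℕ.+ 2       ≡⟨ solve 1 (λ l → con 5 :+ (con 1 :+ l) :* con 8 :+ con 2 := con 15 :+ con 8 :* l) ≡.refl ⌊log₂ D₂ ⌋ ⟩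
      15 ℕ.+ 8 ℕ.* ⌊log₂ D₂ ⌋                    ∎
      where
      open ℕ.≤-Reasoning
      open +-*-Solver using (solve; con; _:+_; _:*_; _:=_)

    -- A label of G₂ has a number below D₂, so its word differs from that of D₂. Its embedding keeps
    -- the number, so the words exchanged with the oracle are those of the product.
    correct-inner : ∀ j → Correct (j ↑ˡ 1)
    correct-inner j rewrite splitAt-↑ˡ D₂ j 1 =
      let (m , j′) = rot G₂ (k , j)
          (t , t′ , t≤ , run) = run-comparison (encode D₂) (code (j ↑ˡ 1))
          (_ , run-pop) = run-flagged differs
      in _ , _ ,
         run (run-pop (query {x = 1F} {c = code m} {d = code j′} (k , j , ≡.refl , ≡.cong encode (toℕ-↑ˡ j 1) , ≡.refl , ≡.refl))) ,
         (≡.refl , ≡.refl , ≡.cong encode (≡.sym (toℕ-↑ˡ j′ 1))) ,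
         time t t′ t≤
      where
      differs : outcome (encode D₂) (code (j ↑ˡ 1)) [] [] ≢ []
      differs = outcome-differs (encode D₂) (code (j ↑ˡ 1)) [] [] (λ eq →
        ℕ.<⇒≢ (toℕ<n j) (≡.trans (≡.sym (toℕ-↑ˡ j 1)) (encode-injective eq)))

    -- The number of the last label is D₂ + 0, so its word is the content of register 2 and no flag
    -- is raised.
    correct-outer : Correct (D₂ ↑ʳ 0F)
    correct-outer rewrite splitAt-↑ʳ D₂ 1 0F =
      let (w , l) = rot G₁ (v , k)
          (t , t′ , t≤ , run) = run-comparison (encode D₂) (code (D₂ ↑ʳ 0F))
      in _ , _ ,
         run (pop-∅ agrees (query {x = 0F} {c = code w} {d = code l} (v , k , ≡.refl , ≡.refl , ≡.refl , ≡.refl))) ,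
         (≡.refl , ≡.refl , ≡.refl) ,
         time t t′ t≤
      where
      agrees : outcome (encode D₂) (code (D₂ ↑ʳ 0F)) [] [] ≡ []
      agrees = ≡.subst (λ w → outcome (encode D₂) w [] [] ≡ [])
        (≡.cong encode (≡.sym (≡.trans (toℕ-↑ʳ D₂ 0F) (ℕ.+-identityʳ D₂)))) (outcome-equal (encode D₂) [] [])

  rotate-correct : ∀ i → Correct i
  rotate-correct i = by-label (splitAt D₂ i) ≡.refl
    where
    by-label : ∀ l → splitAt D₂ i ≡ l → Correct i
    by-label (inj₁ j)  eq = ≡.subst Correct (splitAt⁻¹-↑ˡ eq) (correct-inner j)
    by-label (inj₂ 0F) eq = ≡.subst Correct (splitAt⁻¹-↑ʳ eq) correct-outer

theorem6p4 :
  ((ℝ : CompleteOrderedField) →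
    let open CompleteOrderedField ℝ
        open Spectral ℝ
    in
    Σ[ g ∈ (Carrier → Carrier → ℕ → Carrier) ]
      ((λ₁ λ₂ : Carrier) → InUnitInterval λ₁ → InUnitInterval λ₂ →
       (D₂ : ℕ) → .{{_ : NonZero D₂}} →
         ((N₁ D₁ : ℕ) → .{{_ : NonZero N₁}} → .{{_ : NonZero D₁}} →
          (G₁ : RegularGraph N₁ D₁) (G₂ : RegularGraph D₁ D₂) →
          IsExpander G₁ λ₁ → IsExpander G₂ λ₂ →
          IsExpander (relabel *↔× (replacementProduct G₁ G₂)) (g λ₁ λ₂ D₂))
       × g λ₁ λ₂ D₂ ≤ ∛ ((1# - p D₂) + p D₂ * f λ₁ λ₂)
       × (λ₁ < 1# → λ₂ < 1# → g λ₁ λ₂ D₂ < 1#)))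
  × (∃[ work ] Σ[ P ∈ Program (6 ℕ.+ work) 2 ] Σ[ B ∈ Polynomial 3 ]
      ((N₁ D₁ D₂ : ℕ) → .{{_ : NonZero N₁}} → .{{_ : NonZero D₁}} → .{{_ : NonZero D₂}} →
       (G₁ : RegularGraph N₁ D₁) (G₂ : RegularGraph D₁ D₂) →
       (v : Fin N₁) (k : Fin D₁) (i : Fin (D₂ ℕ.+ 1)) →
       ∃[ τ ] ∃[ t ]
         (Run (rotOracles G₁ G₂) P (input N₁ D₁ D₂ work v k i) τ t 1
         × Outputs τ (Graph.rot (replacementProduct G₁ G₂) ((v , k) , i))
         × t ℕ.≤ ⟦ B ⟧ (⌊log₂ N₁ ⌋ ∷ ⌊log₂ D₁ ⌋ ∷ ⌊log₂ D₂ ⌋ ∷ []))))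
theorem6p4 =
    (λ ℝ → let open ReplacementExpansion ℝ in
      (λ λ₁ λ₂ D₂ → ∛ (expansion λ₁ λ₂ D₂)) ,
      λ λ₁ λ₂ λ₁∈ λ₂∈ D₂ →
        (λ N₁ D₁ G₁ G₂ → replacement-expander λ₁∈ λ₂∈ D₂ G₁ G₂) , ≤-refl , expansion<1 λ₁∈ λ₂∈ D₂)
  , 2 , rotate , con 15 :+ con 8 :* var 2F
  , λ N₁ D₁ D₂ G₁ G₂ v k i → rotate-correct G₁ G₂ v k i
  where open +-*-Solver using (con; var; _:+_; _:*_)
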